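{- For every integer $r \ge 2$ and positive integers $s_1,\ldots,s_r$, letting $s := \sum_{i=1}^r s_i$, we have \[ f_{K_{s_1,\ldots,s_r}, K_{r+2}}(n) = O\left( n^{\frac{2s-3}{4s-5}} (\log n)^3 \right). \]
   Context: $K_{s_1,\ldots,s_r}$ is the complete $r$-partite graph with parts of sizes $s_1,\ldots,s_r$; $K_{r+2}$ is the complete graph on $r+2$ vertices. For graphs $F$ and $G$, a set $S\subseteq V(G)$ is $F$-independent if $G[S]$ contains no copy of $F$ as a subgraph; $\alpha_F(G)$ is the maximum size of an $F$-independent set in $G$; $f_{F,H}(n)$ is the minimum of $\alpha_F(G)$ over all $n$-vertex $H$-free graphs $G$. -}

module Defs where

open import Data.Nat using (ℕ; zero; suc; _+_; _*_; _∸_; _^_; _≤_)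
open import Data.Bool using (Bool; true; false; not)
open import Data.Fin using (Fin; zero; suc; _≟_)
open import Data.Fin.Subset using (Subset; _∈_; ∣_∣)
open import Data.Product using (Σ; _×_)
open import Relation.Binary.PropositionalEquality using (_≡_)
open import Relation.Nullary.Decidable using (⌊_⌋)
open import Function.Definitions using (Injective)

record Graph (V : Set) : Set where
  field
    adj   : V → V → Bool
    adj-sym   : ∀ u v → adj u v ≡ adj v u
    adj-irrefl : ∀ v → adj v v ≡ false
open Graph public

complete : (m : ℕ) → Graph (Fin m)
complete m = record
  { adj = λ i j → not ⌊ i ≟ j ⌋
  ; adj-sym = symP
  ; adj-irrefl = irr }
  where
  open import Relation.Nullary using (yes; no)
  open import Relation.Binary.PropositionalEquality using (refl; sym)
  symP : ∀ i j → not ⌊ i ≟ j ⌋ ≡ not ⌊ j ≟ i ⌋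
  symP i j with i ≟ j | j ≟ i
  ... | yes _ | yes _ = refl
  ... | no _  | no _  = refl
  ... | yes p | no q  with q (sym p)
  ... | ()
  symP i j | no q | yes p with q (sym p)
  ... | ()
  irr : ∀ i → not ⌊ i ≟ i ⌋ ≡ false
  irr i with i ≟ i
  ... | yes _ = refl
  ... | no q with q refl
  ... | ()

completeMultipartite : (r : ℕ) (s : Fin r → ℕ) → Graph (Σ (Fin r) (λ i → Fin (s i)))
completeMultipartite r s = record
  { adj = λ u v → not ⌊ Σ.proj₁ u ≟ Σ.proj₁ v ⌋
  ; adj-sym = λ u v → Graph.adj-sym (complete r) (Σ.proj₁ u) (Σ.proj₁ v)
  ; adj-irrefl = λ u → Graph.adj-irrefl (complete r) (Σ.proj₁ u) }

CopyIn : {W : Set} {n : ℕ} → Graph W → Graph (Fin n) → Subset n → Set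
CopyIn {W} F G S =
  Σ (W → _) λ φ →
    Injective _≡_ _≡_ φ ×
    (∀ w → φ w ∈ S) ×
    (∀ u v → adj F u v ≡ true → adj G (φ u) (φ v) ≡ true)

FIndependent : {W : Set} {n : ℕ} → Graph W → Graph (Fin n) → Subset n → Set
FIndependent F G S = CopyIn F G S → Data.Empty.⊥
  where import Data.Empty

Free : {W : Set} {n : ℕ} → Graph W → Graph (Fin n) → Set
Free H G = ∀ S → FIndependent H G S

αF≤ : {W : Set} {n : ℕ} → Graph W → Graph (Fin n) → ℕ → Set
αF≤ F G b = ∀ S → FIndependent F G S → ∣ S ∣ ≤ b

sumFin : (r : ℕ) → (Fin r → ℕ) → ℕ
sumFin zero s = 0
sumFin (suc r) s = s zero + sumFin r (λ i → s (suc i))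

{-# OPTIONS --safe #-}
module Submission where

-- Let q be a prime and consider the affine points of the Hermitian curve over the field with q² elements
-- and about q⁴ of its secant lines. Two lines share at most one curve point, and no four lines in general
-- position meet pairwise in six curve points. Colour the curve points on each line with r colours and join
-- two lines that meet in a curve point where their colours differ. A clique of size r + 2 would then need
-- r + 1 lines through one point, with distinct colours there, so the graph has no K_{r+2}; on the other hand,
-- s_i lines of colour i through one point for every i form a K_{s₁,…,s_r}.
--
-- Each of the n vertices chooses such a coloured line. Any family of more than about q² R coloured lines,
-- R being the number of colourings, has on average about q points per line in whose pencil all r colours
-- are frequent: a family that mostly avoids one colour i(P) at each point P is exponentially small.
-- A container argument with s - 1 batches of about q² / q^(1/(s-1)) selections, in which the degrees of
-- partially completed patterns stay balanced, shrinks such a family by a constant factor. Iterating it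
-- confines every pattern-free set to few families of size about q² R, so a suitable choice of the n lines
-- has no pattern-free set of T vertices when T is about log² q times that batch size and n is about T q².
--
-- Primes exist between y and 9 y log n, because a common multiple of 1, …, 2h + 1 is at least 4^h. This is
-- weaker than Bertrand's postulate, but the spare logarithms of the bound absorb the loss.

open import Defs
open import Algebra.Bundles using (CommutativeSemiring)
import Algebra.Solver.Ring.NaturalCoefficients.Default
open import Algebra.Structures.Biased using (isCommutativeSemiringˡ)
open import Data.Bool using (Bool; true; false; not; _∧_; _∨_; if_then_else_)
import Data.Bool as Bool
import Data.Bool.Properties as BoolP
open import Data.Empty using (⊥; ⊥-elim)
open import Data.Fin using (Fin; zero; suc; toℕ; fromℕ<)
import Data.Fin as Fin
import Data.Fin.Properties as FinP
open import Data.Fin.Subset using (Subset; ∣_∣)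
import Data.Fin.Subset as Subset
open import Data.Integer using (ℤ; 0ℤ; 1ℤ) renaming (_+_ to _+ᶻ_; _*_ to _*ᶻ_; _-_ to _-ᶻ_; -_ to -ᶻ_; ∣_∣ to absᶻ)
open import Data.Integer.DivMod using (_%ℕ_; _/ℕ_; n%ℕd<d; a≡a%ℕn+[a/ℕn]*n)
open import Data.Integer.Divisibility.Signed using (divides; ∣ᵤ⇒∣; ∣⇒∣ᵤ; ∣m∣n⇒∣m+n; ∣n⇒∣m*n; _∣?_) renaming (_∣_ to _∣ᶻ_)
import Data.Integer.Properties as ℤP
open import Data.Integer.Tactic.RingSolver renaming (solve-∀ to solveᶻ) using ()
open import Data.List using (List; []; _∷_; length; allFin; map; _++_; cartesianProduct; downFrom; _ʳ++_; reverse)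
import Data.List.Membership.Propositional.Properties as ∈P
open import Data.List.Membership.Propositional using (_∈_)
import Data.List.Properties as ListP
open import Data.List.Relation.Binary.Pointwise using (Pointwise; []; _∷_)
open import Data.List.Relation.Binary.Sublist.Propositional using (_⊆_; []; _∷_; _∷ʳ_)
import Data.List.Relation.Binary.Sublist.Propositional.Properties as Sub
open import Data.List.Relation.Unary.All using (All; []; _∷_)
import Data.List.Relation.Unary.All as All
open import Data.List.Relation.Unary.AllPairs using (AllPairs; []; _∷_)
open import Data.List.Relation.Unary.Any using (here; there)
open import Data.List.Relation.Unary.Unique.Propositional using (Unique)
import Data.List.Relation.Unary.Unique.Propositional.Properties as UniqueP
open import Data.Maybe using (Maybe; just; nothing)
open import Data.Nat hiding (_≟_)
open import Data.Nat.Coprimality using (coprime-Bézout; prime⇒coprime)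
open import Data.Nat.DivMod using (m/n*n≤m; m*n/n≡m; /-monoˡ-≤; m≡m%n+[m/n]*n; m%n<n; m≥n⇒m/n>0)
import Data.Nat.Divisibility as ℕD
open ℕD using () renaming (_∣_ to _∣ⁿ_; _∣?_ to _∣ⁿ?_)
open import Data.Nat.GCD using (module Bézout)
open import Data.Nat.Induction using (<-rec)
open import Data.Nat.Logarithm using (⌊log₂_⌋; ⌊log₂⌋-mono-≤; ⌊log₂[2^n]⌋≡n; ⌊log₂⌊n/2⌋⌋≡⌊log₂n⌋∸1)
open import Data.Nat.Primality using (Prime; prime?; euclidsLemma; prime⇒nonZero; prime⇒nonTrivial)
open import Data.Nat.Primality.Factorisation using (factorise)
open import Data.Nat.Properties hiding (_≟_)
open import Data.Nat.Tactic.RingSolver using (solve-∀)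
open import Data.Product using (Σ; ∃; _×_; _,_; proj₁; proj₂)
open import Data.Product.Properties using (≡-dec)
open import Data.Sum using (_⊎_; inj₁; inj₂)
import Data.Sum as Sum
open import Data.Vec using (Vec; []; _∷_; lookup; _[_]≔_)
import Data.Vec.Properties as VecP
open import Function using (_∘_; id)
open import Function.Definitions using (Injective)
open import Level using (0ℓ)
open import Relation.Binary.PropositionalEquality using (_≡_; _≢_; refl; sym; trans; cong; cong₂; subst; subst₂; module ≡-Reasoning)
import Relation.Binary.Reasoning.Setoid
open import Relation.Binary.Structures using (IsEquivalence)
open import Relation.Nullary using (¬_; Dec; yes; no; contradiction; does)
open import Relation.Nullary.Decidable using (isYes≗does; decidable-stable; _×-dec_)

private variable
  I J : Set

𝟙 : Bool → ℕ
𝟙 true = 1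
𝟙 false = 0

𝟙≤1 : ∀ b → 𝟙 b ≤ 1
𝟙≤1 true = ≤-refl
𝟙≤1 false = z≤n

𝟙-∧ : ∀ a b → 𝟙 (a ∧ b) ≡ 𝟙 a * 𝟙 b
𝟙-∧ true b = sym (+-identityʳ _)
𝟙-∧ false b = refl

𝟙-mono : ∀ {a b} → (a ≡ true → b ≡ true) → 𝟙 a ≤ 𝟙 b
𝟙-mono {false} f = z≤n
𝟙-mono {true} f rewrite f refl = ≤-refl

𝟙-split : ∀ a b → 𝟙 a ≡ 𝟙 (a ∧ b) + 𝟙 (a ∧ not b)
𝟙-split false b = refl
𝟙-split true false = refl
𝟙-split true true = refl

∧-true : ∀ {a b} → a ∧ b ≡ true → a ≡ true × b ≡ true
∧-true {true} {true} refl = refl , refl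

∧-intro : ∀ {a b} → a ≡ true → b ≡ true → a ∧ b ≡ true
∧-intro refl refl = refl

not-true : ∀ {a} → not a ≡ true → a ≡ false
not-true {false} refl = refl

true≢false : ∀ {a} {C : Set} → a ≡ true → a ≡ false → C
true≢false refl ()

bool-cases : ∀ a → (a ≡ true) ⊎ (a ≡ false)
bool-cases true = inj₁ refl
bool-cases false = inj₂ refl

¬true⇒false : ∀ {a} → ¬ (a ≡ true) → a ≡ false
¬true⇒false {true} h = ⊥-elim (h refl)
¬true⇒false {false} h = refl

does-true : ∀ {P : Set} (d : Dec P) → P → does d ≡ true
does-true (yes _) p = refl
does-true (no ¬p) p = ⊥-elim (¬p p)

true-does : ∀ {P : Set} (d : Dec P) → does d ≡ true → P
true-does (yes p) _ = p

does-false : ∀ {P : Set} (d : Dec P) → ¬ P → does d ≡ false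
does-false (yes p) ¬p = ⊥-elim (¬p p)
does-false (no _) _ = refl

∑ : List I → (I → ℕ) → ℕ
∑ [] f = 0
∑ (x ∷ xs) f = f x + ∑ xs f

∑-cong : ∀ (xs : List I) {f g} → (∀ x → f x ≡ g x) → ∑ xs f ≡ ∑ xs g
∑-cong [] h = refl
∑-cong (x ∷ xs) h = cong₂ _+_ (h x) (∑-cong xs h)

∑-mono : ∀ (xs : List I) {f g} → (∀ x → f x ≤ g x) → ∑ xs f ≤ ∑ xs g
∑-mono [] h = z≤n
∑-mono (x ∷ xs) h = +-mono-≤ (h x) (∑-mono xs h)

∑-mono∈ : ∀ (xs : List I) {f g} → (∀ x → x ∈ xs → f x ≤ g x) → ∑ xs f ≤ ∑ xs g
∑-mono∈ [] h = z≤n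
∑-mono∈ (x ∷ xs) h = +-mono-≤ (h x (here refl)) (∑-mono∈ xs λ y p → h y (there p))

+-interchange : ∀ a b c d → (a + b) + (c + d) ≡ (a + c) + (b + d)
+-interchange = solve-∀

∑-+ : ∀ (xs : List I) (f g : I → ℕ) → ∑ xs (λ x → f x + g x) ≡ ∑ xs f + ∑ xs g
∑-+ [] f g = refl
∑-+ (x ∷ xs) f g rewrite ∑-+ xs f g = +-interchange (f x) (g x) (∑ xs f) (∑ xs g)

∑-*ˡ : ∀ (xs : List I) c (f : I → ℕ) → ∑ xs (λ x → c * f x) ≡ c * ∑ xs f
∑-*ˡ [] c f = sym (*-zeroʳ c)
∑-*ˡ (x ∷ xs) c f rewrite ∑-*ˡ xs c f = sym (*-distribˡ-+ c (f x) (∑ xs f))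

∑-*ʳ : ∀ (xs : List I) c (f : I → ℕ) → ∑ xs (λ x → f x * c) ≡ ∑ xs f * c
∑-*ʳ [] c f = refl
∑-*ʳ (x ∷ xs) c f rewrite ∑-*ʳ xs c f = sym (*-distribʳ-+ c (f x) (∑ xs f))

∑-const : ∀ (xs : List I) c → ∑ xs (λ _ → c) ≡ length xs * c
∑-const [] c = refl
∑-const (x ∷ xs) c = cong (c +_) (∑-const xs c)

∑-zero : ∀ (xs : List I) {f} → (∀ x → f x ≡ 0) → ∑ xs f ≡ 0
∑-zero [] h = refl
∑-zero (x ∷ xs) h rewrite h x = ∑-zero xs h

∑-swap : ∀ (xs : List I) (ys : List J) (f : I → J → ℕ) →
  ∑ xs (λ x → ∑ ys (f x)) ≡ ∑ ys (λ y → ∑ xs (λ x → f x y))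
∑-swap [] ys f = sym (∑-zero ys λ _ → refl)
∑-swap (x ∷ xs) ys f rewrite ∑-swap xs ys f = sym (∑-+ ys (f x) _)

∑-++ : ∀ (xs ys : List I) f → ∑ (xs ++ ys) f ≡ ∑ xs f + ∑ ys f
∑-++ [] ys f = refl
∑-++ (x ∷ xs) ys f rewrite ∑-++ xs ys f = sym (+-assoc (f x) _ _)

∑-map : ∀ (g : I → J) (xs : List I) f → ∑ (map g xs) f ≡ ∑ xs (f ∘ g)
∑-map g [] f = refl
∑-map g (x ∷ xs) f = cong (f (g x) +_) (∑-map g xs f)

∑-× : ∀ (xs : List I) (ys : List J) f →
  ∑ (cartesianProduct xs ys) f ≡ ∑ xs (λ x → ∑ ys (λ y → f (x , y)))
∑-× [] ys f = refl
∑-× (x ∷ xs) ys f = trans (∑-++ (map (x ,_) ys) _ f)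
  (cong₂ _+_ (∑-map (x ,_) ys f) (∑-× xs ys f))

∑-∈ : ∀ {xs : List I} {x} (f : I → ℕ) → x ∈ xs → f x ≤ ∑ xs f
∑-∈ f (here refl) = m≤m+n _ _
∑-∈ {xs = y ∷ _} f (there p) = ≤-trans (∑-∈ f p) (m≤n+m _ (f y))

∑-mono-< : ∀ {xs : List I} {x} {f g : I → ℕ} → (∀ y → f y ≤ g y) → x ∈ xs → f x < g x →
  ∑ xs f < ∑ xs g
∑-mono-< {xs = _ ∷ xs} h (here refl) lt = +-mono-<-≤ lt (∑-mono xs h)
∑-mono-< {xs = y ∷ xs} h (there p) lt = +-mono-≤-< (h y) (∑-mono-< h p lt)

∑-<⇒∃ : ∀ (xs : List I) (f g : I → ℕ) → ∑ xs f < ∑ xs g → ∃ λ x → x ∈ xs × f x < g x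
∑-<⇒∃ [] f g ()
∑-<⇒∃ (x ∷ xs) f g lt with f x <? g x
... | yes p = x , here refl , p
... | no ¬p with ∑-<⇒∃ xs f g (+-cancelˡ-< (g x) _ _ (≤-<-trans (+-monoˡ-≤ _ (≮⇒≥ ¬p)) lt))
... | y , y∈ , q = y , there y∈ , q

# : List I → (I → Bool) → ℕ
# xs p = ∑ xs (λ x → 𝟙 (p x))

#-mono : ∀ (xs : List I) {p q : I → Bool} → (∀ x → p x ≡ true → q x ≡ true) → # xs p ≤ # xs q
#-mono xs h = ∑-mono xs (λ x → 𝟙-mono (h x))

#-split : ∀ (xs : List I) (p q : I → Bool) → # xs p ≡ # xs (λ x → p x ∧ q x) + # xs (λ x → p x ∧ not (q x))
#-split xs p q = trans (∑-cong xs λ x → 𝟙-split (p x) (q x)) (∑-+ xs _ _)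

#≤length : ∀ (xs : List I) p → # xs p ≤ length xs
#≤length xs p = ≤-trans (∑-mono xs λ x → 𝟙≤1 (p x)) (≤-reflexive (trans (∑-const xs 1) (*-identityʳ _)))

search : ∀ (xs : List I) (p : I → Bool) →
  (∃ λ x → x ∈ xs × p x ≡ true) ⊎ (∀ x → x ∈ xs → p x ≡ false)
search [] p = inj₂ λ _ ()
search (x ∷ xs) p with bool-cases (p x)
... | inj₁ e = inj₁ (x , here refl , e)
... | inj₂ e with search xs p
... | inj₁ (y , y∈ , e') = inj₁ (y , there y∈ , e')
... | inj₂ h = inj₂ λ { _ (here refl) → e ; y (there q) → h y q }

every : List I → (I → Bool) → Bool
every [] p = true
every (x ∷ xs) p = p x ∧ every xs p

every-∈ : ∀ {xs : List I} {p x} → every xs p ≡ true → x ∈ xs → p x ≡ true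
every-∈ {xs = y ∷ ys} {p} e (here refl) = proj₁ (∧-true {p y} {every ys p} e)
every-∈ {xs = y ∷ ys} {p} e (there q) = every-∈ {xs = ys} {p} (proj₂ (∧-true {p y} e)) q

every-false : ∀ (xs : List I) {p} → every xs p ≡ false → ∃ λ x → x ∈ xs × p x ≡ false
every-false (x ∷ xs) {p} e with bool-cases (p x)
... | inj₂ f = x , here refl , f
... | inj₁ t rewrite t with every-false xs e
... | y , y∈ , f = y , there y∈ , f

∈-allFin : ∀ {n} (i : Fin n) → i ∈ allFin n
∈-allFin = ∈P.∈-allFin

∑-allFin-suc : ∀ n (f : Fin (suc n) → ℕ) → ∑ (allFin (suc n)) f ≡ f zero + ∑ (allFin n) (f ∘ suc)
∑-allFin-suc n f = cong (f zero +_) (go n (λ i → i) f)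
  where
  open import Data.List using (tabulate)
  go : ∀ {m} n (h : Fin n → Fin m) (f : Fin (suc m) → ℕ) → ∑ (tabulate (λ i → suc (h i))) f ≡ ∑ (tabulate h) (f ∘ suc)
  go zero h f = refl
  go (suc n) h f = cong (f (suc (h zero)) +_) (go n (h ∘ suc) f)

length-allFin : ∀ n → length (allFin n) ≡ n
length-allFin n = ListP.length-tabulate {n = n} id

PF : ℕ → ℕ → Set
PF n h = Vec (Maybe (Fin h)) n

hit : ∀ {h} → Maybe (Fin h) → Fin h → Bool
hit nothing x = false
hit (just y) x = does (y Fin.≟ x)

_∋_ : ∀ {n h} → PF n h → Fin n × Fin h → Set
γ ∋ (i , x) = hit (lookup γ i) x ≡ true

inside : ∀ {n h} → (Fin n → Fin h → Bool) → PF n h → Bool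
inside X [] = true
inside X (nothing ∷ γ) = inside (X ∘ suc) γ
inside X (just x ∷ γ) = X zero x ∧ inside (X ∘ suc) γ

inside-∋ : ∀ {n h} (X : Fin n → Fin h → Bool) γ → inside X γ ≡ true →
  ∀ i x → γ ∋ (i , x) → X i x ≡ true
inside-∋ X (just y ∷ γ) e zero x p with y Fin.≟ x
... | yes refl = proj₁ (∧-true e)
inside-∋ X (nothing ∷ γ) e (suc i) x p = inside-∋ (X ∘ suc) γ e i x p
inside-∋ X (just y ∷ γ) e (suc i) x p = inside-∋ (X ∘ suc) γ (proj₂ (∧-true {X zero y} e)) i x p

∋-inside : ∀ {n h} (X : Fin n → Fin h → Bool) γ → (∀ i x → γ ∋ (i , x) → X i x ≡ true) →
  inside X γ ≡ true
∋-inside X [] H = refl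
∋-inside X (nothing ∷ γ) H = ∋-inside (X ∘ suc) γ (λ i x → H (suc i) x)
∋-inside X (just y ∷ γ) H = ∧-intro (H zero y (does-true (y Fin.≟ y) refl)) (∋-inside (X ∘ suc) γ (λ i x → H (suc i) x))

erase-∋ : ∀ {n h} (γ : PF n h) i {e} → (γ [ i ]≔ nothing) ∋ e → γ ∋ e × proj₁ e ≢ i
erase-∋ γ i {j , x} p with j Fin.≟ i
... | no j≢i rewrite VecP.lookup∘updateAt′ j i {f = λ _ → nothing} j≢i γ = p , j≢i
... | yes refl rewrite VecP.lookup∘updateAt i {f = λ _ → nothing} γ with () ← p

-- S n h T w sums w over the partial functions Fin n ⇀ Fin h with T-element domain.
S : ∀ n h → ℕ → (PF n h → ℕ) → ℕ
S zero h zero w = w []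
S zero h (suc T) w = 0
S (suc n) h zero w = S n h zero (w ∘ (nothing ∷_))
S (suc n) h (suc T) w = S n h (suc T) (w ∘ (nothing ∷_)) + ∑ (allFin h) (λ x → S n h T (w ∘ (just x ∷_)))

S-mono : ∀ n h T {v w : PF n h → ℕ} → (∀ γ → v γ ≤ w γ) → S n h T v ≤ S n h T w
S-mono zero h zero H = H []
S-mono zero h (suc T) H = z≤n
S-mono (suc n) h zero H = S-mono n h zero (λ γ → H _)
S-mono (suc n) h (suc T) H = +-mono-≤ (S-mono n h (suc T) (λ γ → H _)) (∑-mono (allFin h) λ x → S-mono n h T λ γ → H _)

S-cong : ∀ n h T {v w : PF n h → ℕ} → (∀ γ → v γ ≡ w γ) → S n h T v ≡ S n h T w
S-cong n h T H = ≤-antisym (S-mono n h T λ γ → ≤-reflexive (H γ)) (S-mono n h T λ γ → ≤-reflexive (sym (H γ)))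

S-+ : ∀ n h T (v w : PF n h → ℕ) → S n h T (λ γ → v γ + w γ) ≡ S n h T v + S n h T w
S-+ zero h zero v w = refl
S-+ zero h (suc T) v w = refl
S-+ (suc n) h zero v w = S-+ n h zero _ _
S-+ (suc n) h (suc T) v w = trans (cong₂ _+_ (S-+ n h (suc T) _ _)
    (trans (∑-cong (allFin h) λ x → S-+ n h T _ _) (∑-+ (allFin h) _ _)))
  (+-interchange (S n h (suc T) (v ∘ (nothing ∷_))) _ _ _)

S-* : ∀ n h T c (w : PF n h → ℕ) → S n h T (λ γ → c * w γ) ≡ c * S n h T w
S-* zero h zero c w = refl
S-* zero h (suc T) c w = sym (*-zeroʳ c)
S-* (suc n) h zero c w = S-* n h zero c _
S-* (suc n) h (suc T) c w = trans (cong₂ _+_ (S-* n h (suc T) c _)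
    (trans (∑-cong (allFin h) λ x → S-* n h T c _) (∑-*ˡ (allFin h) c _)))
  (sym (*-distribˡ-+ c _ _))

S-zero : ∀ n h T (w : PF n h → ℕ) → (∀ γ → w γ ≡ 0) → S n h T w ≡ 0
S-zero n h T w H = trans (S-cong n h T {w} {λ γ → 0 * w γ} H) (S-* n h T 0 w)

bernoulli : ∀ x σ T → σ ^ suc T + suc T * x * σ ^ T ≤ (x + σ) ^ suc T
bernoulli x σ zero = ≤-reflexive (lem x σ)
  where
  lem : ∀ x σ → σ * 1 + 1 * x * 1 ≡ (x + σ) * 1
  lem = solve-∀
bernoulli x σ (suc T) = ≤-trans (m≤m+n _ (x * (suc T * x * σ ^ T)))
  (≤-trans (≤-reflexive (lem x σ (suc T) (σ ^ T))) (*-monoʳ-≤ (x + σ) (bernoulli x σ T)))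
  where
  lem : ∀ x σ t s → σ * (σ * s) + (1 + t) * x * (σ * s) + x * (t * x * s) ≡ (x + σ) * (σ * s + t * x * s)
  lem = solve-∀

card : ∀ {n h} → (Fin n → Fin h → Bool) → ℕ
card {n} {h} X = ∑ (allFin n) (λ i → # (allFin h) (X i))

S-inside : ∀ n h T (X : Fin n → Fin h → Bool) → S n h T (𝟙 ∘ inside X) * T ! ≤ card X ^ T
S-inside zero h zero X = ≤-refl
S-inside zero h (suc T) X = z≤n
S-inside (suc n) h zero X = S-inside n h zero (X ∘ suc)
S-inside (suc n) h (suc T) X = begin
    (S₁ + ∑ (allFin h) (λ y → S n h T (λ γ → 𝟙 (X zero y ∧ inside (X ∘ suc) γ)))) * suc T !
      ≡⟨ cong (λ z → (S₁ + z) * suc T !) (trans (∑-cong (allFin h) λ y →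
           trans (S-cong n h T λ γ → 𝟙-∧ (X zero y) _) (S-* n h T (𝟙 (X zero y)) _)) (∑-*ʳ (allFin h) S₂ _)) ⟩
    (S₁ + x * S₂) * (suc T * T !) ≡⟨ lem S₁ x S₂ T (T !) ⟩
    S₁ * (suc T * T !) + suc T * x * (S₂ * T !) ≤⟨ +-mono-≤ (S-inside n h (suc T) (X ∘ suc)) (*-monoʳ-≤ (suc T * x) (S-inside n h T (X ∘ suc))) ⟩
    σ ^ suc T + suc T * x * σ ^ T ≤⟨ bernoulli x σ T ⟩
    (x + σ) ^ suc T ≡⟨ cong (_^ suc T) (sym (∑-allFin-suc n (λ i → # (allFin h) (X i)))) ⟩
    card X ^ suc T ∎
  where
  open ≤-Reasoning
  S₁ = S n h (suc T) (𝟙 ∘ inside (X ∘ suc))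
  S₂ = S n h T (𝟙 ∘ inside (X ∘ suc))
  x = # (allFin h) (X zero)
  σ = card (X ∘ suc)
  lem : ∀ a x b T f → (a + x * b) * ((1 + T) * f) ≡ a * ((1 + T) * f) + (1 + T) * x * (b * f)
  lem = solve-∀

S-nothing : ∀ n h T (w : PF (suc n) h → ℕ) → S n h T (w ∘ (nothing ∷_)) ≤ S (suc n) h T w
S-nothing n h zero w = ≤-refl
S-nothing n h (suc T) w = m≤m+n _ _

∑-δ : ∀ {h} (x : Fin h) c → ∑ (allFin h) (λ y → 𝟙 (does (y Fin.≟ x)) * c) ≤ c
∑-δ {suc h} zero c = ≤-reflexive (trans (∑-allFin-suc h _)
  (trans (cong₂ _+_ (*-identityˡ c) (∑-zero (allFin h) λ y → refl)) (+-identityʳ c)))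
∑-δ {suc h} (suc x) c = ≤-trans (≤-reflexive (∑-allFin-suc h (λ y → 𝟙 (does (y Fin.≟ suc x)) * c)))
  (≤-trans (≤-reflexive (∑-cong (allFin h) {g = λ y → 𝟙 (does (y Fin.≟ x)) * c} λ y → refl)) (∑-δ x c))

takes : ∀ {n h} → Fin n → Fin h → (PF n h → ℕ) → PF n h → ℕ
takes i x w γ = 𝟙 (hit (lookup γ i) x) * w (γ [ i ]≔ nothing)

S-takes-zero : ∀ n h i x (w : PF n h → ℕ) → S n h 0 (takes i x w) ≡ 0
S-takes-zero (suc n) h zero x w = S-zero n h 0 _ (λ _ → refl)
S-takes-zero (suc n) h (suc i) x w = S-takes-zero n h i x (w ∘ (nothing ∷_))

S-takes : ∀ n h T i x (w : PF n h → ℕ) → S n h (suc T) (takes i x w) ≤ S n h T w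
S-takes (suc n) h T zero x w = begin
    S n h (suc T) (λ γ → 0) + ∑ (allFin h) (λ y → S n h T (λ γ → 𝟙 (does (y Fin.≟ x)) * w (nothing ∷ γ)))
      ≡⟨ cong₂ _+_ (S-zero n h (suc T) _ λ _ → refl) (∑-cong (allFin h) λ y → S-* n h T (𝟙 (does (y Fin.≟ x))) _) ⟩
    ∑ (allFin h) (λ y → 𝟙 (does (y Fin.≟ x)) * S n h T (w ∘ (nothing ∷_))) ≤⟨ ∑-δ x _ ⟩
    S n h T (w ∘ (nothing ∷_)) ≤⟨ S-nothing n h T w ⟩
    S (suc n) h T w ∎
  where open ≤-Reasoning
S-takes (suc n) h zero (suc i) x w = ≤-trans (+-mono-≤ (S-takes n h zero i x (w ∘ (nothing ∷_)))
    (≤-reflexive (∑-zero (allFin h) λ y → S-takes-zero n h i x (w ∘ (just y ∷_))))) (≤-reflexive (+-identityʳ _))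
S-takes (suc n) h (suc T) (suc i) x w = +-mono-≤ (S-takes n h (suc T) i x (w ∘ (nothing ∷_)))
    (∑-mono (allFin h) λ y → S-takes n h T i x (w ∘ (just y ∷_)))

restrict : ∀ {n h} → Vec (Fin h) n → Subset n → PF n h
restrict [] [] = []
restrict (x ∷ f) (true ∷ s) = just x ∷ restrict f s
restrict (x ∷ f) (false ∷ s) = nothing ∷ restrict f s

restrict-∋ : ∀ {n h} (f : Vec (Fin h) n) s {i x} → restrict f s ∋ (i , x) → lookup s i ≡ true × lookup f i ≡ x
restrict-∋ (y ∷ f) (true ∷ s) {zero} {x} p = refl , true-does (y Fin.≟ x) p
restrict-∋ (y ∷ f) (true ∷ s) {suc i} p = restrict-∋ f s p
restrict-∋ (y ∷ f) (false ∷ s) {suc i} p = restrict-∋ f s p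

Tot : ∀ n h → (Vec (Fin h) n → ℕ) → ℕ
Tot zero h J = J []
Tot (suc n) h J = ∑ (allFin h) (λ x → Tot n h (J ∘ (x ∷_)))

Tot-+ : ∀ n h (J K : Vec (Fin h) n → ℕ) → Tot n h (λ f → J f + K f) ≡ Tot n h J + Tot n h K
Tot-+ zero h J K = refl
Tot-+ (suc n) h J K = trans (∑-cong (allFin h) λ x → Tot-+ n h _ _) (∑-+ (allFin h) _ _)

Tot-<⇒∃ : ∀ n h (J : Vec (Fin h) n → ℕ) → Tot n h J < h ^ n → ∃ λ f → J f ≡ 0
Tot-<⇒∃ zero h J lt = [] , n<1⇒n≡0 lt
Tot-<⇒∃ (suc n) h J lt with ∑-<⇒∃ (allFin h) _ (λ _ → h ^ n)
    (subst (Tot (suc n) h J <_) (sym (trans (∑-const (allFin h) (h ^ n)) (cong (_* h ^ n) (length-allFin h)))) lt)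
... | x , _ , lt' with Tot-<⇒∃ n h _ lt'
... | f , e = x ∷ f , e

restrictions : ∀ {n h} → ℕ → (PF n h → ℕ) → Vec (Fin h) n → ℕ
restrictions zero w [] = w []
restrictions (suc T) w [] = 0
restrictions zero w (x ∷ f) = restrictions zero (w ∘ (nothing ∷_)) f
restrictions (suc T) w (x ∷ f) = restrictions (suc T) (w ∘ (nothing ∷_)) f + restrictions T (w ∘ (just x ∷_)) f

restrict≤restrictions : ∀ {n h} (w : PF n h → ℕ) f s → w (restrict f s) ≤ restrictions ∣ s ∣ w f
restrict≤restrictions w [] [] = ≤-refl
restrict≤restrictions w (x ∷ f) (true ∷ s) = ≤-trans (restrict≤restrictions (w ∘ (just x ∷_)) f s) (m≤n+m _ _)
restrict≤restrictions w (x ∷ f) (false ∷ s) with ∣ s ∣ in eq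
... | zero = subst (λ t → w (nothing ∷ restrict f s) ≤ restrictions t (w ∘ (nothing ∷_)) f) eq (restrict≤restrictions (w ∘ (nothing ∷_)) f s)
... | suc T = ≤-trans (subst (λ t → w (nothing ∷ restrict f s) ≤ restrictions t (w ∘ (nothing ∷_)) f) eq (restrict≤restrictions (w ∘ (nothing ∷_)) f s)) (m≤m+n _ _)

Tot-restrictions : ∀ n h T (w : PF n h → ℕ) → Tot n h (restrictions T w) * h ^ T ≡ h ^ n * S n h T w
Tot-restrictions zero h zero w = *-comm (w []) 1
Tot-restrictions zero h (suc T) w = refl
Tot-restrictions (suc n) h zero w = begin
    ∑ (allFin h) (λ x → Tot n h (restrictions zero (w ∘ (nothing ∷_)))) * 1 ≡⟨ cong (_* 1) (trans (∑-const (allFin h) _) (cong (_* Tₙ) (length-allFin h))) ⟩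
    h * Tₙ * 1 ≡⟨ *-assoc h Tₙ 1 ⟩
    h * (Tₙ * 1) ≡⟨ cong (h *_) (Tot-restrictions n h zero (w ∘ (nothing ∷_))) ⟩
    h * (h ^ n * S n h 0 (w ∘ (nothing ∷_))) ≡⟨ sym (*-assoc h _ _) ⟩
    h ^ suc n * S n h 0 (w ∘ (nothing ∷_)) ∎
  where
  open ≡-Reasoning
  Tₙ = Tot n h (restrictions zero (w ∘ (nothing ∷_)))
Tot-restrictions (suc n) h (suc T) w = begin
    ∑ (allFin h) (λ x → Tot n h (λ f → restrictions (suc T) (w ∘ (nothing ∷_)) f + restrictions T (w ∘ (just x ∷_)) f)) * h ^ suc T
      ≡⟨ cong (_* h ^ suc T) (trans (∑-cong (allFin h) λ x → Tot-+ n h _ _) (trans (∑-+ (allFin h) _ _)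
           (cong (_+ R) (trans (∑-const (allFin h) P) (cong (_* P) (length-allFin h)))))) ⟩
    (h * P + R) * (h * h ^ T) ≡⟨ lem h P R (h ^ T) ⟩
    h * (P * (h * h ^ T)) + h * (R * h ^ T) ≡⟨ cong₂ (λ a b → h * a + h * b) (Tot-restrictions n h (suc T) _)
        (trans (sym (∑-*ʳ (allFin h) (h ^ T) _)) (trans (∑-cong (allFin h) λ x → Tot-restrictions n h T _) (∑-*ˡ (allFin h) (h ^ n) _))) ⟩
    h * (h ^ n * S n h (suc T) _) + h * (h ^ n * ∑ (allFin h) (λ x → S n h T (w ∘ (just x ∷_)))) ≡⟨ lem₂ h (h ^ n) _ _ ⟩
    h ^ suc n * S (suc n) h (suc T) w ∎
  where
  open ≡-Reasoning
  P = Tot n h (restrictions (suc T) (w ∘ (nothing ∷_)))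
  R = ∑ (allFin h) (λ x → Tot n h (restrictions T (w ∘ (just x ∷_))))
  lem : ∀ h P R t → (h * P + R) * (h * t) ≡ h * (P * (h * t)) + h * (R * t)
  lem = solve-∀
  lem₂ : ∀ h a b c → h * (a * b) + h * (a * c) ≡ h * a * (b + c)
  lem₂ = solve-∀

avoid-restrictions : ∀ n h T (w : PF n h → ℕ) → 0 < h → S n h T w < h ^ T →
  ∃ λ f → ∀ s → ∣ s ∣ ≡ T → w (restrict f s) ≡ 0
avoid-restrictions n h T w h>0 lt with Tot-<⇒∃ n h (restrictions T w)
    (*-cancelʳ-< (h ^ T) _ _ (subst (_< h ^ n * h ^ T) (sym (Tot-restrictions n h T w))
      (*-monoʳ-< (h ^ n) {{>-nonZero (m^n>0 h {{>-nonZero h>0}} n)}} lt)))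
... | f , e = f , λ { s refl → n≤0⇒n≡0 (≤-trans (restrict≤restrictions w f s) (≤-reflexive e)) }

-- The Kleitman–Winston branching with U already selected, X the remaining candidates, Y the target
-- container size and b the number of selections left; the weight of γ counts the branches that produce γ.
module Cover (n h Y : ℕ) (Indep : PF n h → Set) where
  Elt : Set
  Elt = Fin n × Fin h

  record Good (U : List Elt) (γ : PF n h) : Set where
    field
      whole : PF n h
      free : Indep whole
      chosen : All (whole ∋_) U
      apart : AllPairs (λ u v → proj₁ u ≢ proj₁ v) U
      rest : ∀ e → γ ∋ e → whole ∋ e
      fresh : ∀ e → γ ∋ e → All (λ u → proj₁ e ≢ proj₁ u) U

  ∣_∣ₑ : (Elt → Bool) → ℕ
  ∣ X ∣ₑ = card (λ i x → X (i , x))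

  record Cov (b : ℕ) (U : List Elt) (X : Elt → Bool) : Set where
    constructor cov
    field
      weight : PF n h → ℕ
      bound : ∀ T → S n h T weight * T ! * Y ^ b ≤ Y ^ T * (Y + ∣ X ∣ₑ * T) ^ b
      covers : ∀ γ → inside (λ i x → X (i , x)) γ ≡ true → Good U γ → 1 ≤ weight γ

  _≟E_ : (u v : Elt) → Dec (u ≡ v)
  (i , x) ≟E (j , y) with i Fin.≟ j | x Fin.≟ y
  ... | yes refl | yes refl = yes refl
  ... | no p | _ = no λ { refl → p refl }
  ... | _ | no p = no λ { refl → p refl }

  _∖_ : (Elt → Bool) → Elt → Elt → Bool
  (X ∖ v) u = X u ∧ not (does (u ≟E v))

  ∖⊂ : ∀ X v u → (X ∖ v) u ≡ true → X u ≡ true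
  ∖⊂ X v u e = proj₁ (∧-true {X u} e)

  inside-∖ : ∀ X v γ → inside (λ i x → X (i , x)) γ ≡ true → ¬ (γ ∋ v) →
    inside (λ i x → (X ∖ v) (i , x)) γ ≡ true
  inside-∖ X v γ e ∌ = ∋-inside _ γ λ i x p → ∧-intro (inside-∋ _ γ e i x p)
    (cong not (does-false ((i , x) ≟E v) λ { refl → ∌ p }))

  inside-erase : ∀ X (γ : PF n h) i → inside X γ ≡ true → inside X (γ [ i ]≔ nothing) ≡ true
  inside-erase X γ i e = ∋-inside X (γ [ i ]≔ nothing) λ j x p → inside-∋ X γ e j x (proj₁ (erase-∋ γ i {j , x} p))

  ∣∖∣ : ∀ X v → X v ≡ true → suc ∣ X ∖ v ∣ₑ ≤ ∣ X ∣ₑ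
  ∣∖∣ X v@(i , x) e = ∑-mono-< {xs = allFin n} (λ j → #-mono (allFin h) λ y → ∖⊂ X v (j , y)) (∈-allFin i)
    (∑-mono-< {xs = allFin h} (λ y → 𝟙-mono (∖⊂ X v (i , y))) (∈-allFin x) lt)
    where
    lt : 𝟙 ((X ∖ v) v) < 𝟙 (X v)
    lt rewrite e | does-true (v ≟E v) refl = ≤-refl

  leaf : ∀ {b U X} → ∣ X ∣ₑ ≤ Y → Cov b U X
  leaf {b} {U} {X} X≤Y = cov (𝟙 ∘ inside (λ i x → X (i , x)))
    (λ T → *-mono-≤ (≤-trans (S-inside n h T _) (^-monoˡ-≤ T X≤Y)) (^-monoˡ-≤ b (m≤m+n Y _)))
    λ γ e _ → ≤-reflexive (sym (cong 𝟙 e))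

  weaken : ∀ {b U X} → Cov b U X → Cov (suc b) U X
  weaken {b} {U} {X} (cov w bd cv) = cov w (λ T → begin
      S n h T w * T ! * (Y * Y ^ b) ≡⟨ lem (S n h T w * T !) Y (Y ^ b) ⟩
      Y * (S n h T w * T ! * Y ^ b) ≤⟨ *-mono-≤ (m≤m+n Y (∣ X ∣ₑ * T)) (bd T) ⟩
      (Y + ∣ X ∣ₑ * T) * (Y ^ T * (Y + ∣ X ∣ₑ * T) ^ b) ≡⟨ lem (Y + ∣ X ∣ₑ * T) (Y ^ T) ((Y + ∣ X ∣ₑ * T) ^ b) ⟩
      Y ^ T * ((Y + ∣ X ∣ₑ * T) * (Y + ∣ X ∣ₑ * T) ^ b) ∎) cv
    where
    open ≤-Reasoning
    lem : ∀ a b c → a * (b * c) ≡ b * (a * c)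
    lem = solve-∀

  weaken* : ∀ c {b U X} → Cov b U X → Cov (c + b) U X
  weaken* zero C = C
  weaken* (suc c) C = weaken (weaken* c C)

  dead : ∀ {b U X} v → X v ≡ true → (∀ γ → γ ∋ v → ¬ Good U γ) → Cov b U (X ∖ v) → Cov b U X
  dead {b} {U} {X} v e kill (cov w bd cv) = cov w
    (λ T → ≤-trans (bd T) (*-monoʳ-≤ (Y ^ T) (^-monoˡ-≤ b (+-monoʳ-≤ Y (*-monoˡ-≤ T (≤-trans (n≤1+n _) (∣∖∣ X v e)))))))
    λ γ i g → cv γ (inside-∖ X v γ i λ p → kill γ p g) g

  branch : ∀ {b U X} v → X v ≡ true → Cov (suc b) U (X ∖ v) → Cov b (v ∷ U) X → Cov (suc b) U X
  branch {b} {U} {X} v@(i , x) e (cov w₁ bd₁ cv₁) (cov w₂ bd₂ cv₂) = cov w bd cv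
    where
    open ≤-Reasoning
    w : PF n h → ℕ
    w γ = w₁ γ + takes i x w₂ γ
    c c' : ℕ
    c = ∣ X ∣ₑ
    c' = ∣ X ∖ v ∣ₑ
    pow : ∀ A T → T ≤ A → (A ∸ T) ^ suc b + T * A ^ b ≤ A ^ suc b
    pow A T T≤A = begin
      (A ∸ T) * (A ∸ T) ^ b + T * A ^ b ≤⟨ +-monoˡ-≤ _ (*-monoʳ-≤ (A ∸ T) (^-monoˡ-≤ b (m∸n≤m A T))) ⟩
      (A ∸ T) * A ^ b + T * A ^ b ≡⟨ sym (*-distribʳ-+ (A ^ b) (A ∸ T) T) ⟩
      (A ∸ T + T) * A ^ b ≡⟨ cong (_* A ^ b) (m∸n+n≡m T≤A) ⟩
      A ^ suc b ∎
    step : ∀ T → (Y + c' * T) ≤ (Y + c * T) ∸ T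
    step T = m+n≤o⇒m≤o∸n (Y + c' * T) (≤-trans (≤-reflexive (lem Y c' T)) (+-monoʳ-≤ Y (*-monoˡ-≤ T (∣∖∣ X v e))))
      where
      lem : ∀ Y c T → Y + c * T + T ≡ Y + (1 + c) * T
      lem = solve-∀
    T≤ : ∀ T → T ≤ Y + c * T
    T≤ T = ≤-trans (≤-trans (≤-reflexive (sym (*-identityˡ T))) (*-monoˡ-≤ T (≤-trans (s≤s z≤n) (∣∖∣ X v e)))) (m≤n+m (c * T) Y)
    part : ∀ T → S n h T (takes i x w₂) * T ! * Y ^ suc b ≤ Y ^ T * (T * (Y + c * T) ^ b)
    part zero rewrite S-takes-zero n h i x w₂ = z≤n
    part (suc T) = begin
      S n h (suc T) (takes i x w₂) * (suc T * T !) * (Y * Y ^ b) ≤⟨ *-monoˡ-≤ (Y * Y ^ b) (*-monoˡ-≤ (suc T * T !) (S-takes n h T i x w₂)) ⟩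
      S n h T w₂ * (suc T * T !) * (Y * Y ^ b) ≡⟨ lem (S n h T w₂) (suc T) (T !) Y (Y ^ b) ⟩
      suc T * Y * (S n h T w₂ * T ! * Y ^ b) ≤⟨ *-monoʳ-≤ (suc T * Y) (bd₂ T) ⟩
      suc T * Y * (Y ^ T * (Y + c * T) ^ b) ≤⟨ *-monoʳ-≤ (suc T * Y) (*-monoʳ-≤ (Y ^ T) (^-monoˡ-≤ b (+-monoʳ-≤ Y (*-monoʳ-≤ c (n≤1+n T))))) ⟩
      suc T * Y * (Y ^ T * (Y + c * suc T) ^ b) ≡⟨ lem₂ (suc T) Y (Y ^ T) _ ⟩
      Y * Y ^ T * (suc T * (Y + c * suc T) ^ b) ∎
      where
      lem : ∀ s t f y z → s * (t * f) * (y * z) ≡ t * y * (s * f * z)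
      lem = solve-∀
      lem₂ : ∀ t y p q → t * y * (p * q) ≡ y * p * (t * q)
      lem₂ = solve-∀
    bd : ∀ T → S n h T w * T ! * Y ^ suc b ≤ Y ^ T * (Y + c * T) ^ suc b
    bd T = begin
      S n h T w * T ! * Y ^ suc b ≡⟨ cong (λ z → z * T ! * Y ^ suc b) (S-+ n h T w₁ (takes i x w₂)) ⟩
      (S n h T w₁ + S n h T (takes i x w₂)) * T ! * Y ^ suc b ≡⟨ lem (S n h T w₁) _ (T !) (Y ^ suc b) ⟩
      S n h T w₁ * T ! * Y ^ suc b + S n h T (takes i x w₂) * T ! * Y ^ suc b ≤⟨ +-mono-≤ (≤-trans (bd₁ T) (*-monoʳ-≤ (Y ^ T) (^-monoˡ-≤ (suc b) (step T)))) (part T) ⟩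
      Y ^ T * (Y + c * T ∸ T) ^ suc b + Y ^ T * (T * (Y + c * T) ^ b) ≡⟨ sym (*-distribˡ-+ (Y ^ T) _ _) ⟩
      Y ^ T * ((Y + c * T ∸ T) ^ suc b + T * (Y + c * T) ^ b) ≤⟨ *-monoʳ-≤ (Y ^ T) (pow (Y + c * T) T (T≤ T)) ⟩
      Y ^ T * (Y + c * T) ^ suc b ∎
      where
      lem : ∀ a b f y → (a + b) * f * y ≡ a * f * y + b * f * y
      lem = solve-∀
    cv : ∀ γ → inside (λ i x → X (i , x)) γ ≡ true → Good U γ → 1 ≤ w γ
    cv γ i₁ g with bool-cases (hit (lookup γ i) x)
    ... | inj₂ f = ≤-trans (cv₁ γ (inside-∖ X v γ i₁ λ p → true≢false p f) g) (m≤m+n _ _)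
    ... | inj₁ t = ≤-trans (cv₂ (γ [ i ]≔ nothing) (inside-erase (λ i x → X (i , x)) γ i i₁) g') (≤-trans (≤-reflexive (sym (trans (cong (λ z → 𝟙 z * w₂ (γ [ i ]≔ nothing)) t) (*-identityˡ _)))) (m≤n+m _ (w₁ γ)))
      where
      open Good
      g' : Good (v ∷ U) (γ [ i ]≔ nothing)
      g' .whole = whole g
      g' .free = free g
      g' .chosen = rest g v t ∷ chosen g
      g' .apart = fresh g v t ∷ apart g
      g' .rest e p = rest g e (proj₁ (erase-∋ γ i {e} p))
      g' .fresh e p = proj₂ (erase-∋ γ i {e} p) ∷ fresh g e (proj₁ (erase-∋ γ i {e} p))

≤ᵇ-true : ∀ {a b} → a ≤ b → (a ≤ᵇ b) ≡ true
≤ᵇ-true {a} {b} p with a ≤ᵇ b | ≤⇒≤ᵇ p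
... | true | _ = refl

true-≤ᵇ : ∀ a b → (a ≤ᵇ b) ≡ true → a ≤ b
true-≤ᵇ a b e = ≤ᵇ⇒≤ a b (subst Bool.T (sym e) _)

false-≤ᵇ : ∀ a b → (a ≤ᵇ b) ≡ false → b < a
false-≤ᵇ a b e = ≰⇒> λ p → true≢false (≤ᵇ-true p) e

AllPairs-resp-⊆ : ∀ {A : Set} {R : A → A → Set} {xs ys} → xs ⊆ ys → AllPairs R ys → AllPairs R xs
AllPairs-resp-⊆ [] [] = []
AllPairs-resp-⊆ (y ∷ʳ p) (_ ∷ qs) = AllPairs-resp-⊆ p qs
AllPairs-resp-⊆ (refl ∷ p) (q ∷ qs) = Sub.All-resp-⊆ p q ∷ AllPairs-resp-⊆ p qs

batch-arith : ∀ ω d t ρ' N a n' s l Z ρ P Q {z w} → z ≡ 32 * t → w ≡ 64 * ω →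
  1 ≤ ω → 1 ≤ d → 1 ≤ t → 1 ≤ ρ' →
  n' * ρ' < N * (4 * Z) → N * (4 * (z * Z)) ≤ a * (4 * ρ') →
  s * (w * d * Z) ≤ n' * (ρ * ω) → ρ ≤ ρ' → 1 ≤ Z →
  l * (4 * ρ') ≤ 2 * (s * (d * (z * Z))) → a ≤ n' + P + l → P * (4 * ρ') ≤ Q →
  N * (2 * (z * Z)) ≤ Q
batch-arith ω d t ρ' N a n' s l Z ρ P Q {z} {w} refl refl ω>0 d>0 t>0 ρ'>0 h₁ h₂ h₃ ρ≤ Z>0 h₄ h₅ h₆ = *-cancelˡ-≤ 2 (begin
  2 * (N * (2 * (32 * t * Z))) ≡⟨ e₁ N t Z ⟩
  N * (4 * (32 * t * Z)) ≤⟨ h₂ ⟩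
  a * (4 * ρ') ≤⟨ *-monoˡ-≤ (4 * ρ') a≤2P ⟩
  2 * P * (4 * ρ') ≡⟨ *-assoc 2 P _ ⟩
  2 * (P * (4 * ρ')) ≤⟨ *-monoʳ-≤ 2 h₆ ⟩
  2 * Q ∎)
  where
  open ≤-Reasoning
  instance
    ρ'≢0 : NonZero ρ'
    ρ'≢0 = >-nonZero ρ'>0
  e₁ : ∀ N t Z → 2 * (N * (2 * (32 * t * Z))) ≡ N * (4 * (32 * t * Z))
  e₁ = solve-∀
  e₂ : ∀ n t R → 8 * t * n * (16 * R) ≡ 32 * t * 4 * (n * R)
  e₂ = solve-∀
  e₃ : ∀ N t Z → 32 * t * 4 * (N * (4 * Z)) ≡ 4 * (N * (4 * (32 * t * Z)))
  e₃ = solve-∀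
  e₄ : ∀ a R → 4 * (a * (4 * R)) ≡ a * (16 * R)
  e₄ = solve-∀
  8tn'≤a : 8 * t * n' ≤ a
  8tn'≤a = *-cancelʳ-≤ (8 * t * n') a (16 * ρ') {{m*n≢0 16 ρ'}} (begin
    8 * t * n' * (16 * ρ') ≡⟨ e₂ n' t ρ' ⟩
    32 * t * 4 * (n' * ρ') ≤⟨ *-monoʳ-≤ (32 * t * 4) (<⇒≤ h₁) ⟩
    32 * t * 4 * (N * (4 * Z)) ≡⟨ e₃ N t Z ⟩
    4 * (N * (4 * (32 * t * Z))) ≤⟨ *-monoʳ-≤ 4 h₂ ⟩
    4 * (a * (4 * ρ')) ≡⟨ e₄ a ρ' ⟩
    a * (16 * ρ') ∎)
  e₆ : ∀ w d Z s t → w * d * Z * (2 * (s * (d * (32 * t * Z)))) ≡ s * (64 * w * d * Z) * (t * d * Z)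
  e₆ = solve-∀
  e₇ : ∀ n R w t d Z → n * (R * w) * (t * d * Z) ≡ t * n * (R * (w * d * Z))
  e₇ = solve-∀
  e₈ : ∀ l R w d Z → w * d * Z * (l * (4 * R)) ≡ l * 4 * (R * (w * d * Z))
  e₈ = solve-∀
  W = ω * d * Z
  W≢0 : NonZero (ρ' * W)
  W≢0 = m*n≢0 ρ' W {{ρ'≢0}} {{m*n≢0 (ω * d) Z {{m*n≢0 ω d {{>-nonZero ω>0}} {{>-nonZero d>0}}}} {{>-nonZero Z>0}}}}
  l≤tn' : l * 4 ≤ t * n'
  l≤tn' = *-cancelʳ-≤ (l * 4) (t * n') (ρ' * W) {{W≢0}} (begin
    l * 4 * (ρ' * W) ≡⟨ sym (e₈ l ρ' ω d Z) ⟩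
    W * (l * (4 * ρ')) ≤⟨ *-monoʳ-≤ W h₄ ⟩
    W * (2 * (s * (d * (32 * t * Z)))) ≡⟨ e₆ ω d Z s t ⟩
    s * (64 * ω * d * Z) * (t * d * Z) ≤⟨ *-monoˡ-≤ (t * d * Z) h₃ ⟩
    n' * (ρ * ω) * (t * d * Z) ≡⟨ e₇ n' ρ ω t d Z ⟩
    t * n' * (ρ * W) ≤⟨ *-monoʳ-≤ (t * n') (*-monoˡ-≤ W ρ≤) ⟩
    t * n' * (ρ' * W) ∎)
  n'≤tn' : n' ≤ t * n'
  n'≤tn' = ≤-trans (≤-reflexive (sym (*-identityˡ n'))) (*-monoˡ-≤ n' t>0)
  e₉ : ∀ P n l → 2 * (n + P + l) ≡ 2 * P + (2 * n + 2 * l)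
  e₉ = solve-∀
  e₁₀ : ∀ n t → 2 * (t * n) + 6 * (t * n) ≡ 8 * t * n
  e₁₀ = solve-∀
  l≤ : 2 * l ≤ 6 * (t * n')
  l≤ = ≤-trans (≤-trans (*-monoˡ-≤ l {2} {4} (s≤s (s≤s z≤n))) (≤-reflexive (*-comm 4 l))) (≤-trans l≤tn' (m≤n*m (t * n') 6))
  a≤2P : a ≤ 2 * P
  a≤2P = +-cancelʳ-≤ a a (2 * P) (begin
    a + a ≡⟨ cong (a +_) (sym (+-identityʳ a)) ⟩
    2 * a ≤⟨ *-monoʳ-≤ 2 h₅ ⟩
    2 * (n' + P + l) ≡⟨ e₉ P n' l ⟩
    2 * P + (2 * n' + 2 * l) ≤⟨ +-monoʳ-≤ (2 * P) (+-mono-≤ (*-monoʳ-≤ 2 n'≤tn') l≤) ⟩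
    2 * P + (2 * (t * n') + 6 * (t * n')) ≡⟨ cong (2 * P +_) (e₁₀ n' t) ⟩
    2 * P + 8 * t * n' ≤⟨ +-monoʳ-≤ (2 * P) 8tn'≤a ⟩
    2 * P + a ∎)

merge-zero : ∀ {r} a e (F G : Fin r → Bool) → (∀ j → G j ≡ false) →
  𝟙 (a ∨ e) * ∑ (allFin r) (λ j → 𝟙 (if a then F j else G j)) ≤ 𝟙 a * ∑ (allFin r) (λ j → 𝟙 (F j))
merge-zero true e F G G≡f = ≤-refl
merge-zero {r} false e F G G≡f = ≤-reflexive (trans (cong (𝟙 e *_) (∑-zero (allFin r) λ j → cong 𝟙 (G≡f j))) (*-zeroʳ (𝟙 e)))

merge-≤ : ∀ {r} a e (F G H : Fin r → Bool) m → (e ≡ true → m ≡ true) → (∀ j → G j ≡ true → H j ≡ true) →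
  𝟙 (a ∨ e) * ∑ (allFin r) (λ j → 𝟙 (if a then F j else G j))
    ≤ 𝟙 a * ∑ (allFin r) (λ j → 𝟙 (F j)) + 𝟙 m * ∑ (allFin r) (λ j → 𝟙 (H j))
merge-≤ true e F G H m e⇒m G⇒H = m≤m+n _ _
merge-≤ {r} false e F G H m e⇒m G⇒H = *-mono-≤ (𝟙-mono e⇒m) (#-mono (allFin r) G⇒H)

module Batches (n h Y : ℕ) (Indep : PF n h → Set) (r : ℕ) {Pt β : Set}
  (on : (Fin n × Fin h) → Pt → Fin r → Bool) (pat : List (Fin r))
  (kill : ∀ γ → Indep γ → ∀ P us → Pointwise (λ u j → on u P j ≡ true) us pat →
    All (γ ∋_) us → AllPairs (λ u v → proj₁ u ≢ proj₁ v) us → ⊥)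
  (bs : List β) (pt : β → Pt) (mem₀ : β → Fin r → (Fin n × Fin h) → Bool)
  (mem₀-on : ∀ b j u → mem₀ b j u ≡ true → on u (pt b) j ≡ true)
  (es : List (Fin n × Fin h)) (∈es : ∀ u → u ∈ es) (∣∣≡# : ∀ X → card (λ i x → X (i , x)) ≡ # es X)
  (mate : (Fin n × Fin h) → (Fin n × Fin h) → Bool)
  (linear : ∀ v u i → mate v u ≡ false →
    ∑ bs (λ b → 𝟙 (mem₀ b i v) * ∑ (allFin r) (λ j → 𝟙 (mem₀ b j u))) ≤ 1)
  (ρ* ω t m z w : ℕ) (z≡32t : z ≡ 32 * t) (w≡64ω : w ≡ 64 * ω) (ρ*>0 : 1 ≤ ρ*) (ω>0 : 1 ≤ ω) (t>0 : 1 ≤ t)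
  (mates : ∀ v → # es (mate v) ≤ ρ*)
  (V : (Fin n × Fin h) → Bool)
  (mem₀-V : ∀ b j u → mem₀ b j u ≡ true → V u ≡ true)
  (size₀ : ∀ b → ∑ (allFin r) (λ j → # es (mem₀ b j)) ≤ ρ* * ω)
  (m-large : 4 * # es V ≤ m * z * ρ*)
  where

  open Cover n h Y Indep

  N : ℕ
  N = # es V

  z>0 : 1 ≤ z
  z>0 = ≤-trans t>0 (≤-trans (m≤n*m t 32) (≤-reflexive (sym z≡32t)))

  w>0 : 1 ≤ w
  w>0 = ≤-trans ω>0 (≤-trans (m≤n*m ω 64) (≤-reflexive (sym w≡64ω)))

  _⊂V : (Elt → Bool) → Set
  X ⊂V = ∀ u → X u ≡ true → V u ≡ true

  Mem : Set
  Mem = β → Fin r → Elt → Bool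

  Deg : (β → Bool) → Mem → Elt → ℕ
  Deg A mem u = ∑ bs (λ b → 𝟙 (A b) * ∑ (allFin r) (λ j → 𝟙 (mem b j u)))

  Chain : List (Fin r) → List Elt → β → Set
  Chain cs U b = ∃ λ us → us ⊆ U × Pointwise (λ u j → on u (pt b) j ≡ true) us cs

  record State (k : ℕ) (cs : List (Fin r)) (d : ℕ) (U : List Elt) (A : β → Bool) (mem : Mem) : Set where
    field
      sub : ∀ b j u → mem b j u ≡ true → mem₀ b j u ≡ true
      chain : ∀ b → A b ≡ true → Chain cs U b
      rich : ∀ b → A b ≡ true → ∀ j → 4 ^ k * ρ* ≤ # es (mem b j)
      deg : ∀ u → Deg A mem u ≤ d * z ^ k

  Full : ℕ → (β → Bool) → Set
  Full k A = N * (4 * z ^ k) ≤ # bs A * (4 ^ k * ρ*)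

  Deg-sum : ∀ A mem (s : Elt → ℕ) →
    ∑ bs (λ b → 𝟙 (A b) * ∑ (allFin r) (λ j → ∑ es (λ u → 𝟙 (mem b j u) * s u)))
      ≡ ∑ es (λ u → Deg A mem u * s u)
  Deg-sum A mem s = begin
    ∑ bs (λ b → 𝟙 (A b) * ∑ (allFin r) (λ j → ∑ es (λ u → 𝟙 (mem b j u) * s u)))
      ≡⟨ ∑-cong bs (λ b → trans (cong (𝟙 (A b) *_) (trans (∑-swap (allFin r) es _) (∑-cong es λ u → ∑-*ʳ (allFin r) (s u) _)))
           (trans (sym (∑-*ˡ es (𝟙 (A b)) _)) (∑-cong es λ u → sym (*-assoc (𝟙 (A b)) _ (s u))))) ⟩
    ∑ bs (λ b → ∑ es (λ u → 𝟙 (A b) * ∑ (allFin r) (λ j → 𝟙 (mem b j u)) * s u))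
      ≡⟨ trans (∑-swap bs es _) (∑-cong es λ u → ∑-*ʳ bs (s u) _) ⟩
    ∑ es (λ u → Deg A mem u * s u) ∎
    where open ≡-Reasoning

  many-high : ∀ d k (D : Elt → ℕ) → (∀ u → D u ≤ d * z ^ k) → (∀ u → V u ≡ false → D u ≡ 0) →
    N * (2 * z ^ k) ≤ ∑ es D → N ≤ # es (λ u → V u ∧ (z ^ k ≤ᵇ D u)) * d
  many-high d k D up out lo = *-cancelʳ-≤ N _ (z ^ k) {{>-nonZero (m^n>0 z {{>-nonZero z>0}} k)}} (+-cancelˡ-≤ (N * z ^ k) _ _ (begin
    N * z ^ k + N * z ^ k ≡⟨ lem N (z ^ k) ⟩
    N * (2 * z ^ k) ≤⟨ lo ⟩
    ∑ es D ≤⟨ ∑-mono es bnd ⟩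
    ∑ es (λ u → 𝟙 (V u) * z ^ k + 𝟙 (high u) * (d * z ^ k)) ≡⟨ trans (∑-+ es _ _) (cong₂ _+_ (∑-*ʳ es (z ^ k) _) (∑-*ʳ es (d * z ^ k) _)) ⟩
    N * z ^ k + # es high * (d * z ^ k) ≡⟨ cong (N * z ^ k +_) (sym (*-assoc (# es high) d (z ^ k))) ⟩
    N * z ^ k + # es high * d * z ^ k ∎))
    where
    open ≤-Reasoning
    high : Elt → Bool
    high u = V u ∧ (z ^ k ≤ᵇ D u)
    lem : ∀ a b → a * b + a * b ≡ a * (2 * b)
    lem = solve-∀
    bnd : ∀ u → D u ≤ 𝟙 (V u) * z ^ k + 𝟙 (high u) * (d * z ^ k)
    bnd u with bool-cases (V u)
    ... | inj₂ f = ≤-trans (≤-reflexive (out u f)) z≤n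
    ... | inj₁ tt rewrite tt with bool-cases (z ^ k ≤ᵇ D u)
    ... | inj₁ tt' rewrite tt' = ≤-trans (up u) (≤-trans (≤-reflexive (sym (*-identityˡ _))) (m≤n+m (1 * (d * z ^ k)) (1 * z ^ k)))
    ... | inj₂ f rewrite f = ≤-trans (<⇒≤ (false-≤ᵇ (z ^ k) (D u) f)) (≤-trans (≤-reflexive (sym (*-identityˡ _))) (m≤m+n _ _))

  Shrunk : ℕ → (Elt → Bool) → Set
  Shrunk κ X = N + κ * ∣ X ∣ₑ ≤ κ * N

  shrink : ∀ κ d X (High : Elt → Bool) → X ⊂V → (∀ u → High u ≡ true → V u ≡ true) →
    (∀ u → X u ≡ true → High u ≡ false) → N ≤ # es High * d → d ≤ κ → Shrunk κ X
  shrink κ d X High X⊂ H⊂ dis big d≤κ rewrite ∣∣≡# X = begin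
    N + κ * # es X ≤⟨ +-monoˡ-≤ _ (≤-trans big (≤-trans (*-monoʳ-≤ (# es High) d≤κ) (≤-reflexive (*-comm (# es High) κ)))) ⟩
    κ * # es High + κ * # es X ≡⟨ sym (*-distribˡ-+ κ (# es High) _) ⟩
    κ * (# es High + # es X) ≤⟨ *-monoʳ-≤ κ (≤-trans (≤-reflexive (sym (∑-+ es _ _))) (∑-mono es ind)) ⟩
    κ * N ∎
    where
    open ≤-Reasoning
    ind : ∀ u → 𝟙 (High u) + 𝟙 (X u) ≤ 𝟙 (V u)
    ind u with bool-cases (X u)
    ... | inj₁ e rewrite e | dis u e | X⊂ u e = ≤-refl
    ... | inj₂ e rewrite e = ≤-trans (≤-reflexive (+-identityʳ _)) (𝟙-mono (H⊂ u))

  module Last (i : Fin r) (cs : List (Fin r)) (pat-eq : i ∷ cs ≡ pat) (κ d : ℕ) (d≤κ : d ≤ κ)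
    (A : β → Bool) (mem : Mem) (full : Full 0 A) (b₀ : ℕ)
    (cont : ∀ U X → X ⊂V → Shrunk κ X → Cov b₀ U X) where

    D : Elt → ℕ
    D u = ∑ bs (λ b → 𝟙 (A b ∧ mem b i u))

    High : Elt → Bool
    High u = V u ∧ (1 ≤ᵇ D u)

    module _ (U : List Elt) (st : State 0 cs d U A mem) where
      open State st

      D≤Deg : ∀ u → D u ≤ d * z ^ 0
      D≤Deg u = ≤-trans (∑-mono bs λ b → ≤-trans (≤-reflexive (𝟙-∧ (A b) _)) (*-monoʳ-≤ (𝟙 (A b)) (∑-∈ _ (∈-allFin i)))) (deg u)

      D-out : ∀ u → V u ≡ false → D u ≡ 0
      D-out u f = ∑-zero bs λ b → cong 𝟙 (¬true⇒false λ e → true≢false (mem₀-V b i u (sub b i u (proj₂ (∧-true {A b} e)))) f)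

      D-total : N * (2 * z ^ 0) ≤ ∑ es D
      D-total = begin
        N * (2 * 1) ≤⟨ *-monoʳ-≤ N (s≤s (s≤s z≤n)) ⟩
        N * (4 * 1) ≤⟨ full ⟩
        # bs A * (1 * ρ*) ≡⟨ sym (∑-*ʳ bs (1 * ρ*) _) ⟩
        ∑ bs (λ b → 𝟙 (A b) * (1 * ρ*)) ≤⟨ ∑-mono bs bnd ⟩
        ∑ bs (λ b → ∑ es (λ u → 𝟙 (A b ∧ mem b i u))) ≡⟨ ∑-swap bs es _ ⟩
        ∑ es D ∎
        where
        open ≤-Reasoning
        bnd : ∀ b → 𝟙 (A b) * (1 * ρ*) ≤ ∑ es (λ u → 𝟙 (A b ∧ mem b i u))
        bnd b with bool-cases (A b)
        ... | inj₂ f rewrite f = z≤n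
        ... | inj₁ e rewrite e = ≤-trans (≤-reflexive (*-identityˡ _)) (rich b e i)

      last : ∀ c X → ∣ X ∣ₑ ≤ c → X ⊂V → Cov b₀ U X
      last c X ∣X∣≤c X⊂ with search es (λ u → X u ∧ High u)
      ... | inj₂ none = cont U X X⊂ (shrink κ d X High X⊂ (λ u e → proj₁ (∧-true {V u} e))
              (λ u e → ¬true⇒false λ e' → true≢false (∧-intro e e') (none u (∈es u))) (many-high d 0 D D≤Deg D-out D-total) d≤κ)
      last zero X ∣X∣≤c X⊂ | inj₁ (v , _ , e) with () ← ≤-trans (∣∖∣ X v (proj₁ (∧-true {X v} e))) ∣X∣≤c
      last (suc c) X ∣X∣≤c X⊂ | inj₁ (v , _ , e) =
        dead v Xv killed (last c (X ∖ v) (≤-pred (≤-trans (∣∖∣ X v Xv) ∣X∣≤c)) λ u p → X⊂ u (∖⊂ X v u p))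
        where
        Xv = proj₁ (∧-true {X v} e)
        found : ∃ λ b → b ∈ bs × 0 < 𝟙 (A b ∧ mem b i v)
        found = ∑-<⇒∃ bs (λ _ → 0) _ (≤-trans (≤-reflexive (cong suc (∑-zero bs λ _ → refl))) (true-≤ᵇ 1 (D v) (proj₂ (∧-true {V v} (proj₂ (∧-true {X v} e))))))
        pos : ∀ {x} → 0 < 𝟙 x → x ≡ true
        pos {true} _ = refl
        killed : ∀ γ → γ ∋ v → ¬ Good U γ
        killed γ γ∋v g with found
        ... | b , _ , lt with ∧-true {A b} (pos lt)
        ... | Ab , mb with chain b Ab
        ... | us , us⊆U , pw = kill (Good.whole g) (Good.free g) (pt b) (v ∷ us)
              (subst (Pointwise _ (v ∷ us)) pat-eq (mem₀-on b i v (sub b i v mb) ∷ pw))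
              (Good.rest g v γ∋v ∷ Sub.All-resp-⊆ us⊆U (Good.chosen g))
              (Sub.All-resp-⊆ us⊆U (Good.fresh g v γ∋v) ∷ AllPairs-resp-⊆ us⊆U (Good.apart g))

  -- A batch of selections advancing blocks by one position. Elements lying in d′ zᵏ advanced
  -- blocks are saturated and ignored from then on, which keeps the degrees balanced.
  module Batch (k : ℕ) (i : Fin r) (cs : List (Fin r)) (κ d : ℕ) (d≤κ : d ≤ κ) (d>0 : 1 ≤ d)
    (A : β → Bool) (mem : Mem) (full : Full (suc k) A) (b₀ : ℕ)
    (cont : ∀ U X → X ⊂V → Shrunk κ X → Cov b₀ U X)
    (next : ∀ U X A' mem' → X ⊂V → State k (i ∷ cs) (w * d) U A' mem' → Full k A' → Cov b₀ U X) where

    d' ρ' : ℕ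
    d' = w * d
    ρ' = 4 ^ k * ρ*

    ρ*≤ρ' : ρ* ≤ ρ'
    ρ*≤ρ' = m≤n*m ρ* (4 ^ k) {{>-nonZero (m^n>0 4 k)}}

    module Step (U : List Elt) (S₁ : State (suc k) cs d U A mem) (A' : β → Bool) (mem' : Mem)
      (S₂ : State k (i ∷ cs) d' U A' mem') where
      module S₁ = State S₁
      module S₂ = State S₂

      sat : Elt → Bool
      sat u = d' * z ^ k ≤ᵇ Deg A' mem' u

      spare : β → Fin r → ℕ
      spare b j = # es (λ u → mem b j u ∧ not (sat u))

      elig pool : β → Bool
      elig b = every (allFin r) (λ j → 4 * ρ' ≤ᵇ 2 * spare b j)
      pool b = A b ∧ (not (A' b) ∧ elig b)

      D : Elt → ℕ
      D u = ∑ bs (λ b → 𝟙 (pool b ∧ mem b i u))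

      High : Elt → Bool
      High u = V u ∧ (z ^ suc k ≤ᵇ D u)

      D≤Deg : ∀ u → D u ≤ d * z ^ suc k
      D≤Deg u = ≤-trans (∑-mono bs λ b → ≤-trans (≤-reflexive (𝟙-∧ (pool b) _))
          (*-mono-≤ (𝟙-mono {pool b} {A b} λ e → proj₁ (∧-true {A b} e)) (∑-∈ (λ j → 𝟙 (mem b j u)) (∈-allFin i)))) (S₁.deg u)

      D-out : ∀ u → V u ≡ false → D u ≡ 0
      D-out u f = ∑-zero bs λ b → cong 𝟙 (¬true⇒false λ e → true≢false (mem₀-V b i u (S₁.sub b i u (proj₂ (∧-true {pool b} e)))) f)

      saturated : # es sat * (d' * z ^ k) ≤ # bs A' * (ρ* * ω)
      saturated = begin
        # es sat * (d' * z ^ k) ≡⟨ sym (∑-*ʳ es (d' * z ^ k) _) ⟩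
        ∑ es (λ u → 𝟙 (sat u) * (d' * z ^ k)) ≤⟨ ∑-mono es bnd ⟩
        ∑ es (λ u → Deg A' mem' u * 1) ≡⟨ sym (Deg-sum A' mem' (λ _ → 1)) ⟩
        ∑ bs (λ b → 𝟙 (A' b) * ∑ (allFin r) (λ j → ∑ es (λ u → 𝟙 (mem' b j u) * 1))) ≤⟨ ∑-mono bs (λ b → *-monoʳ-≤ (𝟙 (A' b))
            (≤-trans (∑-mono (allFin r) λ j → ∑-mono es λ u → ≤-trans (≤-reflexive (*-identityʳ _)) (𝟙-mono (S₂.sub b j u))) (size₀ b))) ⟩
        ∑ bs (λ b → 𝟙 (A' b) * (ρ* * ω)) ≡⟨ ∑-*ʳ bs (ρ* * ω) _ ⟩
        # bs A' * (ρ* * ω) ∎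
        where
        open ≤-Reasoning
        bnd : ∀ u → 𝟙 (sat u) * (d' * z ^ k) ≤ Deg A' mem' u * 1
        bnd u with bool-cases (sat u)
        ... | inj₂ f rewrite f = z≤n
        ... | inj₁ e rewrite e = ≤-trans (≤-reflexive (*-identityˡ _)) (≤-trans (true-≤ᵇ _ _ e) (≤-reflexive (sym (*-identityʳ _))))

      inel : ℕ
      inel = # bs (λ b → A b ∧ not (elig b))

      ineligible : inel * (4 * ρ') ≤ 2 * (# es sat * (d * z ^ suc k))
      ineligible = begin
        inel * (4 * ρ') ≡⟨ sym (∑-*ʳ bs (4 * ρ') _) ⟩
        ∑ bs (λ b → 𝟙 (A b ∧ not (elig b)) * (4 * ρ')) ≤⟨ ∑-mono bs bnd ⟩
        ∑ bs (λ b → 2 * (𝟙 (A b) * ∑ (allFin r) (λ j → ∑ es (λ u → 𝟙 (mem b j u) * 𝟙 (sat u))))) ≡⟨ ∑-*ˡ bs 2 _ ⟩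
        2 * ∑ bs (λ b → 𝟙 (A b) * ∑ (allFin r) (λ j → ∑ es (λ u → 𝟙 (mem b j u) * 𝟙 (sat u)))) ≡⟨ cong (2 *_) (Deg-sum A mem (𝟙 ∘ sat)) ⟩
        2 * ∑ es (λ u → Deg A mem u * 𝟙 (sat u)) ≤⟨ *-monoʳ-≤ 2 (∑-mono es λ u → ≤-trans (*-monoˡ-≤ (𝟙 (sat u)) (S₁.deg u)) (≤-reflexive (*-comm (d * z ^ suc k) _))) ⟩
        2 * ∑ es (λ u → 𝟙 (sat u) * (d * z ^ suc k)) ≡⟨ cong (2 *_) (∑-*ʳ es (d * z ^ suc k) _) ⟩
        2 * (# es sat * (d * z ^ suc k)) ∎
        where
        open ≤-Reasoning
        half : ∀ R x y → R ≤ x + y → 2 * y < R → R ≤ 2 * x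
        half R x y p q = +-cancelʳ-≤ (2 * y) R (2 * x) (begin
          R + 2 * y ≤⟨ +-monoʳ-≤ R (<⇒≤ q) ⟩
          R + R ≤⟨ +-mono-≤ p p ⟩
          x + y + (x + y) ≡⟨ lem x y ⟩
          2 * x + 2 * y ∎)
          where
          lem : ∀ x y → x + y + (x + y) ≡ 2 * x + 2 * y
          lem = solve-∀
        bnd : ∀ b → 𝟙 (A b ∧ not (elig b)) * (4 * ρ') ≤ 2 * (𝟙 (A b) * ∑ (allFin r) (λ j → ∑ es (λ u → 𝟙 (mem b j u) * 𝟙 (sat u))))
        bnd b with bool-cases (A b)
        ... | inj₂ f rewrite f = z≤n
        ... | inj₁ e with bool-cases (elig b)
        ... | inj₁ e' rewrite e | e' = z≤n
        ... | inj₂ f with every-false (allFin r) f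
        ... | j , j∈ , fj rewrite e | f = begin
          1 * (4 * ρ') ≡⟨ *-identityˡ _ ⟩
          4 * ρ' ≤⟨ half (4 * ρ') (# es (λ u → mem b j u ∧ sat u)) (spare b j)
                     (≤-trans (≤-trans (≤-reflexive (sym (*-assoc 4 (4 ^ k) ρ*))) (S₁.rich b e j)) (≤-reflexive (#-split es (mem b j) sat))) (false-≤ᵇ _ _ fj) ⟩
          2 * # es (λ u → mem b j u ∧ sat u) ≡⟨ cong (2 *_) (∑-cong es λ u → 𝟙-∧ (mem b j u) (sat u)) ⟩
          2 * ∑ es (λ u → 𝟙 (mem b j u) * 𝟙 (sat u)) ≤⟨ *-monoʳ-≤ 2 (≤-trans (∑-∈ (λ j → ∑ es (λ u → 𝟙 (mem b j u) * 𝟙 (sat u))) j∈) (≤-reflexive (sym (*-identityˡ _)))) ⟩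
          2 * (1 * ∑ (allFin r) (λ j → ∑ es (λ u → 𝟙 (mem b j u) * 𝟙 (sat u)))) ∎

      count-A : # bs A ≤ # bs A' + # bs pool + inel
      count-A = ≤-trans (∑-mono bs λ b → ind (A b) (A' b) (elig b))
        (≤-reflexive (trans (∑-+ bs (λ b → 𝟙 (A' b) + 𝟙 (pool b)) _) (cong (_+ inel) (∑-+ bs _ _))))
        where
        ind : ∀ a a' e → 𝟙 a ≤ 𝟙 a' + 𝟙 (a ∧ (not a' ∧ e)) + 𝟙 (a ∧ not e)
        ind false a' e = z≤n
        ind true true e = s≤s z≤n
        ind true false true = ≤-refl
        ind true false false = ≤-refl

      D-sum : # bs pool * (4 * ρ') ≤ ∑ es D
      D-sum = begin
        # bs pool * (4 * ρ') ≡⟨ sym (∑-*ʳ bs (4 * ρ') _) ⟩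
        ∑ bs (λ b → 𝟙 (pool b) * (4 * ρ')) ≤⟨ ∑-mono bs bnd ⟩
        ∑ bs (λ b → ∑ es (λ u → 𝟙 (pool b ∧ mem b i u))) ≡⟨ ∑-swap bs es _ ⟩
        ∑ es D ∎
        where
        open ≤-Reasoning
        bnd : ∀ b → 𝟙 (pool b) * (4 * ρ') ≤ ∑ es (λ u → 𝟙 (pool b ∧ mem b i u))
        bnd b with bool-cases (pool b)
        ... | inj₂ f rewrite f = z≤n
        ... | inj₁ e rewrite e = ≤-trans (≤-reflexive (trans (*-identityˡ _) (sym (*-assoc 4 (4 ^ k) ρ*)))) (S₁.rich b (proj₁ (∧-true {A b} e)) i)

      D-total : # bs A' * ρ' < N * (4 * z ^ k) → N * (2 * z ^ suc k) ≤ ∑ es D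
      D-total lt = batch-arith ω d t ρ' N (# bs A) (# bs A') (# es sat) inel (z ^ k) ρ* (# bs pool) (∑ es D) z≡32t w≡64ω ω>0 d>0 t>0 (≤-trans ρ*>0 ρ*≤ρ') lt
        (≤-trans full (≤-reflexive (cong (# bs A *_) (*-assoc 4 (4 ^ k) ρ*)))) saturated ρ*≤ρ' (m^n>0 z {{>-nonZero z>0}} k)
        ineligible count-A D-sum

      module Select (v : Elt) (big : z ^ suc k ≤ D v) where
        E : β → Bool
        E b = pool b ∧ mem b i v

        ok : Elt → Bool
        ok u = not (sat u) ∧ not (mate v u)

        A'' : β → Bool
        A'' b = A' b ∨ E b

        mem'' : Mem
        mem'' b j u = if A' b then mem' b j u else (mem b j u ∧ ok u)

        sub'' : ∀ b j u → mem'' b j u ≡ true → mem₀ b j u ≡ true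
        sub'' b j u e with A' b
        ... | true = S₂.sub b j u e
        ... | false = S₁.sub b j u (proj₁ (∧-true {mem b j u} e))

        keep : ∀ {ds b} → Chain ds U b → Chain ds (v ∷ U) b
        keep (us , us⊆ , pw) = us , v ∷ʳ us⊆ , pw

        chain'' : ∀ b → A'' b ≡ true → Chain (i ∷ cs) (v ∷ U) b
        chain'' b e with bool-cases (A' b)
        ... | inj₁ t = keep (S₂.chain b t)
        ... | inj₂ f with ∧-true {pool b} (subst (λ a → a ∨ E b ≡ true) f e)
        ... | p , q with S₁.chain b (proj₁ (∧-true {A b} p))
        ... | us , us⊆ , pw = v ∷ us , refl ∷ us⊆ , mem₀-on b i v (S₁.sub b i v q) ∷ pw

        rich'' : ∀ b → A'' b ≡ true → ∀ j → ρ' ≤ # es (mem'' b j)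
        rich'' b e j with bool-cases (A' b)
        ... | inj₁ t = subst (λ a → ρ' ≤ # es (λ u → if a then mem' b j u else (mem b j u ∧ ok u))) (sym t) (S₂.rich b t j)
        ... | inj₂ f = subst (λ a → ρ' ≤ # es (λ u → if a then mem' b j u else (mem b j u ∧ ok u))) (sym f)
              (*-cancelˡ-≤ 2 (+-cancelʳ-≤ (2 * ρ') _ _ (begin
                2 * ρ' + 2 * ρ' ≡⟨ lem ρ' ⟩
                4 * ρ' ≤⟨ true-≤ᵇ _ _ (every-∈ {xs = allFin r} el (∈-allFin j)) ⟩
                2 * spare b j ≤⟨ *-monoʳ-≤ 2 (≤-trans (∑-mono es λ u → ind (mem b j u) (sat u) (mate v u)) (≤-trans (≤-reflexive (∑-+ es (λ u → 𝟙 (mem b j u ∧ ok u)) (𝟙 ∘ mate v))) (+-monoʳ-≤ (# es (λ u → mem b j u ∧ ok u)) (≤-trans (mates v) ρ*≤ρ')))) ⟩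
                2 * (# es (λ u → mem b j u ∧ ok u) + ρ') ≡⟨ *-distribˡ-+ 2 (# es (λ u → mem b j u ∧ ok u)) ρ' ⟩
                2 * # es (λ u → mem b j u ∧ ok u) + 2 * ρ' ∎)))
          where
          open ≤-Reasoning
          lem : ∀ x → 2 * x + 2 * x ≡ 4 * x
          lem = solve-∀
          el : elig b ≡ true
          el = proj₂ (∧-true {not (A' b)} (proj₂ (∧-true {A b} (proj₁ (∧-true {pool b} (subst (λ a → a ∨ E b ≡ true) f e))))))
          ind : ∀ a s t → 𝟙 (a ∧ not s) ≤ 𝟙 (a ∧ (not s ∧ not t)) + 𝟙 t
          ind false s t = z≤n
          ind true true t = z≤n
          ind true false true = ≤-refl
          ind true false false = ≤-refl

        deg'' : ∀ u → Deg A'' mem'' u ≤ d' * z ^ k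
        deg'' u with bool-cases (ok u)
        ... | inj₂ f = ≤-trans (∑-mono bs bnd) (S₂.deg u)
          where
          bnd : ∀ b → 𝟙 (A'' b) * ∑ (allFin r) (λ j → 𝟙 (mem'' b j u)) ≤ 𝟙 (A' b) * ∑ (allFin r) (λ j → 𝟙 (mem' b j u))
          bnd b = merge-zero (A' b) (E b) (λ j → mem' b j u) _ λ j → ¬true⇒false λ q → true≢false (proj₂ (∧-true {mem b j u} q)) f
        ... | inj₁ e = begin
            Deg A'' mem'' u ≤⟨ ∑-mono bs bnd ⟩
            ∑ bs (λ b → 𝟙 (A' b) * ∑ (allFin r) (λ j → 𝟙 (mem' b j u)) + 𝟙 (mem₀ b i v) * ∑ (allFin r) (λ j → 𝟙 (mem₀ b j u))) ≡⟨ ∑-+ bs _ _ ⟩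
            Deg A' mem' u + ∑ bs (λ b → 𝟙 (mem₀ b i v) * ∑ (allFin r) (λ j → 𝟙 (mem₀ b j u)))
              ≤⟨ +-monoʳ-≤ (Deg A' mem' u) (linear v u i (not-true (proj₂ (∧-true {not (sat u)} e)))) ⟩
            Deg A' mem' u + 1 ≡⟨ +-comm _ 1 ⟩
            suc (Deg A' mem' u) ≤⟨ false-≤ᵇ _ _ (not-true (proj₁ (∧-true {not (sat u)} e))) ⟩
            d' * z ^ k ∎
          where
          open ≤-Reasoning
          bnd : ∀ b → 𝟙 (A'' b) * ∑ (allFin r) (λ j → 𝟙 (mem'' b j u)) ≤
            𝟙 (A' b) * ∑ (allFin r) (λ j → 𝟙 (mem' b j u)) + 𝟙 (mem₀ b i v) * ∑ (allFin r) (λ j → 𝟙 (mem₀ b j u))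
          bnd b = merge-≤ (A' b) (E b) (λ j → mem' b j u) _ _ _ (λ q → S₁.sub b i v (proj₂ (∧-true {pool b} q)))
            λ j q → S₁.sub b j u (proj₁ (∧-true {mem b j u} q))

        S₁″ : State (suc k) cs d (v ∷ U) A mem
        S₁″ = record { sub = S₁.sub ; chain = λ b e → keep (S₁.chain b e) ; rich = S₁.rich ; deg = S₁.deg }

        S₂″ : State k (i ∷ cs) d' (v ∷ U) A'' mem''
        S₂″ = record { sub = sub'' ; chain = chain'' ; rich = rich'' ; deg = deg'' }

        grow : # bs A' + z ^ suc k ≤ # bs A''
        grow = ≤-trans (+-monoʳ-≤ _ big) (≤-trans (≤-reflexive (sym (∑-+ bs _ _))) (∑-mono bs λ b → ind (A b) (A' b) (elig b) (mem b i v)))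
          where
          ind : ∀ a a' e m → 𝟙 a' + 𝟙 ((a ∧ (not a' ∧ e)) ∧ m) ≤ 𝟙 (a' ∨ ((a ∧ (not a' ∧ e)) ∧ m))
          ind false true e m = ≤-refl
          ind true true e m = ≤-refl
          ind false false e m = ≤-refl
          ind true false e m = ≤-refl

    Budget : ℕ → (β → Bool) → Set
    Budget b A' = N * (4 * z ^ k) ≤ (# bs A' + b * z ^ suc k) * ρ'

    batch : ∀ b c U X → ∣ X ∣ₑ ≤ c → X ⊂V → State (suc k) cs d U A mem →
      ∀ A' mem' → State k (i ∷ cs) d' U A' mem' → Budget b A' → Cov (b + b₀) U X
    batch b c U X X≤c X⊂ S₁ A' mem' S₂ bud with (# bs A' * ρ') <? N * (4 * z ^ k)
    ... | no ≮ = weaken* b (next U X A' mem' X⊂ S₂ (≮⇒≥ ≮))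
    ... | yes lt with search es (λ u → X u ∧ Step.High U S₁ A' mem' S₂ u)
    ... | inj₂ none = weaken* b (cont U X X⊂ (shrink κ d X High X⊂ (λ u e → proj₁ (∧-true {V u} e))
              (λ u e → ¬true⇒false λ e' → true≢false (∧-intro e e') (none u (∈es u))) (many-high d (suc k) D D≤Deg D-out (D-total lt)) d≤κ))
      where open Step U S₁ A' mem' S₂
    batch zero c U X X≤c X⊂ S₁ A' mem' S₂ bud | yes lt | inj₁ _ =
      ⊥-elim (<⇒≱ lt (≤-trans bud (≤-reflexive (cong (_* ρ') (+-identityʳ (# bs A'))))))
    batch (suc b) zero U X X≤c X⊂ S₁ A' mem' S₂ bud | yes lt | inj₁ (v , _ , e) with () ← ≤-trans (∣∖∣ X v (proj₁ (∧-true {X v} e))) X≤c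
    batch (suc b) (suc c) U X X≤c X⊂ S₁ A' mem' S₂ bud | yes lt | inj₁ (v , _ , e) =
      branch v Xv
        (batch (suc b) c U (X ∖ v) (≤-pred (≤-trans (∣∖∣ X v Xv) X≤c)) (λ u p → X⊂ u (∖⊂ X v u p)) S₁ A' mem' S₂ bud)
        (batch b ∣ X ∣ₑ (v ∷ U) X ≤-refl X⊂ S₁″ A'' mem'' S₂″
          (≤-trans bud (*-monoˡ-≤ ρ' (≤-trans (≤-reflexive (lem (# bs A') (z ^ suc k) b)) (+-monoˡ-≤ (b * z ^ suc k) grow)))))
      where
      Xv = proj₁ (∧-true {X v} e)
      open Step U S₁ A' mem' S₂
      open Select v (true-≤ᵇ _ _ (proj₂ (∧-true {V v} (proj₂ (∧-true {X v} e)))))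
      lem : ∀ a y b → a + (1 + b) * y ≡ a + y + b * y
      lem = solve-∀

    start : ∀ U X → X ⊂V → State (suc k) cs d U A mem → Cov (m + b₀) U X
    start U X X⊂ S₁ = batch m ∣ X ∣ₑ U X ≤-refl X⊂ S₁ (λ _ → false) mem₀
      (record { sub = λ b j u e → e ; chain = λ b () ; rich = λ b () ; deg = λ u → ≤-trans (≤-reflexive (∑-zero bs λ _ → refl)) z≤n })
      (begin
        N * (4 * z ^ k) ≡⟨ e₁ N (z ^ k) ⟩
        4 * N * z ^ k ≤⟨ *-monoˡ-≤ (z ^ k) m-large ⟩
        m * z * ρ* * z ^ k ≤⟨ *-monoˡ-≤ (z ^ k) (*-monoʳ-≤ (m * z) ρ*≤ρ') ⟩
        m * z * ρ' * z ^ k ≡⟨ e₂ m z ρ' (z ^ k) ⟩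
        m * z ^ suc k * ρ' ≡⟨ cong (λ a → (a + m * z ^ suc k) * ρ') (sym (∑-zero bs λ _ → refl)) ⟩
        (# bs (λ _ → false) + m * z ^ suc k) * ρ' ∎)
      where
      open ≤-Reasoning
      e₁ : ∀ N x → N * (4 * x) ≡ 4 * N * x
      e₁ = solve-∀
      e₂ : ∀ m z R x → m * z * R * x ≡ m * (z * x) * R
      e₂ = solve-∀

  round : ∀ rest cs k → length rest ≡ suc k → rest ʳ++ cs ≡ pat → ∀ κ d b₀ → 1 ≤ d → w ^ k * d ≤ κ →
    ∀ U X A mem → X ⊂V → State k cs d U A mem → Full k A →
    (∀ U X → X ⊂V → Shrunk κ X → Cov b₀ U X) → Cov (k * m + b₀) U X
  round (i ∷ []) cs zero len pat-eq κ d b₀ d>0 d≤κ U X A mem X⊂ st full cont =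
    Last.last i cs pat-eq κ d (≤-trans (≤-reflexive (sym (*-identityˡ d))) d≤κ) A mem full b₀ cont U st ∣ X ∣ₑ X ≤-refl X⊂
  round (i ∷ rest) cs (suc k) len pat-eq κ d b₀ d>0 d≤κ U X A mem X⊂ st full cont =
    subst (λ b → Cov b U X) (sym (+-assoc m (k * m) b₀))
      (Batch.start k i cs κ d (≤-trans (m≤n*m d (w ^ suc k) {{>-nonZero (m^n>0 w {{>-nonZero w>0}} (suc k))}}) d≤κ) d>0 A mem full (k * m + b₀)
        (λ U X X⊂ sh → weaken* (k * m) (cont U X X⊂ sh))
        (λ U X A' mem' X⊂ st' full' → round rest (i ∷ cs) k (cong pred len) pat-eq κ (w * d) b₀
          (≤-trans d>0 (m≤n*m d w {{>-nonZero w>0}}))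
          (≤-trans (≤-reflexive (trans (sym (*-assoc (w ^ k) w d)) (cong (_* d) (*-comm (w ^ k) w)))) d≤κ)
          U X A' mem' X⊂ st' full' cont) U X X⊂ st)

record InvolutiveDomain : Set₁ where
  field
    semiring : CommutativeSemiring 0ℓ 0ℓ
  open CommutativeSemiring semiring using (0#; _≈_) renaming (Carrier to K; _+_ to _⊕_; _*_ to _⊗_) public
  field
    cancel : ∀ x {y z} → (y ⊕ x) ≈ (z ⊕ x) → y ≈ z
    domain : ∀ {x y} → (x ⊗ y) ≈ 0# → (x ≈ 0#) ⊎ (y ≈ 0#)
    subtract : ∀ x y → ∃ λ u → x ≈ (y ⊕ u)
    halve : ∀ {x} → (x ⊕ x) ≈ 0# → x ≈ 0#
    conj : K → K
    conj-cong : ∀ {x y} → x ≈ y → conj x ≈ conj y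
    conj-+ : ∀ x y → conj (x ⊕ y) ≈ (conj x ⊕ conj y)
    conj-* : ∀ x y → conj (x ⊗ y) ≈ (conj x ⊗ conj y)
    conj-conj : ∀ x → conj (conj x) ≈ x

-- The Hermitian curve y + ȳ = 2 x x̄ and the lines y = a x + b contain no O'Nan configuration:
-- if a fourth line meets the sides of a triangle e₁e₂e₃ of curve points in curve points, then
-- h₁₂h₂₃h₃₁ + h₂₁h₃₂h₁₃ = 0 for the Hermitian form h, but this sum is the Gram determinant of the triangle.
-- All equations are arranged so that no subtraction occurs.
module Hermitian (domain-with-involution : InvolutiveDomain) where
  open InvolutiveDomain domain-with-involution
  open Algebra.Solver.Ring.NaturalCoefficients.Default semiring using (solve; _:+_; _:*_; _:=_)
  open CommutativeSemiring semiring using (setoid; distribˡ)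
    renaming (refl to ≈refl; sym to ≈sym; trans to ≈trans; +-cong to ⊕cong; *-cong to ⊗cong;
              +-identityʳ to ⊕0; +-identityˡ to 0⊕; zeroʳ to ⊗0; zeroˡ to 0⊗; +-comm to ⊕comm; *-comm to ⊗comm)
  open Relation.Binary.Reasoning.Setoid setoid

  cancel₀ : ∀ {x y} → (x ⊕ y) ≈ y → x ≈ 0#
  cancel₀ {x} {y} e = cancel y (≈trans e (≈sym (0⊕ y)))

  form-at-base : ∀ {X X' Y Y' u v' x z' y w' a c g k H} → (Y ⊕ Y') ≈ (X ⊗ X' ⊕ X ⊗ X') →
    x ≈ (X ⊕ u) → z' ≈ (X' ⊕ v') → y ≈ (Y ⊕ a ⊗ u) → w' ≈ (Y' ⊕ c ⊗ v') →
    a ≈ (g ⊕ (X' ⊕ X')) → c ≈ (k ⊕ (X ⊕ X)) → (H ⊕ (x ⊗ z' ⊕ x ⊗ z')) ≈ (y ⊕ w') →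
    (H ⊕ (u ⊗ v' ⊕ u ⊗ v')) ≈ (g ⊗ u ⊕ k ⊗ v')
  form-at-base {X} {X'} {Y} {Y'} {u} {v'} {x} {z'} {y} {w'} {a} {c} {g} {k} {H} iso ex ez ey ew ea ec eH =
    cancel ((X ⊗ X' ⊕ X ⊗ X') ⊕ ((X ⊗ v' ⊕ X ⊗ v') ⊕ (u ⊗ X' ⊕ u ⊗ X'))) (begin
      (H ⊕ (u ⊗ v' ⊕ u ⊗ v')) ⊕ ((X ⊗ X' ⊕ X ⊗ X') ⊕ ((X ⊗ v' ⊕ X ⊗ v') ⊕ (u ⊗ X' ⊕ u ⊗ X'))) ≈⟨ i₁ H u v' X X' ⟩
      H ⊕ ((X ⊕ u) ⊗ (X' ⊕ v') ⊕ (X ⊕ u) ⊗ (X' ⊕ v')) ≈⟨ ⊕cong ≈refl (⊕cong (⊗cong (≈sym ex) (≈sym ez)) (⊗cong (≈sym ex) (≈sym ez))) ⟩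
      H ⊕ (x ⊗ z' ⊕ x ⊗ z') ≈⟨ eH ⟩
      y ⊕ w' ≈⟨ ⊕cong (≈trans ey (⊕cong ≈refl (⊗cong ea ≈refl))) (≈trans ew (⊕cong ≈refl (⊗cong ec ≈refl))) ⟩
      (Y ⊕ (g ⊕ (X' ⊕ X')) ⊗ u) ⊕ (Y' ⊕ (k ⊕ (X ⊕ X)) ⊗ v') ≈⟨ i₂ Y Y' g k X X' u v' ⟩
      (g ⊗ u ⊕ k ⊗ v') ⊕ ((Y ⊕ Y') ⊕ ((X ⊗ v' ⊕ X ⊗ v') ⊕ (u ⊗ X' ⊕ u ⊗ X'))) ≈⟨ ⊕cong ≈refl (⊕cong iso ≈refl) ⟩
      (g ⊗ u ⊕ k ⊗ v') ⊕ ((X ⊗ X' ⊕ X ⊗ X') ⊕ ((X ⊗ v' ⊕ X ⊗ v') ⊕ (u ⊗ X' ⊕ u ⊗ X'))) ∎)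
    where
    i₁ : ∀ H u v' X X' → ((H ⊕ (u ⊗ v' ⊕ u ⊗ v')) ⊕ ((X ⊗ X' ⊕ X ⊗ X') ⊕ ((X ⊗ v' ⊕ X ⊗ v') ⊕ (u ⊗ X' ⊕ u ⊗ X')))) ≈
      (H ⊕ ((X ⊕ u) ⊗ (X' ⊕ v') ⊕ (X ⊕ u) ⊗ (X' ⊕ v')))
    i₁ = solve 5 (λ H u v' X X' → ((H :+ (u :* v' :+ u :* v')) :+ ((X :* X' :+ X :* X') :+ ((X :* v' :+ X :* v') :+ (u :* X' :+ u :* X')))) := (H :+ ((X :+ u) :* (X' :+ v') :+ (X :+ u) :* (X' :+ v')))) ≈refl
    i₂ : ∀ Y Y' g k X X' u v' → ((Y ⊕ (g ⊕ (X' ⊕ X')) ⊗ u) ⊕ (Y' ⊕ (k ⊕ (X ⊕ X)) ⊗ v')) ≈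
      ((g ⊗ u ⊕ k ⊗ v') ⊕ ((Y ⊕ Y') ⊕ ((X ⊗ v' ⊕ X ⊗ v') ⊕ (u ⊗ X' ⊕ u ⊗ X'))))
    i₂ = solve 8 (λ Y Y' g k X X' u v' → ((Y :+ (g :+ (X' :+ X')) :* u) :+ (Y' :+ (k :+ (X :+ X)) :* v')) := ((g :* u :+ k :* v') :+ ((Y :+ Y') :+ ((X :* v' :+ X :* v') :+ (u :* X' :+ u :* X'))))) ≈refl

  side : ∀ {g k u u' v v' H₁ H₂} → (g ⊗ u ⊕ k ⊗ u') ≈ (u ⊗ u' ⊕ u ⊗ u') → (g ⊗ v ⊕ k ⊗ v') ≈ (v ⊗ v' ⊕ v ⊗ v') →
    (H₁ ⊕ (u ⊗ v' ⊕ u ⊗ v')) ≈ (g ⊗ u ⊕ k ⊗ v') → (H₂ ⊕ (v ⊗ u' ⊕ v ⊗ u')) ≈ (g ⊗ v ⊕ k ⊗ u') →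
    (v ⊗ u' ⊗ H₁ ⊕ u ⊗ v' ⊗ H₂) ≈ 0#
  side {g} {k} {u} {u'} {v} {v'} {H₁} {H₂} eu ev e₁ e₂ = cancel₀ (begin
    (v ⊗ u' ⊗ H₁ ⊕ u ⊗ v' ⊗ H₂) ⊕ (W ⊕ W ⊕ (W ⊕ W)) ≈⟨ i₁ u u' v v' H₁ H₂ ⟩
    v ⊗ u' ⊗ (H₁ ⊕ (u ⊗ v' ⊕ u ⊗ v')) ⊕ u ⊗ v' ⊗ (H₂ ⊕ (v ⊗ u' ⊕ v ⊗ u')) ≈⟨ ⊕cong (⊗cong ≈refl e₁) (⊗cong ≈refl e₂) ⟩
    v ⊗ u' ⊗ (g ⊗ u ⊕ k ⊗ v') ⊕ u ⊗ v' ⊗ (g ⊗ v ⊕ k ⊗ u') ≈⟨ i₂ g k u u' v v' ⟩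
    u ⊗ u' ⊗ (g ⊗ v ⊕ k ⊗ v') ⊕ v ⊗ v' ⊗ (g ⊗ u ⊕ k ⊗ u') ≈⟨ ⊕cong (⊗cong ≈refl ev) (⊗cong ≈refl eu) ⟩
    u ⊗ u' ⊗ (v ⊗ v' ⊕ v ⊗ v') ⊕ v ⊗ v' ⊗ (u ⊗ u' ⊕ u ⊗ u') ≈⟨ i₃ u u' v v' ⟩
    (W ⊕ W ⊕ (W ⊕ W)) ∎)
    where
    W = u ⊗ u' ⊗ (v ⊗ v')
    i₁ : ∀ u u' v v' H₁ H₂ → ((v ⊗ u' ⊗ H₁ ⊕ u ⊗ v' ⊗ H₂) ⊕ (u ⊗ u' ⊗ (v ⊗ v') ⊕ u ⊗ u' ⊗ (v ⊗ v') ⊕ (u ⊗ u' ⊗ (v ⊗ v') ⊕ u ⊗ u' ⊗ (v ⊗ v')))) ≈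
      (v ⊗ u' ⊗ (H₁ ⊕ (u ⊗ v' ⊕ u ⊗ v')) ⊕ u ⊗ v' ⊗ (H₂ ⊕ (v ⊗ u' ⊕ v ⊗ u')))
    i₁ = solve 6 (λ u u' v v' H₁ H₂ → ((v :* u' :* H₁ :+ u :* v' :* H₂) :+ (u :* u' :* (v :* v') :+ u :* u' :* (v :* v') :+ (u :* u' :* (v :* v') :+ u :* u' :* (v :* v')))) := (v :* u' :* (H₁ :+ (u :* v' :+ u :* v')) :+ u :* v' :* (H₂ :+ (v :* u' :+ v :* u')))) ≈refl
    i₂ : ∀ g k u u' v v' → (v ⊗ u' ⊗ (g ⊗ u ⊕ k ⊗ v') ⊕ u ⊗ v' ⊗ (g ⊗ v ⊕ k ⊗ u')) ≈
      (u ⊗ u' ⊗ (g ⊗ v ⊕ k ⊗ v') ⊕ v ⊗ v' ⊗ (g ⊗ u ⊕ k ⊗ u'))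
    i₂ = solve 6 (λ g k u u' v v' → (v :* u' :* (g :* u :+ k :* v') :+ u :* v' :* (g :* v :+ k :* u')) := (u :* u' :* (g :* v :+ k :* v') :+ v :* v' :* (g :* u :+ k :* u'))) ≈refl
    i₃ : ∀ u u' v v' → (u ⊗ u' ⊗ (v ⊗ v' ⊕ v ⊗ v') ⊕ v ⊗ v' ⊗ (u ⊗ u' ⊕ u ⊗ u')) ≈
      (u ⊗ u' ⊗ (v ⊗ v') ⊕ u ⊗ u' ⊗ (v ⊗ v') ⊕ (u ⊗ u' ⊗ (v ⊗ v') ⊕ u ⊗ u' ⊗ (v ⊗ v')))
    i₃ = solve 4 (λ u u' v v' → (u :* u' :* (v :* v' :+ v :* v') :+ v :* v' :* (u :* u' :+ u :* u')) := (u :* u' :* (v :* v') :+ u :* u' :* (v :* v') :+ (u :* u' :* (v :* v') :+ u :* u' :* (v :* v')))) ≈refl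

  height : ∀ {a a₄ b₄ α X Y x y u ℓ} → a ≈ (a₄ ⊕ α) → Y ≈ (a₄ ⊗ X ⊕ b₄) → y ≈ (Y ⊕ a ⊗ u) → x ≈ (X ⊕ u) →
    y ≈ (a₄ ⊗ x ⊕ b₄ ⊕ ℓ) → ℓ ≈ (α ⊗ u)
  height {a} {a₄} {b₄} {α} {X} {Y} {x} {y} {u} {ℓ} ea eY ey ex eℓ = cancel (a₄ ⊗ x ⊕ b₄) (begin
    ℓ ⊕ (a₄ ⊗ x ⊕ b₄) ≈⟨ i₁ ℓ a₄ x b₄ ⟩
    a₄ ⊗ x ⊕ b₄ ⊕ ℓ ≈⟨ ≈trans (≈sym eℓ) ey ⟩
    Y ⊕ a ⊗ u ≈⟨ ⊕cong eY (⊗cong ea ≈refl) ⟩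
    (a₄ ⊗ X ⊕ b₄) ⊕ (a₄ ⊕ α) ⊗ u ≈⟨ i₂ a₄ X b₄ α u ⟩
    α ⊗ u ⊕ (a₄ ⊗ (X ⊕ u) ⊕ b₄) ≈⟨ ⊕cong ≈refl (⊕cong (⊗cong ≈refl (≈sym ex)) ≈refl) ⟩
    α ⊗ u ⊕ (a₄ ⊗ x ⊕ b₄) ∎)
    where
    i₁ : ∀ ℓ a x b → (ℓ ⊕ (a ⊗ x ⊕ b)) ≈ (a ⊗ x ⊕ b ⊕ ℓ)
    i₁ = solve 4 (λ ℓ a x b → (ℓ :+ (a :* x :+ b)) := (a :* x :+ b :+ ℓ)) ≈refl
    i₂ : ∀ a X b α u → ((a ⊗ X ⊕ b) ⊕ (a ⊕ α) ⊗ u) ≈ (α ⊗ u ⊕ (a ⊗ (X ⊕ u) ⊕ b))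
    i₂ = solve 5 (λ a X b α u → ((a :* X :+ b) :+ (a :+ α) :* u) := (α :* u :+ (a :* (X :+ u) :+ b))) ≈refl

  triple : ∀ {s₁ s₂ s₃ t₁ t₂ t₃} → (s₁ ⊕ t₁) ≈ 0# → (s₂ ⊕ t₂) ≈ 0# → (s₃ ⊕ t₃) ≈ 0# →
    (s₁ ⊗ s₂ ⊗ s₃ ⊕ t₁ ⊗ t₂ ⊗ t₃) ≈ 0#
  triple {s₁} {s₂} {s₃} {t₁} {t₂} {t₃} e₁ e₂ e₃ = begin
    s₁ ⊗ s₂ ⊗ s₃ ⊕ t₁ ⊗ t₂ ⊗ t₃ ≈⟨ ≈sym (≈trans (⊕cong ≈refl (≈trans (⊗cong ≈refl e₂) (⊗0 _))) (⊕0 _)) ⟩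
    s₁ ⊗ s₂ ⊗ s₃ ⊕ t₁ ⊗ t₂ ⊗ t₃ ⊕ t₁ ⊗ s₃ ⊗ (s₂ ⊕ t₂) ≈⟨ i₁ s₁ s₂ s₃ t₁ t₂ t₃ ⟩
    s₂ ⊗ s₃ ⊗ (s₁ ⊕ t₁) ⊕ t₁ ⊗ t₂ ⊗ (s₃ ⊕ t₃) ≈⟨ ⊕cong (≈trans (⊗cong ≈refl e₁) (⊗0 _)) (≈trans (⊗cong ≈refl e₃) (⊗0 _)) ⟩
    0# ⊕ 0# ≈⟨ 0⊕ 0# ⟩
    0# ∎
    where
    i₁ : ∀ s₁ s₂ s₃ t₁ t₂ t₃ → (s₁ ⊗ s₂ ⊗ s₃ ⊕ t₁ ⊗ t₂ ⊗ t₃ ⊕ t₁ ⊗ s₃ ⊗ (s₂ ⊕ t₂)) ≈ (s₂ ⊗ s₃ ⊗ (s₁ ⊕ t₁) ⊕ t₁ ⊗ t₂ ⊗ (s₃ ⊕ t₃))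
    i₁ = solve 6 (λ s₁ s₂ s₃ t₁ t₂ t₃ → (s₁ :* s₂ :* s₃ :+ t₁ :* t₂ :* t₃ :+ t₁ :* s₃ :* (s₂ :+ t₂)) := (s₂ :* s₃ :* (s₁ :+ t₁) :+ t₁ :* t₂ :* (s₃ :+ t₃))) ≈refl

  difference : ∀ {g γ k κ} → (k ⊗ γ ⊕ g ⊗ κ) ≈ (g ⊗ k ⊕ γ ⊗ κ) → (g ≈ γ) ⊎ (k ≈ κ)
  difference {g} {γ} {k} {κ} e with subtract g γ | subtract k κ
  ... | α , ea | β , eb with domain {α} {β} (cancel₀ {α ⊗ β} {g ⊗ κ ⊕ γ ⊗ k} (begin
    α ⊗ β ⊕ (g ⊗ κ ⊕ γ ⊗ k) ≈⟨ ⊕cong ≈refl (⊕cong (⊗cong ea ≈refl) (⊗cong ≈refl eb)) ⟩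
    α ⊗ β ⊕ ((γ ⊕ α) ⊗ κ ⊕ γ ⊗ (κ ⊕ β)) ≈⟨ i₁ α β γ κ ⟩
    (γ ⊕ α) ⊗ (κ ⊕ β) ⊕ γ ⊗ κ ≈⟨ ⊕cong (⊗cong (≈sym ea) (≈sym eb)) ≈refl ⟩
    g ⊗ k ⊕ γ ⊗ κ ≈⟨ ≈sym e ⟩
    k ⊗ γ ⊕ g ⊗ κ ≈⟨ i₂ k γ g κ ⟩
    g ⊗ κ ⊕ γ ⊗ k ∎))
    where
    i₁ : ∀ α β γ κ → (α ⊗ β ⊕ ((γ ⊕ α) ⊗ κ ⊕ γ ⊗ (κ ⊕ β))) ≈ ((γ ⊕ α) ⊗ (κ ⊕ β) ⊕ γ ⊗ κ)
    i₁ = solve 4 (λ α β γ κ → (α :* β :+ ((γ :+ α) :* κ :+ γ :* (κ :+ β))) := ((γ :+ α) :* (κ :+ β) :+ γ :* κ)) ≈refl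
    i₂ : ∀ k γ g κ → (k ⊗ γ ⊕ g ⊗ κ) ≈ (g ⊗ κ ⊕ γ ⊗ k)
    i₂ = solve 4 (λ k γ g κ → (k :* γ :+ g :* κ) := (g :* κ :+ γ :* k)) ≈refl
  ... | inj₁ z = inj₁ (≈trans ea (≈trans (⊕cong ≈refl z) (⊕0 γ)))
  ... | inj₂ z = inj₂ (≈trans eb (≈trans (⊕cong ≈refl z) (⊕0 κ)))

  gram : ∀ {g k γ κ u u' v v' H₂₃ H₃₂} → ¬ (u ≈ 0#) → ¬ (u' ≈ 0#) → ¬ (v ≈ 0#) → ¬ (v' ≈ 0#) →
    (g ⊗ u ⊕ k ⊗ u') ≈ (u ⊗ u' ⊕ u ⊗ u') → (γ ⊗ v ⊕ κ ⊗ v') ≈ (v ⊗ v' ⊕ v ⊗ v') →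
    (H₂₃ ⊕ (u ⊗ v' ⊕ u ⊗ v')) ≈ (g ⊗ u ⊕ κ ⊗ v') → (H₃₂ ⊕ (v ⊗ u' ⊕ v ⊗ u')) ≈ (γ ⊗ v ⊕ k ⊗ u') →
    ((k ⊗ u') ⊗ H₂₃ ⊗ (γ ⊗ v) ⊕ (g ⊗ u) ⊗ H₃₂ ⊗ (κ ⊗ v')) ≈ 0# → (g ≈ γ) ⊎ (k ≈ κ)
  gram {g} {k} {γ} {κ} {u} {u'} {v} {v'} {H₂₃} {H₃₂} u≉ u'≉ v≉ v'≉ eu ev e₂₃ e₃₂ eG =
    difference (cancelled (begin
      W ⊗ (k ⊗ γ ⊕ g ⊗ κ) ⊕ W ⊗ (k ⊗ γ ⊕ g ⊗ κ) ≈⟨ ≈sym (≈trans (⊕cong eG ≈refl) (0⊕ _)) ⟩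
      ((k ⊗ u') ⊗ H₂₃ ⊗ (γ ⊗ v) ⊕ (g ⊗ u) ⊗ H₃₂ ⊗ (κ ⊗ v')) ⊕ (W ⊗ (k ⊗ γ ⊕ g ⊗ κ) ⊕ W ⊗ (k ⊗ γ ⊕ g ⊗ κ)) ≈⟨ i₁ g k γ κ u u' v v' H₂₃ H₃₂ ⟩
      k ⊗ u' ⊗ (γ ⊗ v) ⊗ (H₂₃ ⊕ (u ⊗ v' ⊕ u ⊗ v')) ⊕ g ⊗ u ⊗ (κ ⊗ v') ⊗ (H₃₂ ⊕ (v ⊗ u' ⊕ v ⊗ u')) ≈⟨ ⊕cong (⊗cong ≈refl e₂₃) (⊗cong ≈refl e₃₂) ⟩
      k ⊗ u' ⊗ (γ ⊗ v) ⊗ (g ⊗ u ⊕ κ ⊗ v') ⊕ g ⊗ u ⊗ (κ ⊗ v') ⊗ (γ ⊗ v ⊕ k ⊗ u') ≈⟨ i₂ g k γ κ u u' v v' ⟩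
      g ⊗ k ⊗ (u ⊗ u') ⊗ (γ ⊗ v ⊕ κ ⊗ v') ⊕ γ ⊗ κ ⊗ (v ⊗ v') ⊗ (g ⊗ u ⊕ k ⊗ u') ≈⟨ ⊕cong (⊗cong ≈refl ev) (⊗cong ≈refl eu) ⟩
      g ⊗ k ⊗ (u ⊗ u') ⊗ (v ⊗ v' ⊕ v ⊗ v') ⊕ γ ⊗ κ ⊗ (v ⊗ v') ⊗ (u ⊗ u' ⊕ u ⊗ u') ≈⟨ i₃ g k γ κ u u' v v' ⟩
      W ⊗ (g ⊗ k ⊕ γ ⊗ κ) ⊕ W ⊗ (g ⊗ k ⊕ γ ⊗ κ) ∎))
    where
    W = u ⊗ u' ⊗ (v ⊗ v')
    W≉ : ¬ (W ≈ 0#)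
    W≉ e with domain e
    ... | inj₁ e' = Sum.[ u≉ , u'≉ ]′ (domain e')
    ... | inj₂ e' = Sum.[ v≉ , v'≉ ]′ (domain e')
    cancelled : ∀ {x y} → (W ⊗ x ⊕ W ⊗ x) ≈ (W ⊗ y ⊕ W ⊗ y) → x ≈ y
    cancelled {x} {y} e with subtract x y
    ... | δ , ed with domain {W} {δ} (halve (cancel₀ (begin
        (W ⊗ δ ⊕ W ⊗ δ) ⊕ (W ⊗ y ⊕ W ⊗ y) ≈⟨ j W δ y ⟩
        W ⊗ (y ⊕ δ) ⊕ W ⊗ (y ⊕ δ) ≈⟨ ⊕cong (⊗cong ≈refl (≈sym ed)) (⊗cong ≈refl (≈sym ed)) ⟩
        W ⊗ x ⊕ W ⊗ x ≈⟨ e ⟩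
        W ⊗ y ⊕ W ⊗ y ∎)))
      where
      j : ∀ W δ y → ((W ⊗ δ ⊕ W ⊗ δ) ⊕ (W ⊗ y ⊕ W ⊗ y)) ≈ (W ⊗ (y ⊕ δ) ⊕ W ⊗ (y ⊕ δ))
      j = solve 3 (λ W δ y → ((W :* δ :+ W :* δ) :+ (W :* y :+ W :* y)) := (W :* (y :+ δ) :+ W :* (y :+ δ))) ≈refl
    ... | inj₁ w = ⊥-elim (W≉ w)
    ... | inj₂ d = ≈trans ed (≈trans (⊕cong ≈refl d) (⊕0 y))
    i₁ : ∀ g k γ κ u u' v v' H₂₃ H₃₂ → (((k ⊗ u') ⊗ H₂₃ ⊗ (γ ⊗ v) ⊕ (g ⊗ u) ⊗ H₃₂ ⊗ (κ ⊗ v')) ⊕ (u ⊗ u' ⊗ (v ⊗ v') ⊗ (k ⊗ γ ⊕ g ⊗ κ) ⊕ u ⊗ u' ⊗ (v ⊗ v') ⊗ (k ⊗ γ ⊕ g ⊗ κ))) ≈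
      (k ⊗ u' ⊗ (γ ⊗ v) ⊗ (H₂₃ ⊕ (u ⊗ v' ⊕ u ⊗ v')) ⊕ g ⊗ u ⊗ (κ ⊗ v') ⊗ (H₃₂ ⊕ (v ⊗ u' ⊕ v ⊗ u')))
    i₁ = solve 10 (λ g k γ κ u u' v v' H₂₃ H₃₂ → (((k :* u') :* H₂₃ :* (γ :* v) :+ (g :* u) :* H₃₂ :* (κ :* v')) :+ (u :* u' :* (v :* v') :* (k :* γ :+ g :* κ) :+ u :* u' :* (v :* v') :* (k :* γ :+ g :* κ))) := (k :* u' :* (γ :* v) :* (H₂₃ :+ (u :* v' :+ u :* v')) :+ g :* u :* (κ :* v') :* (H₃₂ :+ (v :* u' :+ v :* u')))) ≈refl
    i₂ : ∀ g k γ κ u u' v v' → (k ⊗ u' ⊗ (γ ⊗ v) ⊗ (g ⊗ u ⊕ κ ⊗ v') ⊕ g ⊗ u ⊗ (κ ⊗ v') ⊗ (γ ⊗ v ⊕ k ⊗ u')) ≈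
      (g ⊗ k ⊗ (u ⊗ u') ⊗ (γ ⊗ v ⊕ κ ⊗ v') ⊕ γ ⊗ κ ⊗ (v ⊗ v') ⊗ (g ⊗ u ⊕ k ⊗ u'))
    i₂ = solve 8 (λ g k γ κ u u' v v' → (k :* u' :* (γ :* v) :* (g :* u :+ κ :* v') :+ g :* u :* (κ :* v') :* (γ :* v :+ k :* u')) := (g :* k :* (u :* u') :* (γ :* v :+ κ :* v') :+ γ :* κ :* (v :* v') :* (g :* u :+ k :* u'))) ≈refl
    i₃ : ∀ g k γ κ u u' v v' → (g ⊗ k ⊗ (u ⊗ u') ⊗ (v ⊗ v' ⊕ v ⊗ v') ⊕ γ ⊗ κ ⊗ (v ⊗ v') ⊗ (u ⊗ u' ⊕ u ⊗ u')) ≈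
      (u ⊗ u' ⊗ (v ⊗ v') ⊗ (g ⊗ k ⊕ γ ⊗ κ) ⊕ u ⊗ u' ⊗ (v ⊗ v') ⊗ (g ⊗ k ⊕ γ ⊗ κ))
    i₃ = solve 8 (λ g k γ κ u u' v v' → (g :* k :* (u :* u') :* (v :* v' :+ v :* v') :+ γ :* κ :* (v :* v') :* (u :* u' :+ u :* u')) := (u :* u' :* (v :* v') :* (g :* k :+ γ :* κ) :+ u :* u' :* (v :* v') :* (g :* k :+ γ :* κ))) ≈refl

  Isotropic : K → K → Set
  Isotropic x y = (y ⊕ conj y) ≈ (x ⊗ conj x ⊕ x ⊗ conj x)

  Incident : K → K → K → K → Set
  Incident a b x y = y ≈ (a ⊗ x ⊕ b)

  along : ∀ {a b X Y x y u} → Incident a b X Y → Incident a b x y → x ≈ (X ⊕ u) → y ≈ (Y ⊕ a ⊗ u)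
  along {a} {b} {X} {Y} {x} {y} {u} eY ey ex = begin
    y ≈⟨ ≈trans ey (⊕cong (⊗cong ≈refl ex) ≈refl) ⟩
    a ⊗ (X ⊕ u) ⊕ b ≈⟨ i₁ a b X u ⟩
    (a ⊗ X ⊕ b) ⊕ a ⊗ u ≈⟨ ⊕cong (≈sym eY) ≈refl ⟩
    Y ⊕ a ⊗ u ∎
    where
    i₁ : ∀ a b X u → (a ⊗ (X ⊕ u) ⊕ b) ≈ ((a ⊗ X ⊕ b) ⊕ a ⊗ u)
    i₁ = solve 4 (λ a b X u → (a :* (X :+ u) :+ b) := ((a :* X :+ b) :+ a :* u)) ≈refl

  conj-sum : ∀ {x X u} → x ≈ (X ⊕ u) → conj x ≈ (conj X ⊕ conj u)
  conj-sum e = ≈trans (conj-cong e) (conj-+ _ _)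

  conj-line : ∀ {y Y a u} → y ≈ (Y ⊕ a ⊗ u) → conj y ≈ (conj Y ⊕ conj a ⊗ conj u)
  conj-line e = ≈trans (conj-sum e) (⊕cong ≈refl (conj-* _ _))

  subtractʳ : ∀ x y → ∃ λ u → x ≈ (u ⊕ y)
  subtractʳ x y with subtract x y
  ... | u , e = u , ≈trans e (⊕comm y u)

  0-sum : ∀ {x y} → y ≈ x → (0# ⊕ x) ≈ y
  0-sum {x} e = ≈trans (0⊕ x) (≈sym e)

  skew : ∀ {a b a₄ b₄ X Y x y z w ℓ m H₁ H₂} → Isotropic X Y → Isotropic x y → Isotropic z w →
    Incident a b X Y → Incident a b x y → Incident a b z w → Incident a₄ b₄ X Y →
    y ≈ (a₄ ⊗ x ⊕ b₄ ⊕ ℓ) → w ≈ (a₄ ⊗ z ⊕ b₄ ⊕ m) →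
    (H₁ ⊕ (x ⊗ conj z ⊕ x ⊗ conj z)) ≈ (y ⊕ conj w) → (H₂ ⊕ (z ⊗ conj x ⊕ z ⊗ conj x)) ≈ (w ⊕ conj y) →
    (m ⊗ conj ℓ ⊗ H₁ ⊕ ℓ ⊗ conj m ⊗ H₂) ≈ 0#
  skew {a} {b} {a₄} {b₄} {X} {Y} {x} {y} {z} {w} {ℓ} {m} {H₁} {H₂} isoF isoe isof onF one onf on₄ eℓ em e₁ e₂
    with subtract x X | subtract z X | subtract a a₄ | subtractʳ a (conj X ⊕ conj X) | subtractʳ (conj a) (X ⊕ X)
  ... | u , eu | v , ev | α , eα | g , eg | k , ek = begin
    m ⊗ conj ℓ ⊗ H₁ ⊕ ℓ ⊗ conj m ⊗ H₂ ≈⟨ ⊕cong (⊗cong (⊗cong m≈ (conj-α ℓ≈)) ≈refl) (⊗cong (⊗cong ℓ≈ (conj-α m≈)) ≈refl) ⟩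
    (α ⊗ v) ⊗ (conj α ⊗ conj u) ⊗ H₁ ⊕ (α ⊗ u) ⊗ (conj α ⊗ conj v) ⊗ H₂ ≈⟨ i₁ α (conj α) u (conj u) v (conj v) H₁ H₂ ⟩
    α ⊗ conj α ⊗ (v ⊗ conj u ⊗ H₁ ⊕ u ⊗ conj v ⊗ H₂) ≈⟨ ⊗cong ≈refl (side (iso-at eu ey isoe) (iso-at ev ew isof)
        (form-at-base isoF eu (conj-sum ev) ey (conj-line ew) eg ek e₁) (form-at-base isoF ev (conj-sum eu) ew (conj-line ey) eg ek e₂)) ⟩
    α ⊗ conj α ⊗ 0# ≈⟨ ⊗0 _ ⟩
    0# ∎
    where
    i₁ : ∀ α α' u u' v v' H₁ H₂ → ((α ⊗ v) ⊗ (α' ⊗ u') ⊗ H₁ ⊕ (α ⊗ u) ⊗ (α' ⊗ v') ⊗ H₂) ≈ (α ⊗ α' ⊗ (v ⊗ u' ⊗ H₁ ⊕ u ⊗ v' ⊗ H₂))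
    i₁ = solve 8 (λ α α' u u' v v' H₁ H₂ → ((α :* v) :* (α' :* u') :* H₁ :+ (α :* u) :* (α' :* v') :* H₂) := (α :* α' :* (v :* u' :* H₁ :+ u :* v' :* H₂))) ≈refl
    ey : y ≈ (Y ⊕ a ⊗ u)
    ey = along onF one eu
    ew : w ≈ (Y ⊕ a ⊗ v)
    ew = along onF onf ev
    ℓ≈ : ℓ ≈ (α ⊗ u)
    ℓ≈ = height eα on₄ ey eu eℓ
    m≈ : m ≈ (α ⊗ v)
    m≈ = height eα on₄ ew ev em
    conj-α : ∀ {x u} → x ≈ (α ⊗ u) → conj x ≈ (conj α ⊗ conj u)
    conj-α e = ≈trans (conj-cong e) (conj-* _ _)
    iso-at : ∀ {x y u} → x ≈ (X ⊕ u) → y ≈ (Y ⊕ a ⊗ u) → Isotropic x y → (g ⊗ u ⊕ k ⊗ conj u) ≈ (u ⊗ conj u ⊕ u ⊗ conj u)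
    iso-at eu ey iso = ≈trans (≈sym (form-at-base isoF eu (conj-sum eu) ey (conj-line ey) eg ek (0-sum iso))) (0⊕ _)

  base-form : ∀ {X X' Y Y' z' w' u' c k} → (Y ⊕ Y') ≈ (X ⊗ X' ⊕ X ⊗ X') → z' ≈ (X' ⊕ u') → w' ≈ (Y' ⊕ c ⊗ u') →
    c ≈ (k ⊕ (X ⊕ X)) → (k ⊗ u' ⊕ (X ⊗ z' ⊕ X ⊗ z')) ≈ (Y ⊕ w')
  base-form {X} {X'} {Y} {Y'} {z'} {w'} {u'} {c} {k} iso ez ew ec = begin
    k ⊗ u' ⊕ (X ⊗ z' ⊕ X ⊗ z') ≈⟨ ⊕cong ≈refl (⊕cong (⊗cong ≈refl ez) (⊗cong ≈refl ez)) ⟩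
    k ⊗ u' ⊕ (X ⊗ (X' ⊕ u') ⊕ X ⊗ (X' ⊕ u')) ≈⟨ i₁ k u' X X' ⟩
    (X ⊗ X' ⊕ X ⊗ X') ⊕ (k ⊕ (X ⊕ X)) ⊗ u' ≈⟨ ⊕cong (≈sym iso) (⊗cong (≈sym ec) ≈refl) ⟩
    (Y ⊕ Y') ⊕ c ⊗ u' ≈⟨ i₂ Y Y' (c ⊗ u') ⟩
    Y ⊕ (Y' ⊕ c ⊗ u') ≈⟨ ⊕cong ≈refl (≈sym ew) ⟩
    Y ⊕ w' ∎
    where
    i₁ : ∀ k u' X X' → (k ⊗ u' ⊕ (X ⊗ (X' ⊕ u') ⊕ X ⊗ (X' ⊕ u'))) ≈ ((X ⊗ X' ⊕ X ⊗ X') ⊕ (k ⊕ (X ⊕ X)) ⊗ u')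
    i₁ = solve 4 (λ k u' X X' → (k :* u' :+ (X :* (X' :+ u') :+ X :* (X' :+ u'))) := ((X :* X' :+ X :* X') :+ (k :+ (X :+ X)) :* u')) ≈refl
    i₂ : ∀ Y Y' t → ((Y ⊕ Y') ⊕ t) ≈ (Y ⊕ (Y' ⊕ t))
    i₂ = solve 3 (λ Y Y' t → ((Y :+ Y') :+ t) := (Y :+ (Y' :+ t))) ≈refl

  base-form′ : ∀ {X X' Y Y' z w u a g} → (Y ⊕ Y') ≈ (X ⊗ X' ⊕ X ⊗ X') → z ≈ (X ⊕ u) → w ≈ (Y ⊕ a ⊗ u) →
    a ≈ (g ⊕ (X' ⊕ X')) → (g ⊗ u ⊕ (z ⊗ X' ⊕ z ⊗ X')) ≈ (w ⊕ Y')
  base-form′ {X} {X'} {Y} {Y'} {z} {w} {u} {a} {g} iso ez ew ea =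
    ≈trans (⊕cong ≈refl (⊕cong (⊗comm z X') (⊗comm z X')))
      (≈trans (base-form (≈trans (⊕comm Y' Y) (≈trans iso (⊕cong (⊗comm X X') (⊗comm X X')))) ez ew ea) (⊕comm Y' w))

  conj-0 : conj 0# ≈ 0#
  conj-0 = cancel₀ (≈trans (≈sym (conj-+ 0# 0#)) (conj-cong (0⊕ 0#)))

  conj-≉0 : ∀ {x} → ¬ (x ≈ 0#) → ¬ (conj x ≈ 0#)
  conj-≉0 x≉ e = x≉ (≈trans (≈sym (conj-conj _)) (≈trans (conj-cong e) conj-0))

  ⊗≉0 : ∀ {x y} → ¬ (x ≈ 0#) → ¬ (y ≈ 0#) → ¬ ((x ⊗ y) ≈ 0#)
  ⊗≉0 x≉ y≉ e with domain e
  ... | inj₁ e' = x≉ e'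
  ... | inj₂ e' = y≉ e'

  one-point : ∀ {a b c d x y X Y} → Incident a b X Y → Incident c d X Y → Incident a b x y → Incident c d x y →
    (x ≈ X) ⊎ (a ≈ c)
  one-point {a} {b} {c} {d} {x} {y} {X} {Y} 1F 2F 1e 2e =
    let u , eu = subtract x X
        α , eα = subtract a c
    in Sum.[ (λ z → inj₂ (≈trans eα (≈trans (⊕cong ≈refl z) (⊕0 c)))) , (λ z → inj₁ (≈trans eu (≈trans (⊕cong ≈refl z) (⊕0 X)))) ]′
      (domain {α} {u} (cancel₀ {α ⊗ u} {Y ⊕ c ⊗ u} (begin
        α ⊗ u ⊕ (Y ⊕ c ⊗ u) ≈⟨ i₁ α u Y c ⟩
        Y ⊕ (c ⊕ α) ⊗ u ≈⟨ ⊕cong ≈refl (⊗cong (≈sym eα) ≈refl) ⟩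
        Y ⊕ a ⊗ u ≈⟨ ≈sym (along 1F 1e eu) ⟩
        y ≈⟨ along 2F 2e eu ⟩
        Y ⊕ c ⊗ u ∎)))
    where
    i₁ : ∀ α u Y c → (α ⊗ u ⊕ (Y ⊕ c ⊗ u)) ≈ (Y ⊕ (c ⊕ α) ⊗ u)
    i₁ = solve 4 (λ α u Y c → (α :* u :+ (Y :+ c :* u)) := (Y :+ (c :+ α) :* u)) ≈refl

  same-intercept : ∀ {a b c d x y} → a ≈ c → Incident a b x y → Incident c d x y → b ≈ d
  same-intercept {a} {b} {c} {d} {x} e i j = cancel (a ⊗ x) (≈trans (⊕comm b (a ⊗ x)) (≈trans (≈sym i) (≈trans j
    (≈trans (⊕cong (⊗cong (≈sym e) ≈refl) ≈refl) (⊕comm (a ⊗ x) d)))))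

  same-ordinate : ∀ {a b x y X Y} → x ≈ X → Incident a b x y → Incident a b X Y → y ≈ Y
  same-ordinate e i j = ≈trans i (≈trans (⊕cong (⊗cong ≈refl e) ≈refl) (≈sym j))

  no-onan : ∀ {a₁ b₁ a₂ b₂ a₃ b₃ a₄ b₄ x₁ y₁ x₂ y₂ x₃ y₃ X₁ Y₁ X₂ Y₂ X₃ Y₃} →
    Isotropic x₁ y₁ → Isotropic x₂ y₂ → Isotropic x₃ y₃ → Isotropic X₁ Y₁ → Isotropic X₂ Y₂ → Isotropic X₃ Y₃ →
    Incident a₂ b₂ x₁ y₁ → Incident a₃ b₃ x₁ y₁ → Incident a₁ b₁ x₂ y₂ → Incident a₃ b₃ x₂ y₂ →
    Incident a₁ b₁ x₃ y₃ → Incident a₂ b₂ x₃ y₃ → Incident a₁ b₁ X₁ Y₁ → Incident a₄ b₄ X₁ Y₁ →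
    Incident a₂ b₂ X₂ Y₂ → Incident a₄ b₄ X₂ Y₂ → Incident a₃ b₃ X₃ Y₃ → Incident a₄ b₄ X₃ Y₃ →
    ¬ Incident a₄ b₄ x₁ y₁ → ¬ Incident a₄ b₄ x₂ y₂ → ¬ Incident a₄ b₄ x₃ y₃ →
    ¬ (x₂ ≈ x₁) → ¬ (x₃ ≈ x₁) → ¬ (a₃ ≈ a₂) → ⊥
  no-onan {a₁} {b₁} {a₂} {b₂} {a₃} {b₃} {a₄} {b₄} {x₁} {y₁} {x₂} {y₂} {x₃} {y₃} {X₁} {Y₁} {X₂} {Y₂} {X₃} {Y₃}
    i₁ i₂ i₃ I₁ I₂ I₃ 2e₁ 3e₁ 1e₂ 3e₂ 1e₃ 2e₃ 1f₁ 4f₁ 2f₂ 4f₂ 3f₃ 4f₃ n₁ n₂ n₃ x₂≉x₁ x₃≉x₁ a₃≉a₂ =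
    let u , eu = subtract x₂ x₁
        v , ev = subtract x₃ x₁
        g , eg = subtractʳ a₃ (conj x₁ ⊕ conj x₁)
        k , ek = subtractʳ (conj a₃) (x₁ ⊕ x₁)
        γ , eγ = subtractʳ a₂ (conj x₁ ⊕ conj x₁)
        κ , eκ = subtractʳ (conj a₂) (x₁ ⊕ x₁)
        ℓ₁ , eℓ₁ = subtract y₁ (a₄ ⊗ x₁ ⊕ b₄)
        ℓ₂ , eℓ₂ = subtract y₂ (a₄ ⊗ x₂ ⊕ b₄)
        ℓ₃ , eℓ₃ = subtract y₃ (a₄ ⊗ x₃ ⊕ b₄)
        H₂₃ , e₂₃ = subtractʳ (y₂ ⊕ conj y₃) (x₂ ⊗ conj x₃ ⊕ x₂ ⊗ conj x₃)
        H₃₂ , e₃₂ = subtractʳ (y₃ ⊕ conj y₂) (x₃ ⊗ conj x₂ ⊕ x₃ ⊗ conj x₂)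
    in contradict u eu v ev g eg k ek γ eγ κ eκ ℓ₁ eℓ₁ ℓ₂ eℓ₂ ℓ₃ eℓ₃ H₂₃ e₂₃ H₃₂ e₃₂
    where
    contradict : (u : K) (eu : x₂ ≈ (x₁ ⊕ u)) (v : K) (ev : x₃ ≈ (x₁ ⊕ v)) (g : K) (eg : a₃ ≈ (g ⊕ (conj x₁ ⊕ conj x₁))) (k : K) (ek : conj a₃ ≈ (k ⊕ (x₁ ⊕ x₁))) (γ : K) (eγ : a₂ ≈ (γ ⊕ (conj x₁ ⊕ conj x₁))) (κ : K) (eκ : conj a₂ ≈ (κ ⊕ (x₁ ⊕ x₁))) (ℓ₁ : K) (eℓ₁ : y₁ ≈ (a₄ ⊗ x₁ ⊕ b₄ ⊕ ℓ₁)) (ℓ₂ : K) (eℓ₂ : y₂ ≈ (a₄ ⊗ x₂ ⊕ b₄ ⊕ ℓ₂)) (ℓ₃ : K) (eℓ₃ : y₃ ≈ (a₄ ⊗ x₃ ⊕ b₄ ⊕ ℓ₃)) (H₂₃ : K) (e₂₃ : (y₂ ⊕ conj y₃) ≈ (H₂₃ ⊕ (x₂ ⊗ conj x₃ ⊕ x₂ ⊗ conj x₃))) (H₃₂ : K) (e₃₂ : (y₃ ⊕ conj y₂) ≈ (H₃₂ ⊕ (x₃ ⊗ conj x₂ ⊕ x₃ ⊗ conj x₂))) → ⊥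
    contradict u eu v ev g eg k ek γ eγ κ eκ ℓ₁ eℓ₁ ℓ₂ eℓ₂ ℓ₃ eℓ₃ H₂₃ e₂₃ H₃₂ e₃₂ =
      finish (gram (shift≉ eu x₂≉x₁) (conj-≉0 (shift≉ eu x₂≉x₁)) (shift≉ ev x₃≉x₁) (conj-≉0 (shift≉ ev x₃≉x₁))
        (≈trans (≈sym (form-at-base i₁ eu (conj-sum eu) ey₂ (conj-line ey₂) eg ek (0-sum i₂))) (0⊕ _))
        (≈trans (≈sym (form-at-base i₁ ev (conj-sum ev) ey₃ (conj-line ey₃) eγ eκ (0-sum i₃))) (0⊕ _))
        (form-at-base i₁ eu (conj-sum ev) ey₂ (conj-line ey₃) eg eκ (≈sym e₂₃))
        (form-at-base i₁ ev (conj-sum eu) ey₃ (conj-line ey₂) eγ ek (≈sym e₃₂))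
        gram0)
      where
        ey₂ : y₂ ≈ (y₁ ⊕ a₃ ⊗ u)
        ey₂ = along 3e₁ 3e₂ eu
        ey₃ : y₃ ≈ (y₁ ⊕ a₂ ⊗ v)
        ey₃ = along 2e₁ 2e₃ ev
        shift≉ : ∀ {x X u} → x ≈ (X ⊕ u) → ¬ (x ≈ X) → ¬ (u ≈ 0#)
        shift≉ e x≉ u0 = x≉ (≈trans e (≈trans (⊕cong ≈refl u0) (⊕0 _)))
        finish : (g ≈ γ) ⊎ (k ≈ κ) → ⊥
        finish (inj₁ e) = a₃≉a₂ (≈trans eg (≈trans (⊕cong e ≈refl) (≈sym eγ)))
        finish (inj₂ e) = a₃≉a₂ (≈trans (≈sym (conj-conj a₃)) (≈trans (conj-cong (≈trans ek (≈trans (⊕cong e ≈refl) (≈sym eκ)))) (conj-conj a₂)))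
        ℓ≉ : ∀ {x y ℓ} → y ≈ (a₄ ⊗ x ⊕ b₄ ⊕ ℓ) → ¬ Incident a₄ b₄ x y → ¬ (ℓ ≈ 0#)
        ℓ≉ e n ℓ0 = n (≈trans e (≈trans (⊕cong ≈refl ℓ0) (⊕0 _)))
        N = ℓ₁ ⊗ conj ℓ₁ ⊗ (ℓ₂ ⊗ conj ℓ₂) ⊗ (ℓ₃ ⊗ conj ℓ₃)
        norm≉ : ∀ {ℓ} → ¬ (ℓ ≈ 0#) → ¬ ((ℓ ⊗ conj ℓ) ≈ 0#)
        norm≉ h = ⊗≉0 h (conj-≉0 h)
        N≉ : ¬ (N ≈ 0#)
        N≉ = ⊗≉0 (⊗≉0 (norm≉ (ℓ≉ eℓ₁ n₁)) (norm≉ (ℓ≉ eℓ₂ n₂))) (norm≉ (ℓ≉ eℓ₃ n₃))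
        j : ∀ a b c p q r → ((a ⊗ q) ⊗ (b ⊗ r) ⊗ (c ⊗ p)) ≈ (a ⊗ b ⊗ c ⊗ (p ⊗ q ⊗ r))
        j = solve 6 (λ a b c p q r → ((a :* q) :* (b :* r) :* (c :* p)) := (a :* b :* c :* (p :* q :* r))) ≈refl
        N₁ : ∀ l₁ m₁ l₂ m₂ l₃ m₃ → ((l₃ ⊗ m₂) ⊗ (l₁ ⊗ m₃) ⊗ (l₂ ⊗ m₁)) ≈ (l₁ ⊗ m₁ ⊗ (l₂ ⊗ m₂) ⊗ (l₃ ⊗ m₃))
        N₁ = solve 6 (λ l₁ m₁ l₂ m₂ l₃ m₃ → ((l₃ :* m₂) :* (l₁ :* m₃) :* (l₂ :* m₁)) := (l₁ :* m₁ :* (l₂ :* m₂) :* (l₃ :* m₃))) ≈refl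
        N₂ : ∀ l₁ m₁ l₂ m₂ l₃ m₃ → ((l₂ ⊗ m₃) ⊗ (l₃ ⊗ m₁) ⊗ (l₁ ⊗ m₂)) ≈ (l₁ ⊗ m₁ ⊗ (l₂ ⊗ m₂) ⊗ (l₃ ⊗ m₃))
        N₂ = solve 6 (λ l₁ m₁ l₂ m₂ l₃ m₃ → ((l₂ :* m₃) :* (l₃ :* m₁) :* (l₁ :* m₂)) := (l₁ :* m₁ :* (l₂ :* m₂) :* (l₃ :* m₃))) ≈refl
        factor : ∀ {p q r p' q' r'} → ((ℓ₃ ⊗ conj ℓ₂ ⊗ q) ⊗ (ℓ₁ ⊗ conj ℓ₃ ⊗ r) ⊗ (ℓ₂ ⊗ conj ℓ₁ ⊗ p) ⊕
            (ℓ₂ ⊗ conj ℓ₃ ⊗ q') ⊗ (ℓ₃ ⊗ conj ℓ₁ ⊗ r') ⊗ (ℓ₁ ⊗ conj ℓ₂ ⊗ p')) ≈ (N ⊗ (p ⊗ q ⊗ r ⊕ p' ⊗ q' ⊗ r'))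
        factor {p} {q} {r} {p'} {q'} {r'} = ≈trans (⊕cong
            (≈trans (j (ℓ₃ ⊗ conj ℓ₂) (ℓ₁ ⊗ conj ℓ₃) (ℓ₂ ⊗ conj ℓ₁) p q r) (⊗cong (N₁ ℓ₁ (conj ℓ₁) ℓ₂ (conj ℓ₂) ℓ₃ (conj ℓ₃)) ≈refl))
            (≈trans (j (ℓ₂ ⊗ conj ℓ₃) (ℓ₃ ⊗ conj ℓ₁) (ℓ₁ ⊗ conj ℓ₂) p' q' r') (⊗cong (N₂ ℓ₁ (conj ℓ₁) ℓ₂ (conj ℓ₂) ℓ₃ (conj ℓ₃)) ≈refl)))
          (≈sym (distribˡ N (p ⊗ q ⊗ r) (p' ⊗ q' ⊗ r')))
        skew₁ : (ℓ₃ ⊗ conj ℓ₂ ⊗ H₂₃ ⊕ ℓ₂ ⊗ conj ℓ₃ ⊗ H₃₂) ≈ 0#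
        skew₁ = skew {a₁} {b₁} {a₄} {b₄} {X₁} {Y₁} {x₂} {y₂} {x₃} {y₃} {ℓ₂} {ℓ₃} {H₂₃} {H₃₂} I₁ i₂ i₃ 1f₁ 1e₂ 1e₃ 4f₁ eℓ₂ eℓ₃ (≈sym e₂₃) (≈sym e₃₂)
        skew₂ : (ℓ₁ ⊗ conj ℓ₃ ⊗ (γ ⊗ v) ⊕ ℓ₃ ⊗ conj ℓ₁ ⊗ (κ ⊗ conj v)) ≈ 0#
        skew₂ = skew {a₂} {b₂} {a₄} {b₄} {X₂} {Y₂} {x₃} {y₃} {x₁} {y₁} {ℓ₃} {ℓ₁} {γ ⊗ v} {κ ⊗ conj v} I₂ i₃ i₁ 2f₂ 2e₃ 2e₁ 4f₂ eℓ₃ eℓ₁ (base-form′ {x₁} {conj x₁} {y₁} {conj y₁} {x₃} {y₃} {v} {a₂} {γ} i₁ ev ey₃ eγ) (base-form {x₁} {conj x₁} {y₁} {conj y₁} {conj x₃} {conj y₃} {conj v} {conj a₂} {κ} i₁ (conj-sum ev) (conj-line ey₃) eκ)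
        skew₃ : (ℓ₂ ⊗ conj ℓ₁ ⊗ (k ⊗ conj u) ⊕ ℓ₁ ⊗ conj ℓ₂ ⊗ (g ⊗ u)) ≈ 0#
        skew₃ = skew {a₃} {b₃} {a₄} {b₄} {X₃} {Y₃} {x₁} {y₁} {x₂} {y₂} {ℓ₁} {ℓ₂} {k ⊗ conj u} {g ⊗ u} I₃ i₁ i₂ 3f₃ 3e₁ 3e₂ 4f₃ eℓ₁ eℓ₂ (base-form {x₁} {conj x₁} {y₁} {conj y₁} {conj x₂} {conj y₂} {conj u} {conj a₃} {k} i₁ (conj-sum eu) (conj-line ey₂) ek) (base-form′ {x₁} {conj x₁} {y₁} {conj y₁} {x₂} {y₂} {u} {a₃} {g} i₁ eu ey₂ eg)
        gram0 : ((k ⊗ conj u) ⊗ H₂₃ ⊗ (γ ⊗ v) ⊕ (g ⊗ u) ⊗ H₃₂ ⊗ (κ ⊗ conj v)) ≈ 0#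
        gram0 = Sum.[ (λ e → ⊥-elim (N≉ e)) , id ]′ (domain {N} (≈trans (≈sym (factor {k ⊗ conj u} {H₂₃} {γ ⊗ v} {g ⊗ u} {H₃₂} {κ ⊗ conj v})) (triple skew₁ skew₂ skew₃)))

module Modular (p : ℕ) (prime : Prime p) where
  open import Data.Integer using (+_)

  instance
    p≢0 : NonZero p
    p≢0 = prime⇒nonZero prime

  P∣_ : ℤ → Set
  P∣ x = + p ∣ᶻ x

  comb : ∀ {x y} u v {t} → P∣ x → P∣ y → t ≡ u *ᶻ x +ᶻ v *ᶻ y → P∣ t
  comb u v dx dy refl = ∣m∣n⇒∣m+n (∣n⇒∣m*n u dx) (∣n⇒∣m*n v dy)

  P∣0 : P∣ 0ℤ
  P∣0 = divides 0ℤ refl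

  euclid : ∀ x y → P∣ (x *ᶻ y) → P∣ x ⊎ P∣ y
  euclid x y d with euclidsLemma (absᶻ x) (absᶻ y) prime (subst (p ℕD.∣_) (ℤP.abs-* x y) (∣⇒∣ᵤ d))
  ... | inj₁ q = inj₁ (∣ᵤ⇒∣ q)
  ... | inj₂ q = inj₂ (∣ᵤ⇒∣ q)

  ⟦_⟧ : Fin p → ℤ
  ⟦ i ⟧ = + toℕ i

  ⟦⟧-inj-≤ : ∀ (i j : Fin p) → toℕ j ≤ toℕ i → p ℕD.∣ absᶻ (⟦ i ⟧ -ᶻ ⟦ j ⟧) → i ≡ j
  ⟦⟧-inj-≤ i j j≤i d = FinP.toℕ-injective (≤-antisym (m∸n≡0⇒m≤n (gap (toℕ i ∸ toℕ j) refl)) j≤i)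
    where
    e : absᶻ (⟦ i ⟧ -ᶻ ⟦ j ⟧) ≡ toℕ i ∸ toℕ j
    e = cong absᶻ (trans (ℤP.m-n≡m⊖n (toℕ i) (toℕ j)) (ℤP.⊖-≥ j≤i))
    gap : ∀ k → k ≡ toℕ i ∸ toℕ j → toℕ i ∸ toℕ j ≡ 0
    gap zero eq = sym eq
    gap (suc k) eq = ⊥-elim (<⇒≱ (≤-<-trans (m∸n≤m (toℕ i) (toℕ j)) (FinP.toℕ<n i))
      (ℕD.∣⇒≤ {{>-nonZero (subst (0 <_) eq (s≤s z≤n))}} (subst (p ℕD.∣_) e d)))

  ⟦⟧-inj : ∀ i j → P∣ (⟦ i ⟧ -ᶻ ⟦ j ⟧) → i ≡ j
  ⟦⟧-inj i j d with ≤-total (toℕ j) (toℕ i)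
  ... | inj₁ j≤i = ⟦⟧-inj-≤ i j j≤i (∣⇒∣ᵤ d)
  ... | inj₂ i≤j = sym (⟦⟧-inj-≤ j i i≤j (subst (p ℕD.∣_) (ℤP.∣i-j∣≡∣j-i∣ ⟦ i ⟧ ⟦ j ⟧) (∣⇒∣ᵤ d)))

  residue : ∀ c → ∃ λ (x : Fin p) → P∣ (c -ᶻ ⟦ x ⟧)
  residue c = fromℕ< (n%ℕd<d c p) , divides (c /ℕ p) (trans (cong (λ m → c -ᶻ + m) (FinP.toℕ-fromℕ< (n%ℕd<d c p)))
    (trans (cong (_-ᶻ + (c %ℕ p)) (a≡a%ℕn+[a/ℕn]*n c p)) (lem (+ (c %ℕ p)) (c /ℕ p *ᶻ + p))))
    where
    lem : ∀ a b → a +ᶻ b -ᶻ a ≡ b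
    lem = solveᶻ

  inverse : ∀ b → ¬ (P∣ b) → ∃ λ b' → P∣ (b *ᶻ b' -ᶻ 1ℤ)
  inverse b p∤b with residue b
  ... | x , dx with coprime-Bézout (prime⇒coprime prime {{>-nonZero (n≢0⇒n>0 x≢0)}} (FinP.toℕ<n x))
    where
    x≢0 : toℕ x ≢ 0
    x≢0 e = p∤b (subst P∣_ (trans (cong (λ m → b -ᶻ + m) e) (ℤP.+-identityʳ b)) dx)
  ... | Bézout.+- u y eq = -ᶻ (+ y) , comb (-ᶻ (+ y)) (-ᶻ (+ u)) dx (divides 1ℤ (sym (ℤP.*-identityˡ (+ p))))
          (trans (lem b ⟦ x ⟧ (+ y)) (cong (λ t → (-ᶻ (+ y)) *ᶻ (b -ᶻ ⟦ x ⟧) +ᶻ -ᶻ t) (trans (cong (1ℤ +ᶻ_) (sym (ℤP.pos-* y (toℕ x)))) (trans (cong +_ eq) (ℤP.pos-* u p))) ⊡ lem₂ b ⟦ x ⟧ (+ y) (+ u) (+ p)))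
    where
    infixl 1 _⊡_
    _⊡_ : ∀ {a b c : ℤ} → a ≡ b → b ≡ c → a ≡ c
    _⊡_ = trans
    lem : ∀ b x y → b *ᶻ (-ᶻ y) -ᶻ 1ℤ ≡ (-ᶻ y) *ᶻ (b -ᶻ x) +ᶻ -ᶻ (1ℤ +ᶻ y *ᶻ x)
    lem = solveᶻ
    lem₂ : ∀ b x y u q → (-ᶻ y) *ᶻ (b -ᶻ x) +ᶻ -ᶻ (u *ᶻ q) ≡ (-ᶻ y) *ᶻ (b -ᶻ x) +ᶻ (-ᶻ u) *ᶻ q
    lem₂ = solveᶻ
  ... | Bézout.-+ u y eq = + y , comb (+ y) (+ u) dx (divides 1ℤ (sym (ℤP.*-identityˡ (+ p))))
          (trans (lem b ⟦ x ⟧ (+ y)) (cong (λ t → (+ y) *ᶻ (b -ᶻ ⟦ x ⟧) +ᶻ (t -ᶻ 1ℤ)) (trans (sym (ℤP.pos-* y (toℕ x))) (trans (cong +_ (sym eq)) (cong (1ℤ +ᶻ_) (ℤP.pos-* u p)))) ⊡ lem₂ b ⟦ x ⟧ (+ y) (+ u) (+ p)))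
    where
    infixl 1 _⊡_
    _⊡_ : ∀ {a b c : ℤ} → a ≡ b → b ≡ c → a ≡ c
    _⊡_ = trans
    lem : ∀ b x y → b *ᶻ y -ᶻ 1ℤ ≡ y *ᶻ (b -ᶻ x) +ᶻ (y *ᶻ x -ᶻ 1ℤ)
    lem = solveᶻ
    lem₂ : ∀ b x y u q → y *ᶻ (b -ᶻ x) +ᶻ (1ℤ +ᶻ u *ᶻ q -ᶻ 1ℤ) ≡ y *ᶻ (b -ᶻ x) +ᶻ u *ᶻ q
    lem₂ = solveᶻ

  Square? : ∀ (d : Fin p) → Dec (∃ λ (x : Fin p) → P∣ (⟦ x ⟧ *ᶻ ⟦ x ⟧ -ᶻ ⟦ d ⟧))
  Square? d = FinP.any? λ x → + p ∣? (⟦ x ⟧ *ᶻ ⟦ x ⟧ -ᶻ ⟦ d ⟧)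

  -- 1 and -1 have the same square, so squaring is not surjective.
  nonsquare : ∃ (λ k → p ≡ 3 + k) → ∃ λ (d : Fin p) → ¬ (∃ λ (x : Fin p) → P∣ (⟦ x ⟧ *ᶻ ⟦ x ⟧ -ᶻ ⟦ d ⟧))
  nonsquare (k , p≡) with FinP.all? Square?
  ... | no ¬all = FinP.¬∀⟶∃¬ p _ Square? ¬all
  ... | yes all = ⊥-elim (clash FinP.pigeonhole)
    where
    one -one : Fin p
    one = subst Fin (sym p≡) (suc zero)
    -one = subst Fin (sym p≡) (Fin.fromℕ (2 + k))
    toℕ-subst : ∀ {m n} (e : m ≡ n) (i : Fin m) → toℕ (subst Fin e i) ≡ toℕ i
    toℕ-subst refl i = refl
    root : Fin p → Fin p
    root d = proj₁ (all d)
    missed : ∃ λ (c : Fin p) → P∣ (⟦ c ⟧ *ᶻ ⟦ c ⟧ -ᶻ 1ℤ) × c ≢ root one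
    missed with root one Fin.≟ one
    ... | no ne = one , subst (λ m → P∣ (+ m *ᶻ + m -ᶻ 1ℤ)) (sym (toℕ-subst (sym p≡) (suc zero))) P∣0 , λ e → ne (sym e)
    ... | yes e = -one , subst (λ m → P∣ (+ m *ᶻ + m -ᶻ 1ℤ)) (sym (trans (toℕ-subst (sym p≡) (Fin.fromℕ (2 + k))) (FinP.toℕ-fromℕ (2 + k))))
          (divides (+ (1 + k)) (trans (lem (+ k)) (cong (λ q → (+ (1 + k)) *ᶻ + q) (sym p≡)))) ,
          λ e' → contradiction (trans (sym (trans (toℕ-subst (sym p≡) (Fin.fromℕ (2 + k))) (FinP.toℕ-fromℕ (2 + k)))) (trans (cong toℕ (trans e' e)) (toℕ-subst (sym p≡) (suc zero)))) λ ()
      where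
      lem : ∀ k → (+ 2 +ᶻ k) *ᶻ (+ 2 +ᶻ k) -ᶻ 1ℤ ≡ (1ℤ +ᶻ k) *ᶻ (+ 3 +ᶻ k)
      lem = solveᶻ
    c = proj₁ missed
    one≡ : ⟦ one ⟧ ≡ 1ℤ
    one≡ = cong +_ (toℕ-subst (sym p≡) (suc zero))
    square-inj : ∀ d d' → root d ≡ root d' → d ≡ d'
    square-inj d d' e = ⟦⟧-inj d d' (comb (-ᶻ 1ℤ) 1ℤ (proj₂ (all d)) (subst (λ x → P∣ (⟦ x ⟧ *ᶻ ⟦ x ⟧ -ᶻ ⟦ d' ⟧)) (sym e) (proj₂ (all d')))
      (lem (⟦ root d ⟧ *ᶻ ⟦ root d ⟧) ⟦ d ⟧ ⟦ d' ⟧))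
      where
      lem : ∀ s d d' → d -ᶻ d' ≡ (-ᶻ 1ℤ) *ᶻ (s -ᶻ d) +ᶻ 1ℤ *ᶻ (s -ᶻ d')
      lem = solveᶻ
    c≢root : ∀ d → c ≢ root d
    c≢root d e = proj₂ (proj₂ missed) (trans e (cong root (⟦⟧-inj d one (subst (λ o → P∣ (⟦ d ⟧ -ᶻ o)) (sym one≡)
      (comb (-ᶻ 1ℤ) 1ℤ (proj₂ (all d)) (subst (λ x → P∣ (⟦ x ⟧ *ᶻ ⟦ x ⟧ -ᶻ 1ℤ)) e (proj₁ (proj₂ missed)))
        (lem (⟦ root d ⟧ *ᶻ ⟦ root d ⟧) ⟦ d ⟧))))))
      where
      lem : ∀ s d → d -ᶻ 1ℤ ≡ (-ᶻ 1ℤ) *ᶻ (s -ᶻ d) +ᶻ 1ℤ *ᶻ (s -ᶻ 1ℤ)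
      lem = solveᶻ
    p≡suc : p ≡ suc (2 + k)
    p≡suc = p≡
    clash : (∀ {m n} → m < n → (f : Fin n → Fin m) → ∃ λ i → ∃ λ j → i Fin.< j × f i ≡ f j) → ⊥
    clash pigeon = go p≡suc c c≢root
      where
      go : ∀ {q} → p ≡ suc q → (c : Fin p) → (∀ d → c ≢ root d) → ⊥
      go {q} refl c c≢ with pigeon (n<1+n q) (λ d → Fin.punchOut (c≢ d))
      ... | i , j , i<j , e = FinP.<⇒≢ i<j (square-inj i j (FinP.punchOut-injective (c≢ i) (c≢ j) e))

  anisotropic : ∀ δ → ¬ (∃ λ (x : Fin p) → P∣ (⟦ x ⟧ *ᶻ ⟦ x ⟧ -ᶻ δ)) →
    ∀ a b → P∣ (a *ᶻ a -ᶻ δ *ᶻ (b *ᶻ b)) → P∣ a × P∣ b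
  anisotropic δ ns a b d = Sum.[ id , id ]′ (euclid a a a²) , p∣b
    where
    lem : ∀ a b b' δ x → x *ᶻ x -ᶻ δ ≡ (-ᶻ (x +ᶻ a *ᶻ b')) *ᶻ (a *ᶻ b' -ᶻ x) +ᶻ
      1ℤ *ᶻ (b' *ᶻ b' *ᶻ (a *ᶻ a -ᶻ δ *ᶻ (b *ᶻ b)) +ᶻ δ *ᶻ (b *ᶻ b' +ᶻ 1ℤ) *ᶻ (b *ᶻ b' -ᶻ 1ℤ))
    lem = solveᶻ
    p∣b : P∣ b
    p∣b = decidable-stable (+ p ∣? b) λ p∤b →
      let b' , db = inverse b p∤b
          x , dx = residue (a *ᶻ b')
      in ns (x , comb (-ᶻ (⟦ x ⟧ +ᶻ a *ᶻ b')) 1ℤ dx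
          (comb
            (b' *ᶻ b') (δ *ᶻ (b *ᶻ b' +ᶻ 1ℤ)) d db refl) (lem a b b' δ ⟦ x ⟧))
    lem₂ : ∀ a b δ → a *ᶻ a ≡ 1ℤ *ᶻ (a *ᶻ a -ᶻ δ *ᶻ (b *ᶻ b)) +ᶻ δ *ᶻ b *ᶻ b
    lem₂ = solveᶻ
    a² : P∣ (a *ᶻ a)
    a² = comb 1ℤ (δ *ᶻ b) d p∣b (lem₂ a b δ)

∑-↑ : ∀ m n (f : Fin (m + n) → ℕ) →
  ∑ (allFin (m + n)) f ≡ ∑ (allFin m) (λ i → f (i Fin.↑ˡ n)) + ∑ (allFin n) (λ j → f (m Fin.↑ʳ j))
∑-↑ zero n f = refl
∑-↑ (suc m) n f = trans (∑-allFin-suc (m + n) f) (trans (cong (f zero +_) (∑-↑ m n (f ∘ suc)))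
  (trans (sym (+-assoc (f zero) _ _)) (cong (_+ ∑ (allFin n) (λ j → f (suc m Fin.↑ʳ j))) (sym (∑-allFin-suc m (λ i → f (i Fin.↑ˡ n)))))))

∑-combine : ∀ m n (f : Fin (m * n) → ℕ) →
  ∑ (allFin (m * n)) f ≡ ∑ (allFin m) (λ i → ∑ (allFin n) (λ j → f (Fin.combine i j)))
∑-combine zero n f = refl
∑-combine (suc m) n f = trans (∑-↑ n (m * n) f) (trans (cong (∑ (allFin n) (λ j → f (j Fin.↑ˡ (m * n))) +_) (∑-combine m n (λ k → f (n Fin.↑ʳ k))))
  (sym (∑-allFin-suc m (λ i → ∑ (allFin n) (λ j → f (Fin.combine i j))))))

∑-remQuot : ∀ m n (f : Fin m × Fin n → ℕ) →
  ∑ (allFin (m * n)) (f ∘ Fin.remQuot n) ≡ ∑ (allFin m) (λ i → ∑ (allFin n) (λ j → f (i , j)))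
∑-remQuot m n f = trans (∑-combine m n (f ∘ Fin.remQuot n))
  (∑-cong (allFin m) λ i → ∑-cong (allFin n) λ j → cong f (FinP.remQuot-combine i j))

remQuot-inj : ∀ {m} n (i j : Fin (m * n)) → proj₁ (Fin.remQuot {m} n i) ≡ proj₁ (Fin.remQuot {m} n j) →
  proj₂ (Fin.remQuot {m} n i) ≡ proj₂ (Fin.remQuot {m} n j) → i ≡ j
remQuot-inj {m} n i j p q = trans (sym (FinP.combine-remQuot {m} n i)) (trans (cong₂ Fin.combine p q) (FinP.combine-remQuot {m} n j))

#≤1 : ∀ n (q : Fin n → Bool) → (∀ i j → q i ≡ true → q j ≡ true → i ≡ j) → # (allFin n) q ≤ 1
#≤1 zero q u = z≤n
#≤1 (suc n) q u with bool-cases (q zero)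
... | inj₂ f = ≤-trans (≤-reflexive (trans (∑-allFin-suc n (𝟙 ∘ q)) (cong (λ b → 𝟙 b + # (allFin n) (q ∘ suc)) f)))
      (#≤1 n (q ∘ suc) λ i j a b → FinP.suc-injective (u (suc i) (suc j) a b))
... | inj₁ t = ≤-reflexive (trans (∑-allFin-suc n (𝟙 ∘ q)) (cong₂ _+_ (cong 𝟙 t) (∑-zero (allFin n) λ i → cong 𝟙 (¬true⇒false λ e → contradiction (u zero (suc i) t e) λ ()))))

#≤2 : ∀ n (q : Fin n → Bool) →
  (∀ i j k → q i ≡ true → q j ≡ true → q k ≡ true → i ≡ j ⊎ i ≡ k ⊎ j ≡ k) → # (allFin n) q ≤ 2
#≤2 zero q u = z≤n
#≤2 (suc n) q u with bool-cases (q zero)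
... | inj₂ f = ≤-trans (≤-reflexive (trans (∑-allFin-suc n (𝟙 ∘ q)) (cong (λ b → 𝟙 b + # (allFin n) (q ∘ suc)) f)))
      (#≤2 n (q ∘ suc) λ i j k a b c → lower (u (suc i) (suc j) (suc k) a b c))
  where
  lower : ∀ {i j k : Fin n} → suc i ≡ suc j ⊎ suc i ≡ suc k ⊎ suc j ≡ suc k → i ≡ j ⊎ i ≡ k ⊎ j ≡ k
  lower (inj₁ e) = inj₁ (FinP.suc-injective e)
  lower (inj₂ (inj₁ e)) = inj₂ (inj₁ (FinP.suc-injective e))
  lower (inj₂ (inj₂ e)) = inj₂ (inj₂ (FinP.suc-injective e))
... | inj₁ t = ≤-trans (≤-reflexive (∑-allFin-suc n (𝟙 ∘ q))) (+-mono-≤ (𝟙≤1 (q zero)) (#≤1 n (q ∘ suc) λ i j a b → rest (u zero (suc i) (suc j) t a b)))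
  where
  rest : ∀ {i j : Fin n} → zero ≡ suc i ⊎ zero ≡ suc j ⊎ suc i ≡ suc j → i ≡ j
  rest (inj₂ (inj₂ e)) = FinP.suc-injective e

enumerate : ∀ n (q : Fin n → Bool) → ∃ λ (f : Fin (# (allFin n) q) → Fin n) →
  (∀ i → q (f i) ≡ true) × (∀ i j → f i ≡ f j → i ≡ j)
enumerate zero q = (λ ()) , (λ ()) , λ ()
enumerate (suc n) q with enumerate n (q ∘ suc) | bool-cases (q zero)
... | f , good , inj | inj₂ e = subst (λ k → ∃ λ (f : Fin k → Fin (suc n)) → (∀ i → q (f i) ≡ true) × (∀ i j → f i ≡ f j → i ≡ j))
    (sym (trans (∑-allFin-suc n (𝟙 ∘ q)) (cong (λ b → 𝟙 b + # (allFin n) (q ∘ suc)) e)))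
    (suc ∘ f , good , λ i j e → inj i j (FinP.suc-injective e))
... | f , good , inj | inj₁ e = subst (λ k → ∃ λ (f : Fin k → Fin (suc n)) → (∀ i → q (f i) ≡ true) × (∀ i j → f i ≡ f j → i ≡ j))
    (sym (trans (∑-allFin-suc n (𝟙 ∘ q)) (cong (λ b → 𝟙 b + # (allFin n) (q ∘ suc)) e)))
    (g , good′ , inj′)
  where
  g : Fin (suc (# (allFin n) (q ∘ suc))) → Fin (suc n)
  g zero = zero
  g (suc i) = suc (f i)
  good′ : ∀ i → q (g i) ≡ true
  good′ zero = e
  good′ (suc i) = good i
  inj′ : ∀ i j → g i ≡ g j → i ≡ j
  inj′ zero zero _ = refl
  inj′ (suc i) (suc j) e = cong suc (inj i j (FinP.suc-injective e))

∑-∧-bound : ∀ n (g : Fin n → Fin n → Bool) (h : Fin n → Fin n → Fin n → Bool) →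
  (∀ x y → # (allFin n) (h x y) ≤ 1) → (∀ y → # (allFin n) (λ x → g x y) ≤ 2) →
  ∑ (allFin n) (λ x → ∑ (allFin n) (λ y → ∑ (allFin n) (λ t → 𝟙 (g x y ∧ h x y t)))) ≤ 2 * n
∑-∧-bound n g h h≤1 g≤2 = begin
    ∑ F (λ x → ∑ F (λ y → ∑ F (λ t → 𝟙 (g x y ∧ h x y t))))
      ≤⟨ ∑-mono F (λ x → ∑-mono F λ y → ≤-trans (≤-reflexive (trans (∑-cong F λ t → 𝟙-∧ (g x y) (h x y t)) (∑-*ˡ F (𝟙 (g x y)) (λ t → 𝟙 (h x y t)))))
           (≤-trans (*-monoʳ-≤ (𝟙 (g x y)) (h≤1 x y)) (≤-reflexive (*-identityʳ (𝟙 (g x y)))))) ⟩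
    ∑ F (λ x → ∑ F (λ y → 𝟙 (g x y))) ≡⟨ ∑-swap F F (λ x y → 𝟙 (g x y)) ⟩
    ∑ F (λ y → ∑ F (λ x → 𝟙 (g x y))) ≤⟨ ∑-mono F g≤2 ⟩
    ∑ F (λ y → 2) ≡⟨ trans (∑-const F 2) (trans (cong (_* 2) (length-allFin n)) (*-comm n 2)) ⟩
    2 * n ∎
  where
  open ≤-Reasoning
  F = allFin n

record Geometry (p : ℕ) : Set where
  field
    lines : ℕ
    inc : Fin lines → Fin (p * (p * p)) → Bool
    many : p ^ 4 ≤ 4 * lines
    few : lines ≤ p ^ 4
    long : ∀ ℓ → p ≤ 2 * # (allFin (p * (p * p))) (inc ℓ)
    short : ∀ ℓ → # (allFin (p * (p * p))) (inc ℓ) ≤ 2 * p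
    meet : ∀ ℓ m P Q → ℓ ≢ m → inc ℓ P ≡ true → inc m P ≡ true → inc ℓ Q ≡ true → inc m Q ≡ true → P ≡ Q
    onan : ∀ ℓ₁ ℓ₂ ℓ₃ ℓ₄ P₁₂ P₁₃ P₁₄ P₂₃ P₂₄ P₃₄ → ℓ₁ ≢ ℓ₂ → ℓ₃ ≢ ℓ₄ →
      inc ℓ₁ P₁₂ ≡ true → inc ℓ₂ P₁₂ ≡ true → inc ℓ₁ P₁₃ ≡ true → inc ℓ₃ P₁₃ ≡ true →
      inc ℓ₁ P₁₄ ≡ true → inc ℓ₄ P₁₄ ≡ true → inc ℓ₂ P₂₃ ≡ true → inc ℓ₃ P₂₃ ≡ true →
      inc ℓ₂ P₂₄ ≡ true → inc ℓ₄ P₂₄ ≡ true → inc ℓ₃ P₃₄ ≡ true → inc ℓ₄ P₃₄ ≡ true →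
      inc ℓ₃ P₁₂ ≡ false → inc ℓ₄ P₁₂ ≡ false → inc ℓ₁ P₃₄ ≡ false → inc ℓ₂ P₃₄ ≡ false → ⊥

module Plane (p : ℕ) (prime : Prime p) (p>2 : 2 < p) (δ : ℤ)
  (definite : ∀ a b → Modular.P∣_ p prime (a *ᶻ a -ᶻ δ *ᶻ (b *ᶻ b)) → Modular.P∣_ p prime a × Modular.P∣_ p prime b) where
  open Modular p prime
  open import Data.Integer using (+_)

  K : Set
  K = ℤ × ℤ

  infixl 6 _⊕_
  infixl 7 _⊗_
  _⊕_ _⊗_ : K → K → K
  (a , b) ⊕ (c , e) = a +ᶻ c , b +ᶻ e
  (a , b) ⊗ (c , e) = a *ᶻ c +ᶻ δ *ᶻ (b *ᶻ e) , a *ᶻ e +ᶻ b *ᶻ c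

  conj neg : K → K
  conj (a , b) = a , -ᶻ b
  neg (a , b) = -ᶻ a , -ᶻ b

  𝟎 𝟏 : K
  𝟎 = 0ℤ , 0ℤ
  𝟏 = 1ℤ , 0ℤ

  infix 4 _≈_
  record _≈_ (x y : K) : Set where
    constructor _&_
    field
      re : P∣ (proj₁ x -ᶻ proj₁ y)
      im : P∣ (proj₂ x -ᶻ proj₂ y)
  open _≈_

  exact : ∀ {a b : ℤ} → a ≡ b → P∣ (a -ᶻ b)
  exact {a} refl = subst P∣_ (sym (ℤP.+-inverseʳ a)) P∣0

  ≡⇒≈ : ∀ {a b c e : ℤ} → a ≡ c → b ≡ e → (a , b) ≈ (c , e)
  ≡⇒≈ p q = exact p & exact q

  P∣sym : ∀ a b → P∣ (a -ᶻ b) → P∣ (b -ᶻ a)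
  P∣sym a b d = comb (-ᶻ 1ℤ) 0ℤ d P∣0 (lem a b)
    where
    lem : ∀ a b → b -ᶻ a ≡ (-ᶻ 1ℤ) *ᶻ (a -ᶻ b) +ᶻ 0ℤ *ᶻ 0ℤ
    lem = solveᶻ

  P∣trans : ∀ a b c → P∣ (a -ᶻ b) → P∣ (b -ᶻ c) → P∣ (a -ᶻ c)
  P∣trans a b c d e = comb 1ℤ 1ℤ d e (lem a b c)
    where
    lem : ∀ a b c → a -ᶻ c ≡ 1ℤ *ᶻ (a -ᶻ b) +ᶻ 1ℤ *ᶻ (b -ᶻ c)
    lem = solveᶻ

  P∣+ : ∀ a a' b b' → P∣ (a -ᶻ a') → P∣ (b -ᶻ b') → P∣ ((a +ᶻ b) -ᶻ (a' +ᶻ b'))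
  P∣+ a a' b b' d e = comb 1ℤ 1ℤ d e (lem a a' b b')
    where
    lem : ∀ a a' b b' → (a +ᶻ b) -ᶻ (a' +ᶻ b') ≡ 1ℤ *ᶻ (a -ᶻ a') +ᶻ 1ℤ *ᶻ (b -ᶻ b')
    lem = solveᶻ

  P∣* : ∀ a a' b b' → P∣ (a -ᶻ a') → P∣ (b -ᶻ b') → P∣ (a *ᶻ b -ᶻ a' *ᶻ b')
  P∣* a a' b b' d e = comb b a' d e (lem a a' b b')
    where
    lem : ∀ a a' b b' → a *ᶻ b -ᶻ a' *ᶻ b' ≡ b *ᶻ (a -ᶻ a') +ᶻ a' *ᶻ (b -ᶻ b')
    lem = solveᶻ

  ⊕-cong : ∀ {x y u v} → x ≈ y → u ≈ v → (x ⊕ u) ≈ (y ⊕ v)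
  ⊕-cong {a , b} {a' , b'} {c , e} {c' , e'} (p & q) (r & s) = P∣+ a a' c c' p r & P∣+ b b' e e' q s

  ⊗-cong : ∀ {x y u v} → x ≈ y → u ≈ v → (x ⊗ u) ≈ (y ⊗ v)
  ⊗-cong {a , b} {a' , b'} {c , e} {c' , e'} (p & q) (r & s) =
    P∣+ (a *ᶻ c) (a' *ᶻ c') (δ *ᶻ (b *ᶻ e)) (δ *ᶻ (b' *ᶻ e')) (P∣* a a' c c' p r) (P∣* δ δ (b *ᶻ e) (b' *ᶻ e') (exact {δ} refl) (P∣* b b' e e' q s)) &
    P∣+ (a *ᶻ e) (a' *ᶻ e') (b *ᶻ c) (b' *ᶻ c') (P∣* a a' e e' p s) (P∣* b b' c c' q r)

  semiring : CommutativeSemiring 0ℓ 0ℓ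
  semiring = record
    { Carrier = K ; _≈_ = _≈_ ; _+_ = _⊕_ ; _*_ = _⊗_ ; 0# = 𝟎 ; 1# = 𝟏
    ; isCommutativeSemiring = isCommutativeSemiringˡ record
      { +-isCommutativeMonoid = record
        { isMonoid = record
          { isSemigroup = record
            { isMagma = record { isEquivalence = equiv ; ∙-cong = ⊕-cong }
            ; assoc = λ { (a , b) (c , e) (f , g) → ≡⇒≈ (ℤP.+-assoc a c f) (ℤP.+-assoc b e g) } }
          ; identity = (λ { (a , b) → ≡⇒≈ (ℤP.+-identityˡ a) (ℤP.+-identityˡ b) }) , (λ { (a , b) → ≡⇒≈ (ℤP.+-identityʳ a) (ℤP.+-identityʳ b) }) }
        ; comm = λ { (a , b) (c , e) → ≡⇒≈ (ℤP.+-comm a c) (ℤP.+-comm b e) } }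
      ; *-isCommutativeMonoid = record
        { isMonoid = record
          { isSemigroup = record
            { isMagma = record { isEquivalence = equiv ; ∙-cong = ⊗-cong }
            ; assoc = λ { (a , b) (c , e) (f , g) → ≡⇒≈ (a₁ a b c e f g δ) (a₂ a b c e f g δ) } }
          ; identity = (λ { (a , b) → ≡⇒≈ (l₁ a b δ) (l₂ a b) }) , (λ { (a , b) → ≡⇒≈ (r₁ a b δ) (r₂ a b) }) }
        ; comm = λ { (a , b) (c , e) → ≡⇒≈ (c₁ a b c e δ) (c₂ a b c e) } }
      ; distribʳ = λ { (a , b) (c , e) (f , g) → ≡⇒≈ (d₁ a b c e f g δ) (d₂ a b c e f g) }
      ; zeroˡ = λ { (a , b) → ≡⇒≈ (z₁ a b δ) (z₂ a b) }
      } }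
    where
    equiv : IsEquivalence _≈_
    equiv = record { refl = λ { {a , b} → ≡⇒≈ {a} {b} refl refl }
                   ; sym = λ { {a , b} {c , e} (p & q) → P∣sym a c p & P∣sym b e q }
                   ; trans = λ { {a , b} {c , e} {f , g} (p & q) (r & s) → P∣trans a c f p r & P∣trans b e g q s } }
    a₁ : ∀ a b c e f g δ → (a *ᶻ c +ᶻ δ *ᶻ (b *ᶻ e)) *ᶻ f +ᶻ δ *ᶻ ((a *ᶻ e +ᶻ b *ᶻ c) *ᶻ g) ≡ a *ᶻ (c *ᶻ f +ᶻ δ *ᶻ (e *ᶻ g)) +ᶻ δ *ᶻ (b *ᶻ (c *ᶻ g +ᶻ e *ᶻ f))
    a₁ = solveᶻ
    a₂ : ∀ a b c e f g δ → (a *ᶻ c +ᶻ δ *ᶻ (b *ᶻ e)) *ᶻ g +ᶻ (a *ᶻ e +ᶻ b *ᶻ c) *ᶻ f ≡ a *ᶻ (c *ᶻ g +ᶻ e *ᶻ f) +ᶻ b *ᶻ (c *ᶻ f +ᶻ δ *ᶻ (e *ᶻ g))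
    a₂ = solveᶻ
    l₁ : ∀ a b δ → 1ℤ *ᶻ a +ᶻ δ *ᶻ (0ℤ *ᶻ b) ≡ a
    l₁ = solveᶻ
    l₂ : ∀ a b → 1ℤ *ᶻ b +ᶻ 0ℤ *ᶻ a ≡ b
    l₂ = solveᶻ
    r₁ : ∀ a b δ → a *ᶻ 1ℤ +ᶻ δ *ᶻ (b *ᶻ 0ℤ) ≡ a
    r₁ = solveᶻ
    r₂ : ∀ a b → a *ᶻ 0ℤ +ᶻ b *ᶻ 1ℤ ≡ b
    r₂ = solveᶻ
    c₁ : ∀ a b c e δ → a *ᶻ c +ᶻ δ *ᶻ (b *ᶻ e) ≡ c *ᶻ a +ᶻ δ *ᶻ (e *ᶻ b)
    c₁ = solveᶻ
    c₂ : ∀ a b c e → a *ᶻ e +ᶻ b *ᶻ c ≡ c *ᶻ b +ᶻ e *ᶻ a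
    c₂ = solveᶻ
    d₁ : ∀ a b c e f g δ → (c +ᶻ f) *ᶻ a +ᶻ δ *ᶻ ((e +ᶻ g) *ᶻ b) ≡ (c *ᶻ a +ᶻ δ *ᶻ (e *ᶻ b)) +ᶻ (f *ᶻ a +ᶻ δ *ᶻ (g *ᶻ b))
    d₁ = solveᶻ
    d₂ : ∀ a b c e f g → (c +ᶻ f) *ᶻ b +ᶻ (e +ᶻ g) *ᶻ a ≡ (c *ᶻ b +ᶻ e *ᶻ a) +ᶻ (f *ᶻ b +ᶻ g *ᶻ a)
    d₂ = solveᶻ
    z₁ : ∀ a b δ → 0ℤ *ᶻ a +ᶻ δ *ᶻ (0ℤ *ᶻ b) ≡ 0ℤ
    z₁ = solveᶻ
    z₂ : ∀ a b → 0ℤ *ᶻ b +ᶻ 0ℤ *ᶻ a ≡ 0ℤ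
    z₂ = solveᶻ

  cancel : ∀ x {y z} → (y ⊕ x) ≈ (z ⊕ x) → y ≈ z
  cancel (a , b) {c , e} {f , g} (p & q) = subst P∣_ (lem a c f) p & subst P∣_ (lem b e g) q
    where
    lem : ∀ a c f → (c +ᶻ a) -ᶻ (f +ᶻ a) ≡ c -ᶻ f
    lem = solveᶻ

  ⊖0 : ∀ {a} → P∣ (a -ᶻ 0ℤ) → P∣ a
  ⊖0 {a} = subst P∣_ (ℤP.+-identityʳ a)

  0⊖ : ∀ {a} → P∣ a → P∣ (a -ᶻ 0ℤ)
  0⊖ {a} = subst P∣_ (sym (ℤP.+-identityʳ a))

  norm-* : ∀ a b c e δ → (a *ᶻ a -ᶻ δ *ᶻ (b *ᶻ b)) *ᶻ (c *ᶻ c -ᶻ δ *ᶻ (e *ᶻ e)) ≡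
    (a *ᶻ c +ᶻ δ *ᶻ (b *ᶻ e)) *ᶻ (a *ᶻ c +ᶻ δ *ᶻ (b *ᶻ e)) +ᶻ (-ᶻ (δ *ᶻ (a *ᶻ e +ᶻ b *ᶻ c))) *ᶻ (a *ᶻ e +ᶻ b *ᶻ c)
  norm-* = solveᶻ

  domain : ∀ {x y} → (x ⊗ y) ≈ 𝟎 → (x ≈ 𝟎) ⊎ (y ≈ 𝟎)
  domain {a , b} {c , e} (p & q) = Sum.map
      (λ d → 0⊖ (proj₁ (definite a b d)) & 0⊖ (proj₂ (definite a b d)))
      (λ d → 0⊖ (proj₁ (definite c e d)) & 0⊖ (proj₂ (definite c e d)))
      (euclid (a *ᶻ a -ᶻ δ *ᶻ (b *ᶻ b)) (c *ᶻ c -ᶻ δ *ᶻ (e *ᶻ e)) norms)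
    where
    re₀ : P∣ (a *ᶻ c +ᶻ δ *ᶻ (b *ᶻ e))
    re₀ = ⊖0 {a *ᶻ c +ᶻ δ *ᶻ (b *ᶻ e)} p
    im₀ : P∣ (a *ᶻ e +ᶻ b *ᶻ c)
    im₀ = ⊖0 {a *ᶻ e +ᶻ b *ᶻ c} q
    norms : P∣ ((a *ᶻ a -ᶻ δ *ᶻ (b *ᶻ b)) *ᶻ (c *ᶻ c -ᶻ δ *ᶻ (e *ᶻ e)))
    norms = comb {a *ᶻ c +ᶻ δ *ᶻ (b *ᶻ e)} {a *ᶻ e +ᶻ b *ᶻ c} (a *ᶻ c +ᶻ δ *ᶻ (b *ᶻ e)) (-ᶻ (δ *ᶻ (a *ᶻ e +ᶻ b *ᶻ c))) re₀ im₀ (norm-* a b c e δ)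

  subtract : ∀ x y → ∃ λ u → x ≈ (y ⊕ u)
  subtract (a , b) (c , e) = (a -ᶻ c , b -ᶻ e) , ≡⇒≈ (lem a c) (lem b e)
    where
    lem : ∀ a c → a ≡ c +ᶻ (a -ᶻ c)
    lem = solveᶻ

  P∤2 : ¬ (P∣ (+ 2))
  P∤2 d = <⇒≱ p>2 (ℕD.∣⇒≤ (∣⇒∣ᵤ d))

  halve₁ : ∀ a → P∣ (a +ᶻ a -ᶻ 0ℤ) → P∣ (a -ᶻ 0ℤ)
  halve₁ a d with euclid (+ 2) a (subst P∣_ (lem a) d)
    where
    lem : ∀ a → a +ᶻ a -ᶻ 0ℤ ≡ + 2 *ᶻ a
    lem = solveᶻ
  ... | inj₁ e = ⊥-elim (P∤2 e)
  ... | inj₂ e = 0⊖ e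

  halve : ∀ {x} → (x ⊕ x) ≈ 𝟎 → x ≈ 𝟎
  halve {a , b} (p & q) = halve₁ a p & halve₁ b q

  conj-cong : ∀ {x y} → x ≈ y → conj x ≈ conj y
  conj-cong {a , b} {c , e} (p & q) = p & comb (-ᶻ 1ℤ) 0ℤ q P∣0 (lem b e)
    where
    lem : ∀ b e → (-ᶻ b) -ᶻ (-ᶻ e) ≡ (-ᶻ 1ℤ) *ᶻ (b -ᶻ e) +ᶻ 0ℤ *ᶻ 0ℤ
    lem = solveᶻ

  conj-+ : ∀ x y → conj (x ⊕ y) ≈ (conj x ⊕ conj y)
  conj-+ (a , b) (c , e) = ≡⇒≈ {a +ᶻ c} refl (ℤP.neg-distrib-+ b e)

  conj-* : ∀ x y → conj (x ⊗ y) ≈ (conj x ⊗ conj y)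
  conj-* (a , b) (c , e) = ≡⇒≈ (l₁ a b c e δ) (l₂ a b c e)
    where
    l₁ : ∀ a b c e δ → a *ᶻ c +ᶻ δ *ᶻ (b *ᶻ e) ≡ a *ᶻ c +ᶻ δ *ᶻ ((-ᶻ b) *ᶻ (-ᶻ e))
    l₁ = solveᶻ
    l₂ : ∀ a b c e → -ᶻ (a *ᶻ e +ᶻ b *ᶻ c) ≡ a *ᶻ (-ᶻ e) +ᶻ (-ᶻ b) *ᶻ c
    l₂ = solveᶻ

  conj-conj : ∀ x → conj (conj x) ≈ x
  conj-conj (a , b) = ≡⇒≈ {a} refl (ℤP.neg-involutive b)

  involutive : InvolutiveDomain
  involutive = record
    { semiring = semiring ; cancel = cancel
    ; domain = λ {x} {y} → domain {x} {y} ; subtract = subtract ; halve = λ {x} → halve {x}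
    ; conj = conj ; conj-cong = conj-cong ; conj-+ = conj-+ ; conj-* = conj-* ; conj-conj = conj-conj }

  open Hermitian involutive
    using (Isotropic; Incident; no-onan; one-point; same-intercept; same-ordinate)

  Pt Ln : Set
  Pt = Fin p × Fin p × Fin p
  Ln = Fin p × Fin p × Fin p × Fin p

  X Y : Pt → K
  X (x , y , t) = ⟦ x ⟧ , ⟦ y ⟧
  Y (x , y , t) = ⟦ x ⟧ *ᶻ ⟦ x ⟧ -ᶻ δ *ᶻ (⟦ y ⟧ *ᶻ ⟦ y ⟧) , ⟦ t ⟧

  slope icpt : Ln → K
  slope (a , b , c , d) = ⟦ a ⟧ , ⟦ b ⟧
  icpt (a , b , c , d) = ⟦ c ⟧ , ⟦ d ⟧

  eq₀ : (x y a b c : Fin p) → ℤ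
  eq₀ x y a b c = (⟦ x ⟧ *ᶻ ⟦ x ⟧ -ᶻ δ *ᶻ (⟦ y ⟧ *ᶻ ⟦ y ⟧)) -ᶻ ((⟦ a ⟧ *ᶻ ⟦ x ⟧ +ᶻ δ *ᶻ (⟦ b ⟧ *ᶻ ⟦ y ⟧)) +ᶻ ⟦ c ⟧)

  eq₁ : (x y t a b d : Fin p) → ℤ
  eq₁ x y t a b d = ⟦ t ⟧ -ᶻ ((⟦ a ⟧ *ᶻ ⟦ y ⟧ +ᶻ ⟦ b ⟧ *ᶻ ⟦ x ⟧) +ᶻ ⟦ d ⟧)

  divides? : ℤ → Bool
  divides? c = does (+ p ∣? c)

  on : Ln → Pt → Bool
  on (a , b , c , d) (x , y , t) = divides? (eq₀ x y a b c) ∧ divides? (eq₁ x y t a b d)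

  P∣divides : ∀ c → P∣ c → divides? c ≡ true
  P∣divides c = does-true (+ p ∣? c)

  divides-P∣ : ∀ c → divides? c ≡ true → P∣ c
  divides-P∣ c = true-does (+ p ∣? c)

  on⇒Incident : ∀ ℓ P → on ℓ P ≡ true → Incident (slope ℓ) (icpt ℓ) (X P) (Y P)
  on⇒Incident (a , b , c , d) (x , y , t) e =
    divides-P∣ (eq₀ x y a b c) (proj₁ (∧-true {divides? (eq₀ x y a b c)} e)) &
    divides-P∣ (eq₁ x y t a b d) (proj₂ (∧-true {divides? (eq₀ x y a b c)} e))

  Incident⇒on : ∀ ℓ P → Incident (slope ℓ) (icpt ℓ) (X P) (Y P) → on ℓ P ≡ true
  Incident⇒on (a , b , c , d) (x , y , t) (u & v) = ∧-intro (P∣divides (eq₀ x y a b c) u) (P∣divides (eq₁ x y t a b d) v)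

  isotropic : ∀ P → Isotropic (X P) (Y P)
  isotropic (x , y , t) = ≡⇒≈ (l₁ ⟦ x ⟧ ⟦ y ⟧ δ) (l₂ ⟦ x ⟧ ⟦ y ⟧ ⟦ t ⟧)
    where
    l₁ : ∀ x y δ → (x *ᶻ x -ᶻ δ *ᶻ (y *ᶻ y)) +ᶻ (x *ᶻ x -ᶻ δ *ᶻ (y *ᶻ y)) ≡
      (x *ᶻ x +ᶻ δ *ᶻ (y *ᶻ (-ᶻ y))) +ᶻ (x *ᶻ x +ᶻ δ *ᶻ (y *ᶻ (-ᶻ y)))
    l₁ = solveᶻ
    l₂ : ∀ x y t → t +ᶻ (-ᶻ t) ≡ (x *ᶻ (-ᶻ y) +ᶻ y *ᶻ x) +ᶻ (x *ᶻ (-ᶻ y) +ᶻ y *ᶻ x)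
    l₂ = solveᶻ

  point≡ : ∀ P Q → X P ≈ X Q → Y P ≈ Y Q → P ≡ Q
  point≡ (x , y , t) (x' , y' , t') (a & b) (_ & c) =
    cong₂ _,_ (⟦⟧-inj x x' a) (cong₂ _,_ (⟦⟧-inj y y' b) (⟦⟧-inj t t' c))

  line≡ : ∀ ℓ m → slope ℓ ≈ slope m → icpt ℓ ≈ icpt m → ℓ ≡ m
  line≡ (a , b , c , d) (a' , b' , c' , d') (p & q) (r & s) =
    cong₂ _,_ (⟦⟧-inj a a' p) (cong₂ _,_ (⟦⟧-inj b b' q) (cong₂ _,_ (⟦⟧-inj c c' r) (⟦⟧-inj d d' s)))

  ≉X : ∀ ℓ P Q → P ≢ Q → on ℓ P ≡ true → on ℓ Q ≡ true → ¬ (X P ≈ X Q)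
  ≉X ℓ P Q P≢Q e f x = P≢Q (point≡ P Q x (same-ordinate {slope ℓ} {icpt ℓ} {X P} {Y P} {X Q} {Y Q} x (on⇒Incident ℓ P e) (on⇒Incident ℓ Q f)))

  ≉slope : ∀ ℓ m P → ℓ ≢ m → on ℓ P ≡ true → on m P ≡ true → ¬ (slope ℓ ≈ slope m)
  ≉slope ℓ m P ℓ≢m e f x = ℓ≢m (line≡ ℓ m x (same-intercept {slope ℓ} {icpt ℓ} {slope m} {icpt m} {X P} {Y P} x (on⇒Incident ℓ P e) (on⇒Incident m P f)))

  _≟Pt_ : (P Q : Pt) → Dec (P ≡ Q)
  _≟Pt_ = ≡-dec Fin._≟_ (≡-dec Fin._≟_ Fin._≟_)

  on-meet : ∀ ℓ m P Q → ℓ ≢ m → on ℓ P ≡ true → on m P ≡ true → on ℓ Q ≡ true → on m Q ≡ true → P ≡ Q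
  on-meet ℓ m P Q ℓ≢m e f g h with P ≟Pt Q
  ... | yes P≡Q = P≡Q
  ... | no P≢Q = ⊥-elim (Sum.[ ≉X ℓ P Q P≢Q e g , ≉slope ℓ m P ℓ≢m e f ]′
      (one-point {slope ℓ} {icpt ℓ} {slope m} {icpt m} {X P} {Y P} {X Q} {Y Q}
        (on⇒Incident ℓ Q g) (on⇒Incident m Q h) (on⇒Incident ℓ P e) (on⇒Incident m P f)))

  on-onan : ∀ ℓ₁ ℓ₂ ℓ₃ ℓ₄ P₁₂ P₁₃ P₁₄ P₂₃ P₂₄ P₃₄ → ℓ₁ ≢ ℓ₂ → ℓ₃ ≢ ℓ₄ →
    on ℓ₁ P₁₂ ≡ true → on ℓ₂ P₁₂ ≡ true → on ℓ₁ P₁₃ ≡ true → on ℓ₃ P₁₃ ≡ true →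
    on ℓ₁ P₁₄ ≡ true → on ℓ₄ P₁₄ ≡ true → on ℓ₂ P₂₃ ≡ true → on ℓ₃ P₂₃ ≡ true →
    on ℓ₂ P₂₄ ≡ true → on ℓ₄ P₂₄ ≡ true → on ℓ₃ P₃₄ ≡ true → on ℓ₄ P₃₄ ≡ true →
    on ℓ₃ P₁₂ ≡ false → on ℓ₄ P₁₂ ≡ false → on ℓ₁ P₃₄ ≡ false → on ℓ₂ P₃₄ ≡ false → ⊥
  on-onan ℓ₁ ℓ₂ ℓ₃ ℓ₄ P₁₂ P₁₃ P₁₄ P₂₃ P₂₄ P₃₄ ℓ₁≢ℓ₂ ℓ₃≢ℓ₄ 1-12 2-12 1-13 3-13 1-14 4-14 2-23 3-23 2-24 4-24 3-34 4-34 ¬3-12 ¬4-12 ¬1-34 ¬2-34 =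
    no-onan {slope ℓ₁} {icpt ℓ₁} {slope ℓ₂} {icpt ℓ₂} {slope ℓ₃} {icpt ℓ₃} {slope ℓ₄} {icpt ℓ₄}
      {X P₂₃} {Y P₂₃} {X P₁₃} {Y P₁₃} {X P₁₂} {Y P₁₂} {X P₁₄} {Y P₁₄} {X P₂₄} {Y P₂₄} {X P₃₄} {Y P₃₄}
      (isotropic P₂₃) (isotropic P₁₃) (isotropic P₁₂) (isotropic P₁₄) (isotropic P₂₄) (isotropic P₃₄)
      (on⇒Incident ℓ₂ P₂₃ 2-23) (on⇒Incident ℓ₃ P₂₃ 3-23) (on⇒Incident ℓ₁ P₁₃ 1-13) (on⇒Incident ℓ₃ P₁₃ 3-13)
      (on⇒Incident ℓ₁ P₁₂ 1-12) (on⇒Incident ℓ₂ P₁₂ 2-12) (on⇒Incident ℓ₁ P₁₄ 1-14) (on⇒Incident ℓ₄ P₁₄ 4-14)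
      (on⇒Incident ℓ₂ P₂₄ 2-24) (on⇒Incident ℓ₄ P₂₄ 4-24) (on⇒Incident ℓ₃ P₃₄ 3-34) (on⇒Incident ℓ₄ P₃₄ 4-34)
      (λ i → off {ℓ₂} {P₂₃} (Incident⇒on ℓ₄ P₂₃ i) 3-23 2-23 ¬2-34) (λ i → off {ℓ₁} {P₁₃} (Incident⇒on ℓ₄ P₁₃ i) 3-13 1-13 ¬1-34)
      (λ i → true≢false (Incident⇒on ℓ₄ P₁₂ i) ¬4-12)
      (≉X ℓ₃ P₁₃ P₂₃ P₁₃≢P₂₃ 3-13 3-23)
      (≉X ℓ₂ P₁₂ P₂₃ (λ { refl → true≢false 3-23 ¬3-12 }) 2-12 2-23)
      (≉slope ℓ₃ ℓ₂ P₂₃ (λ { refl → true≢false 2-12 ¬3-12 }) 3-23 2-23)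
    where
    off : ∀ {ℓ P} → on ℓ₄ P ≡ true → on ℓ₃ P ≡ true → on ℓ P ≡ true → on ℓ P₃₄ ≡ false → ⊥
    off {ℓ} {P} 4P 3P ℓP ¬ℓ = true≢false (subst (λ Q → on ℓ Q ≡ true) (on-meet ℓ₃ ℓ₄ P P₃₄ ℓ₃≢ℓ₄ 3P 4P 3-34 4-34) ℓP) ¬ℓ
    P₁₃≢P₂₃ : P₁₃ ≢ P₂₃
    P₁₃≢P₂₃ refl = true≢false (subst (λ Q → on ℓ₃ Q ≡ true) (on-meet ℓ₁ ℓ₂ P₁₃ P₁₂ ℓ₁≢ℓ₂ 1-13 2-23 1-12 2-12) 3-13) ¬3-12

  F : List (Fin p)
  F = allFin p

  count-t : ∀ x y a b d → # F (λ t → divides? (eq₁ x y t a b d)) ≤ 1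
  count-t x y a b d = #≤1 p _ λ t t' e f → ⟦⟧-inj t t' (comb 1ℤ (-ᶻ 1ℤ) (divides-P∣ (eq₁ x y t a b d) e) (divides-P∣ (eq₁ x y t' a b d) f)
    (lem ⟦ t ⟧ ⟦ t' ⟧ ((⟦ a ⟧ *ᶻ ⟦ y ⟧ +ᶻ ⟦ b ⟧ *ᶻ ⟦ x ⟧) +ᶻ ⟦ d ⟧)))
    where
    lem : ∀ t t' r → t -ᶻ t' ≡ 1ℤ *ᶻ (t -ᶻ r) +ᶻ (-ᶻ 1ℤ) *ᶻ (t' -ᶻ r)
    lem = solveᶻ

  roots : ∀ y a b c x x' → P∣ (eq₀ x y a b c) → P∣ (eq₀ x' y a b c) → x ≡ x' ⊎ P∣ ((⟦ x ⟧ +ᶻ ⟦ x' ⟧) -ᶻ ⟦ a ⟧)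
  roots y a b c x x' d e = Sum.map₁ (⟦⟧-inj x x') (euclid (⟦ x ⟧ -ᶻ ⟦ x' ⟧) ((⟦ x ⟧ +ᶻ ⟦ x' ⟧) -ᶻ ⟦ a ⟧)
      (comb {eq₀ x y a b c} {eq₀ x' y a b c} 1ℤ (-ᶻ 1ℤ) d e (lem ⟦ x ⟧ ⟦ x' ⟧ ⟦ a ⟧ (δ *ᶻ (⟦ y ⟧ *ᶻ ⟦ y ⟧)) (δ *ᶻ (⟦ b ⟧ *ᶻ ⟦ y ⟧)) ⟦ c ⟧)))
    where
    lem : ∀ x x' a u v c → (x -ᶻ x') *ᶻ ((x +ᶻ x') -ᶻ a) ≡ 1ℤ *ᶻ ((x *ᶻ x -ᶻ u) -ᶻ ((a *ᶻ x +ᶻ v) +ᶻ c)) +ᶻ (-ᶻ 1ℤ) *ᶻ ((x' *ᶻ x' -ᶻ u) -ᶻ ((a *ᶻ x' +ᶻ v) +ᶻ c))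
    lem = solveᶻ

  count-x : ∀ y a b c → # F (λ x → divides? (eq₀ x y a b c)) ≤ 2
  count-x y a b c = #≤2 p _ λ i j k e f g → three i j k (divides-P∣ (eq₀ i y a b c) e) (divides-P∣ (eq₀ j y a b c) f) (divides-P∣ (eq₀ k y a b c) g)
    where
    lem : ∀ i j k a → j -ᶻ k ≡ 1ℤ *ᶻ ((i +ᶻ j) -ᶻ a) +ᶻ (-ᶻ 1ℤ) *ᶻ ((i +ᶻ k) -ᶻ a)
    lem = solveᶻ
    three : ∀ i j k → P∣ (eq₀ i y a b c) → P∣ (eq₀ j y a b c) → P∣ (eq₀ k y a b c) → i ≡ j ⊎ i ≡ k ⊎ j ≡ k
    three i j k e f g = pick (roots y a b c i j e f) (roots y a b c i k e g)
      where
      pick : i ≡ j ⊎ P∣ ((⟦ i ⟧ +ᶻ ⟦ j ⟧) -ᶻ ⟦ a ⟧) → i ≡ k ⊎ P∣ ((⟦ i ⟧ +ᶻ ⟦ k ⟧) -ᶻ ⟦ a ⟧) → i ≡ j ⊎ i ≡ k ⊎ j ≡ k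
      pick (inj₁ q) _ = inj₁ q
      pick (inj₂ _) (inj₁ q) = inj₂ (inj₁ q)
      pick (inj₂ u) (inj₂ v) = inj₂ (inj₂ (⟦⟧-inj j k (comb {(⟦ i ⟧ +ᶻ ⟦ j ⟧) -ᶻ ⟦ a ⟧} {(⟦ i ⟧ +ᶻ ⟦ k ⟧) -ᶻ ⟦ a ⟧} 1ℤ (-ᶻ 1ℤ) u v (lem ⟦ i ⟧ ⟦ j ⟧ ⟦ k ⟧ ⟦ a ⟧))))

  on-short : ∀ ℓ → ∑ F (λ x → ∑ F (λ y → ∑ F (λ t → 𝟙 (on ℓ (x , y , t))))) ≤ 2 * p
  on-short (a , b , c , d) = ∑-∧-bound p (λ x y → divides? (eq₀ x y a b c)) (λ x y t → divides? (eq₁ x y t a b d))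
    (λ x y → count-t x y a b d) (λ y → count-x y a b c)

  through : ∀ x y t a b → 1 ≤ ∑ F (λ c → ∑ F (λ d → 𝟙 (on (a , b , c , d) (x , y , t))))
  through x y t a b = ≤-trans (≤-reflexive (sym (cong 𝟙 (Incident⇒on (a , b , c , d) (x , y , t) (flip r u c e & flip ⟦ t ⟧ v d f)))))
      (≤-trans (∑-∈ (λ d → 𝟙 (on (a , b , c , d) (x , y , t))) (∈-allFin d)) (∑-∈ (λ c → ∑ F (λ d → 𝟙 (on (a , b , c , d) (x , y , t)))) (∈-allFin c)))
    where
    r u v : ℤ
    r = ⟦ x ⟧ *ᶻ ⟦ x ⟧ -ᶻ δ *ᶻ (⟦ y ⟧ *ᶻ ⟦ y ⟧)
    u = ⟦ a ⟧ *ᶻ ⟦ x ⟧ +ᶻ δ *ᶻ (⟦ b ⟧ *ᶻ ⟦ y ⟧)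
    v = ⟦ a ⟧ *ᶻ ⟦ y ⟧ +ᶻ ⟦ b ⟧ *ᶻ ⟦ x ⟧
    c d : Fin p
    c = proj₁ (residue (r -ᶻ u))
    d = proj₁ (residue (⟦ t ⟧ -ᶻ v))
    e : P∣ ((r -ᶻ u) -ᶻ ⟦ c ⟧)
    e = proj₂ (residue (r -ᶻ u))
    f : P∣ ((⟦ t ⟧ -ᶻ v) -ᶻ ⟦ d ⟧)
    f = proj₂ (residue (⟦ t ⟧ -ᶻ v))
    lem : ∀ r u c → (r -ᶻ u) -ᶻ c ≡ r -ᶻ (u +ᶻ c)
    lem = solveᶻ
    flip : ∀ r u (c : Fin p) → P∣ ((r -ᶻ u) -ᶻ ⟦ c ⟧) → P∣ (r -ᶻ (u +ᶻ ⟦ c ⟧))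
    flip r u c = subst P∣_ (lem r u ⟦ c ⟧)

  toPt : Fin (p * (p * p)) → Pt
  toPt i = proj₁ (Fin.remQuot (p * p) i) , Fin.remQuot p (proj₂ (Fin.remQuot {p} (p * p) i))

  toLn : Fin (p * (p * (p * p))) → Ln
  toLn i = proj₁ (Fin.remQuot (p * (p * p)) i) , toPt (proj₂ (Fin.remQuot {p} (p * (p * p)) i))

  toPt-inj : ∀ i j → toPt i ≡ toPt j → i ≡ j
  toPt-inj i j e = remQuot-inj (p * p) i j (cong proj₁ e) (remQuot-inj p _ _ (cong (proj₁ ∘ proj₂) e) (cong (proj₂ ∘ proj₂) e))

  toLn-inj : ∀ i j → toLn i ≡ toLn j → i ≡ j
  toLn-inj i j e = remQuot-inj (p * (p * p)) i j (cong proj₁ e) (toPt-inj _ _ (cong proj₂ e))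

  ∑-Pt : ∀ (f : Pt → ℕ) → ∑ (allFin (p * (p * p))) (f ∘ toPt) ≡ ∑ F (λ x → ∑ F (λ y → ∑ F (λ t → f (x , y , t))))
  ∑-Pt f = trans (∑-remQuot p (p * p) (λ { (x , i) → f (x , Fin.remQuot p i) }))
    (∑-cong F λ x → ∑-remQuot p p (λ { (y , t) → f (x , y , t) }))

  ∑-Ln : ∀ (f : Ln → ℕ) → ∑ (allFin (p * (p * (p * p)))) (f ∘ toLn) ≡ ∑ F (λ a → ∑ F (λ b → ∑ F (λ c → ∑ F (λ d → f (a , b , c , d)))))
  ∑-Ln f = trans (∑-remQuot p (p * (p * p)) (λ { (a , i) → f (a , toPt i) }))
    (∑-cong F λ a → ∑-Pt (λ q → f (a , q)))

  M : ℕ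
  M = p * (p * (p * p))

  size : Fin M → ℕ
  size ℓ = # (allFin (p * (p * p))) (λ P → on (toLn ℓ) (toPt P))

  size≤ : ∀ ℓ → size ℓ ≤ 2 * p
  size≤ ℓ = ≤-trans (≤-reflexive (∑-Pt (λ P → 𝟙 (on (toLn ℓ) P)))) (on-short (toLn ℓ))

  long? : Fin M → Bool
  long? ℓ = p ≤ᵇ 2 * size ℓ

  ∑1 : ∀ (c : ℕ) → ∑ F (λ _ → c) ≡ p * c
  ∑1 c = trans (∑-const F c) (cong (_* c) (length-allFin p))

  incidences : p * (p * (p * (p * p))) ≤ ∑ (allFin M) size
  incidences = begin
    p * (p * (p * (p * p))) ≡⟨ sym (trans (∑-Pt (λ _ → p * p)) (trans (∑-cong F λ x → trans (∑-cong F λ y → ∑1 (p * p)) (∑1 (p * (p * p)))) (∑1 (p * (p * (p * p)))))) ⟩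
    ∑ (allFin (p * (p * p))) (λ P → p * p) ≤⟨ ∑-mono (allFin (p * (p * p))) pencil ⟩
    ∑ (allFin (p * (p * p))) (λ P → ∑ (allFin M) (λ ℓ → 𝟙 (on (toLn ℓ) (toPt P)))) ≡⟨ ∑-swap (allFin (p * (p * p))) (allFin M) _ ⟩
    ∑ (allFin M) size ∎
    where
    open ≤-Reasoning
    pencil : ∀ P → p * p ≤ ∑ (allFin M) (λ ℓ → 𝟙 (on (toLn ℓ) (toPt P)))
    pencil P = begin
      p * p ≡⟨ sym (trans (∑-cong F λ a → trans (∑1 1) (*-identityʳ p)) (∑1 p)) ⟩
      ∑ F (λ a → ∑ F (λ b → 1)) ≤⟨ ∑-mono F (λ a → ∑-mono F λ b → through (proj₁ (toPt P)) (proj₁ (proj₂ (toPt P))) (proj₂ (proj₂ (toPt P))) a b) ⟩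
      ∑ F (λ a → ∑ F (λ b → ∑ F (λ c → ∑ F (λ d → 𝟙 (on (a , b , c , d) (toPt P)))))) ≡⟨ sym (∑-Ln (λ ℓ → 𝟙 (on ℓ (toPt P)))) ⟩
      ∑ (allFin M) (λ ℓ → 𝟙 (on (toLn ℓ) (toPt P))) ∎

  many-long : p ^ 4 ≤ 4 * # (allFin M) long?
  many-long = *-cancelʳ-≤ (p ^ 4) _ p (+-cancelʳ-≤ (M * p) _ _ (begin
    p ^ 4 * p + M * p ≡⟨ e₁ p ⟩
    2 * (p * (p * (p * (p * p)))) ≤⟨ *-monoʳ-≤ 2 incidences ⟩
    2 * ∑ (allFin M) size ≡⟨ sym (∑-*ˡ (allFin M) 2 size) ⟩
    ∑ (allFin M) (λ ℓ → 2 * size ℓ) ≤⟨ ∑-mono (allFin M) bnd ⟩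
    ∑ (allFin M) (λ ℓ → 𝟙 (long? ℓ) * (4 * p) + p) ≡⟨ ∑-+ (allFin M) _ _ ⟩
    ∑ (allFin M) (λ ℓ → 𝟙 (long? ℓ) * (4 * p)) + ∑ (allFin M) (λ _ → p) ≡⟨ cong₂ _+_ (∑-*ʳ (allFin M) (4 * p) _) (trans (∑-const (allFin M) p) (cong (_* p) (length-allFin M))) ⟩
    # (allFin M) long? * (4 * p) + M * p ≡⟨ cong (_+ M * p) (e₂ (# (allFin M) long?) p) ⟩
    4 * # (allFin M) long? * p + M * p ∎))
    where
    open ≤-Reasoning
    e₁ : ∀ p → p * (p * (p * (p * 1))) * p + p * (p * (p * p)) * p ≡ 2 * (p * (p * (p * (p * p))))
    e₁ = solve-∀
    e₂ : ∀ g p → g * (4 * p) ≡ 4 * g * p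
    e₂ = solve-∀
    e₃ : ∀ p → 2 * (2 * p) ≡ 1 * (4 * p)
    e₃ = solve-∀
    bnd : ∀ ℓ → 2 * size ℓ ≤ 𝟙 (long? ℓ) * (4 * p) + p
    bnd ℓ with bool-cases (long? ℓ)
    ... | inj₁ t rewrite t = ≤-trans (*-monoʳ-≤ 2 (size≤ ℓ)) (≤-trans (≤-reflexive (e₃ p)) (m≤m+n _ p))
    ... | inj₂ f rewrite f = <⇒≤ (false-≤ᵇ p (2 * size ℓ) f)

  plane : Geometry p
  plane = record
    { lines = # (allFin M) long?
    ; inc = λ ℓ P → on (toLn (line ℓ)) (toPt P)
    ; many = many-long
    ; few = ≤-trans (#≤length (allFin M) long?) (≤-reflexive (trans (length-allFin M) (cong (λ q → p * (p * (p * q))) (sym (*-identityʳ p)))))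
    ; long = λ ℓ → true-≤ᵇ p (2 * size (line ℓ)) (line-long ℓ)
    ; short = λ ℓ → size≤ (line ℓ)
    ; meet = λ ℓ m P Q ℓ≢m a b c d → toPt-inj P Q (on-meet (toLn (line ℓ)) (toLn (line m)) (toPt P) (toPt Q) (distinct ℓ≢m) a b c d)
    ; onan = λ ℓ₁ ℓ₂ ℓ₃ ℓ₄ P₁₂ P₁₃ P₁₄ P₂₃ P₂₄ P₃₄ ℓ₁≢ℓ₂ ℓ₃≢ℓ₄ →
        on-onan (toLn (line ℓ₁)) (toLn (line ℓ₂)) (toLn (line ℓ₃)) (toLn (line ℓ₄))
          (toPt P₁₂) (toPt P₁₃) (toPt P₁₄) (toPt P₂₃) (toPt P₂₄) (toPt P₃₄) (distinct ℓ₁≢ℓ₂) (distinct ℓ₃≢ℓ₄)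
    }
    where
    line : Fin (# (allFin M) long?) → Fin M
    line = proj₁ (enumerate M long?)
    line-long : ∀ i → long? (line i) ≡ true
    line-long = proj₁ (proj₂ (enumerate M long?))
    distinct : ∀ {i j} → i ≢ j → toLn (line i) ≢ toLn (line j)
    distinct i≢j e = i≢j (proj₂ (proj₂ (enumerate M long?)) _ _ (toLn-inj _ _ e))

geometry : ∀ p → Prime p → 2 < p → Geometry p
geometry p pr p>2 = Plane.plane p pr p>2 ⟦ proj₁ ns ⟧ (anisotropic ⟦ proj₁ ns ⟧ (proj₂ ns))
  where
  open Modular p pr
  ns = nonsquare (p ∸ 3 , sym (m+[n∸m]≡n p>2))

-- The reciprocals 1 / ((k+j+1) C(k+j,k)) of the Leibniz triangle are integral combinations of
-- 1, 1/2, …, 1/(n+1), so M times each of them is an integer.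
leibniz : ∀ n M → (∀ i → 1 ≤ i → i ≤ suc n → i ∣ⁿ M) → ∀ k j → k + j ≤ n →
  ∃ λ L → L * suc (k + j) ! ≡ M * (k ! * j !)
leibniz n M div zero j j≤n with div (suc j) (s≤s z≤n) (s≤s j≤n)
... | ℕD.divides L refl = L , lem L (suc j) (j !)
  where
  lem : ∀ L a f → L * (a * f) ≡ L * a * (1 * f)
  lem = solve-∀
leibniz n M div (suc k) j k+j≤n with leibniz n M div k j (≤-trans (n≤1+n _) k+j≤n)
    | leibniz n M div k (suc j) (≤-trans (≤-reflexive (+-suc k j)) k+j≤n)
... | L₁ , e₁ | L₂ , e₂ rewrite +-suc k j = L₁ ∸ L₂ , (begin
    (L₁ ∸ L₂) * N ≡⟨ *-distribʳ-∸ N L₁ L₂ ⟩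
    L₁ * N ∸ L₂ * N ≡⟨ cong₂ _∸_ (trans (lem₁ L₁ (2+ (k + j)) (suc (k + j) !)) (cong ((2+ (k + j)) *_) e₁)) e₂ ⟩
    2+ (k + j) * (M * (k ! * j !)) ∸ M * (k ! * suc j !) ≡⟨ cong₂ _∸_ (lem₂ k j M (k !) (j !)) (lem₃ j M (k !) (j !)) ⟩
    (M * (suc k ! * j !) + suc j * (M * (k ! * j !))) ∸ suc j * (M * (k ! * j !)) ≡⟨ m+n∸n≡m (M * (suc k ! * j !)) (suc j * (M * (k ! * j !))) ⟩
    M * (suc k ! * j !) ∎)
  where
  open ≡-Reasoning
  N = 2+ (k + j) !
  lem₁ : ∀ L a f → L * (a * f) ≡ a * (L * f)
  lem₁ = solve-∀
  lem₂ : ∀ k j M f g → (2 + (k + j)) * (M * (f * g)) ≡ M * ((1 + k) * f * g) + (1 + j) * (M * (f * g))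
  lem₂ = solve-∀
  lem₃ : ∀ j M f g → M * (f * ((1 + j) * g)) ≡ (1 + j) * (M * (f * g))
  lem₃ = solve-∀

central : ∀ h → 4 ^ h * (h ! * h !) ≤ suc (h + h) !
central zero = ≤-refl
central (suc h) rewrite +-suc h h = begin
  4 * 4 ^ h * (suc h * h ! * (suc h * h !)) ≡⟨ lem (4 ^ h) h (h !) ⟩
  4 * (suc h * suc h) * (4 ^ h * (h ! * h !)) ≤⟨ *-mono-≤ (≤-trans (m≤m+n _ (2 * suc h)) (≤-reflexive (lem₂ h))) (central h) ⟩
  (3 + (h + h)) * (2 + (h + h)) * suc (h + h) ! ≡⟨ *-assoc (3 + (h + h)) (2 + (h + h)) (suc (h + h) !) ⟩
  (3 + (h + h)) * ((2 + (h + h)) * suc (h + h) !) ∎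
  where
  open ≤-Reasoning
  lem : ∀ a h f → 4 * a * ((1 + h) * f * ((1 + h) * f)) ≡ 4 * ((1 + h) * (1 + h)) * (a * (f * f))
  lem = solve-∀
  lem₂ : ∀ h → 4 * ((1 + h) * (1 + h)) + 2 * (1 + h) ≡ (3 + (h + h)) * (2 + (h + h))
  lem₂ = solve-∀

common-multiple-large : ∀ h M → 1 ≤ M → (∀ i → 1 ≤ i → i ≤ suc (h + h) → i ∣ⁿ M) → 4 ^ h ≤ M
common-multiple-large h M M>0 div with leibniz (h + h) M div h h ≤-refl
... | L , e = *-cancelʳ-≤ (4 ^ h) M (h ! * h !) {{m*n≢0 (h !) (h !) {{f≢0}} {{f≢0}}}} (begin
    4 ^ h * (h ! * h !) ≤⟨ central h ⟩
    suc (h + h) ! ≤⟨ m≤n*m _ L {{L≢0}} ⟩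
    L * suc (h + h) ! ≡⟨ e ⟩
    M * (h ! * h !) ∎)
  where
  open ≤-Reasoning
  f≢0 : NonZero (h !)
  f≢0 = >-nonZero (1≤n! h)
  L≢0 : NonZero L
  L≢0 = >-nonZero (n≢0⇒n>0 λ { refl → <⇒≢ (*-mono-≤ M>0 (*-mono-≤ (1≤n! h) (1≤n! h))) e })

top-power : ∀ n q → 1 ≤ n → 2 ≤ q → ∃ λ t → 1 ≤ t × t ≤ n × (∀ e → q ^ e ≤ n → q ^ e ∣ⁿ t)
top-power n q n>0 q≥2 = let t , t>0 , t≤n , h = go (suc n) in
    t , t>0 , t≤n , λ e le → h e (s≤s (≤-trans (<⇒≤ (m<q^m e)) le)) le
  where
  m<q^m : ∀ m → m < q ^ m
  m<q^m zero = s≤s z≤n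
  m<q^m (suc m) = begin-strict
    suc m <⟨ s≤s (m<q^m m) ⟩
    suc (q ^ m) ≤⟨ +-monoˡ-≤ (q ^ m) (m^n>0 q {{>-nonZero (≤-trans (s≤s z≤n) q≥2)}} m) ⟩
    q ^ m + q ^ m ≡⟨ cong (q ^ m +_) (sym (+-identityʳ (q ^ m))) ⟩
    2 * q ^ m ≤⟨ *-monoˡ-≤ (q ^ m) q≥2 ⟩
    q ^ suc m ∎
    where open ≤-Reasoning
  go : ∀ m → ∃ λ t → 1 ≤ t × t ≤ n × (∀ e → e < m → q ^ e ≤ n → q ^ e ∣ⁿ t)
  go zero = 1 , ≤-refl , n>0 , λ _ ()
  go (suc m) with q ^ m ≤? n
  ... | yes le = q ^ m , m^n>0 q {{>-nonZero (≤-trans (s≤s z≤n) q≥2)}} m , le , λ e e<m _ → subst (λ s → q ^ e ∣ⁿ s) (trans (sym (^-distribˡ-+-* q e (m ∸ e))) (cong (q ^_) (m+[n∸m]≡n (≤-pred e<m)))) (ℕD.m∣m*n (q ^ (m ∸ e)))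
  ... | no ≰ with go m
  ... | t , t>0 , t≤n , h = t , t>0 , t≤n , λ e e<m le → h e (≤∧≢⇒< (≤-pred e<m) λ { refl → ≰ le }) le

strip : ∀ q k → 2 ≤ q → 1 ≤ k → ∃ λ e → ∃ λ k' → k ≡ q ^ e * k' × ¬ (q ∣ⁿ k')
strip q k q≥2 = <-rec (λ k → 1 ≤ k → ∃ λ e → ∃ λ k' → k ≡ q ^ e * k' × ¬ (q ∣ⁿ k')) step k
  where
  step : ∀ k → (∀ {j} → j < k → 1 ≤ j → ∃ λ e → ∃ λ k' → j ≡ q ^ e * k' × ¬ (q ∣ⁿ k')) →
    1 ≤ k → ∃ λ e → ∃ λ k' → k ≡ q ^ e * k' × ¬ (q ∣ⁿ k')
  step k rec k>0 with q ∣ⁿ? k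
  ... | no q∤k = 0 , k , sym (*-identityˡ k) , q∤k
  ... | yes (ℕD.divides j refl) with rec (≤-trans (≤-reflexive (+-comm 1 j)) (≤-trans (+-monoʳ-≤ j j>0) (≤-trans (≤-reflexive (trans (cong (j +_) (sym (+-identityʳ j))) (*-comm 2 j))) (*-monoʳ-≤ j q≥2)))) j>0
    where
    j>0 : 1 ≤ j
    j>0 = n≢0⇒n>0 λ { refl → <⇒≱ k>0 z≤n }
  ... | e , k' , eq , q∤ = suc e , k' , trans (cong (_* q) eq) (lem (q ^ e) k' q) , q∤
    where
    lem : ∀ a k q → a * k * q ≡ q * a * k
    lem = solve-∀

smooth-multiple : ∀ n → 1 ≤ n → ∀ j → ∃ λ M → 1 ≤ M × M ≤ n ^ j ×
  (∀ k → 1 ≤ k → k ≤ n → (∀ q → Prime q → q ∣ⁿ k → q ≤ j) → k ∣ⁿ M)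
smooth-multiple n n>0 zero = 1 , ≤-refl , ≤-refl , λ k k>0 _ h → unit k k>0 h
  where
  unit : ∀ k → 1 ≤ k → (∀ q → Prime q → q ∣ⁿ k → q ≤ 0) → k ∣ⁿ 1
  unit k k>0 h with factorise k {{>-nonZero k>0}}
  ... | record { factors = [] ; isFactorisation = eq } rewrite eq = ℕD.∣-refl
  ... | record { factors = q ∷ qs ; isFactorisation = eq ; factorsPrime = pq ∷ _ } =
    ⊥-elim (<⇒≱ (>-nonZero⁻¹ q {{prime⇒nonZero pq}}) (h q pq (subst (q ∣ⁿ_) (sym eq) (ℕD.m∣m*n _))))
smooth-multiple n n>0 (suc j) with smooth-multiple n n>0 j | prime? (suc j)
... | M , M>0 , M≤ , h | no ¬pr = M , M>0 , ≤-trans M≤ (m≤n*m (n ^ j) n {{>-nonZero n>0}}) , λ k k>0 k≤n sm →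
    h k k>0 k≤n λ q pq q∣k → ≤-pred (≤∧≢⇒< (sm q pq q∣k) λ { refl → ¬pr pq })
... | M , M>0 , M≤ , h | yes pr with top-power n (suc j) n>0 (nonTrivial⇒n>1 (suc j) {{prime⇒nonTrivial pr}})
... | t , t>0 , t≤n , ht = t * M , *-mono-≤ t>0 M>0 , *-mono-≤ t≤n M≤ , λ k k>0 k≤n sm → div k k>0 k≤n sm
  where
  div : ∀ k → 1 ≤ k → k ≤ n → (∀ q → Prime q → q ∣ⁿ k → q ≤ suc j) → k ∣ⁿ t * M
  div k k>0 k≤n sm with strip (suc j) k (nonTrivial⇒n>1 (suc j) {{prime⇒nonTrivial pr}}) k>0
  ... | e , k' , refl , q∤k' = ℕD.*-pres-∣ (ht e (≤-trans (m≤m*n (suc j ^ e) k' {{>-nonZero k'>0}}) k≤n))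
        (h k' k'>0 (≤-trans (m≤n*m k' (suc j ^ e) {{m^n≢0 (suc j) e}}) k≤n) λ q pq q∣k' →
          ≤-pred (≤∧≢⇒< (sm q pq (ℕD.∣-trans q∣k' (ℕD.n∣m*n (suc j ^ e)))) λ { refl → q∤k' q∣k' }))
    where
    k'>0 : 1 ≤ k'
    k'>0 = n≢0⇒n>0 λ { refl → <⇒≱ k>0 (≤-reflexive (*-zeroʳ (suc j ^ e))) }

prime-between : ∀ y h → suc (h + h) ^ y < 4 ^ h → ∃ λ q → Prime q × y < q × q ≤ suc (h + h)
prime-between y h lt with FinP.any? {n = 2+ (h + h)} (λ i → prime? (toℕ i) ×-dec (y <? toℕ i))
... | yes (i , pr , y<i) = toℕ i , pr , y<i , ≤-pred (FinP.toℕ<n i)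
... | no none with smooth-multiple (suc (h + h)) (s≤s z≤n) y
... | M , M>0 , M≤ , div = ⊥-elim (<⇒≱ lt (≤-trans (common-multiple-large h M M>0 λ i i>0 i≤ →
    div i i>0 i≤ λ q pq q∣i → ≮⇒≥ λ y<q → none (fromℕ< (q< i i>0 i≤ q q∣i) , subst (λ m → Prime m × y < m) (sym (FinP.toℕ-fromℕ< (q< i i>0 i≤ q q∣i))) (pq , y<q))) M≤))
  where
  q< : ∀ i → 1 ≤ i → i ≤ suc (h + h) → ∀ q → q ∣ⁿ i → q < 2+ (h + h)
  q< i i>0 i≤ q q∣i = s≤s (≤-trans (ℕD.∣⇒≤ {{>-nonZero i>0}} q∣i) i≤)

^-distribʳ-* : ∀ n a b → (a * b) ^ n ≡ a ^ n * b ^ n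
^-distribʳ-* zero a b = refl
^-distribʳ-* (suc n) a b = trans (cong (a * b *_) (^-distribʳ-* n a b)) (lem₃ a b (a ^ n) (b ^ n))
  where
  lem₃ : ∀ a b c d → a * b * (c * d) ≡ a * c * (b * d)
  lem₃ = solve-∀

-- Colourings c of m points are encoded by Fin (r ^ m); the colouring hits P if q P and c P = t P.
module Hits (r : ℕ) where
  hits misses : ∀ {m} → (Fin m → Bool) → (Fin m → Fin r) → (Fin m → Fin r) → ℕ
  hits {m} q t c = # (allFin m) (λ P → q P ∧ does (c P Fin.≟ t P))
  misses {m} q t c = # (allFin m) (λ P → q P ∧ not (does (c P Fin.≟ t P)))

  hits+misses : ∀ {m} (q : Fin m → Bool) t c → # (allFin m) q ≡ hits q t c + misses q t c
  hits+misses {m} q t c = #-split (allFin m) q (λ P → does (c P Fin.≟ t P))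

  colour-weight : ∀ (t : Fin r) → suc (∑ (allFin r) (λ a → 2 ^ 𝟙 (not (does (a Fin.≟ t))))) ≤ 2 * r
  colour-weight t = begin
    suc (∑ (allFin r) (λ a → 2 ^ 𝟙 (not (does (a Fin.≟ t))))) ≤⟨ +-monoˡ-≤ _ (≤-trans (≤-reflexive (sym (cong 𝟙 (does-true (t Fin.≟ t) refl)))) (∑-∈ (λ a → 𝟙 (does (a Fin.≟ t))) (∈-allFin t))) ⟩
    # (allFin r) (λ a → does (a Fin.≟ t)) + ∑ (allFin r) (λ a → 2 ^ 𝟙 (not (does (a Fin.≟ t)))) ≡⟨ sym (∑-+ (allFin r) _ _) ⟩
    ∑ (allFin r) (λ a → 𝟙 (does (a Fin.≟ t)) + 2 ^ 𝟙 (not (does (a Fin.≟ t)))) ≡⟨ ∑-cong (allFin r) (λ a → two (does (a Fin.≟ t))) ⟩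
    ∑ (allFin r) (λ _ → 2) ≡⟨ trans (∑-const (allFin r) 2) (trans (cong (_* 2) (length-allFin r)) (*-comm r 2)) ⟩
    2 * r ∎
    where
    open ≤-Reasoning
    two : ∀ b → 𝟙 b + 2 ^ 𝟙 (not b) ≡ 2
    two true = refl
    two false = refl

  total-weight : ∀ m (q : Fin m → Bool) t →
    ∑ (allFin (r ^ m)) (λ c → 2 ^ misses q t (Fin.finToFun c)) * r ^ # (allFin m) q ≤ (2 * r ∸ 1) ^ # (allFin m) q * r ^ m
  total-weight zero q t = ≤-refl
  total-weight (suc m) q t = begin
    ∑ (allFin (r * r ^ m)) (λ c → 2 ^ misses q t (Fin.finToFun c)) * r ^ # (allFin (suc m)) q
      ≡⟨ cong₂ _*_ (trans (∑-cong (allFin (r * r ^ m)) split) (trans (∑-remQuot r (r ^ m) (λ { (a , c) → 2 ^ 𝟙 (q zero ∧ not (does (a Fin.≟ t zero))) * W' c }))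
           (trans (∑-cong (allFin r) λ a → ∑-*ˡ (allFin (r ^ m)) (2 ^ 𝟙 (q zero ∧ not (does (a Fin.≟ t zero)))) W') (∑-*ʳ (allFin r) S' _))))
           (trans (cong (r ^_) (∑-allFin-suc m (𝟙 ∘ q))) (^-distribˡ-+-* r (𝟙 (q zero)) s')) ⟩
    ∑ (allFin r) (λ a → 2 ^ 𝟙 (q zero ∧ not (does (a Fin.≟ t zero)))) * S' * (r ^ 𝟙 (q zero) * r ^ s') ≡⟨ lem (∑ (allFin r) (λ a → 2 ^ 𝟙 (q zero ∧ not (does (a Fin.≟ t zero))))) S' (r ^ 𝟙 (q zero)) (r ^ s') ⟩
    ∑ (allFin r) (λ a → 2 ^ 𝟙 (q zero ∧ not (does (a Fin.≟ t zero)))) * r ^ 𝟙 (q zero) * (S' * r ^ s') ≤⟨ *-mono-≤ (head (q zero)) (total-weight m (q ∘ suc) (t ∘ suc)) ⟩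
    (2 * r ∸ 1) ^ 𝟙 (q zero) * r * ((2 * r ∸ 1) ^ s' * r ^ m) ≡⟨ lem₂ ((2 * r ∸ 1) ^ 𝟙 (q zero)) r ((2 * r ∸ 1) ^ s') (r ^ m) ⟩
    (2 * r ∸ 1) ^ 𝟙 (q zero) * (2 * r ∸ 1) ^ s' * (r * r ^ m) ≡⟨ cong (_* (r * r ^ m)) (sym (trans (cong ((2 * r ∸ 1) ^_) (∑-allFin-suc m (𝟙 ∘ q))) (^-distribˡ-+-* (2 * r ∸ 1) (𝟙 (q zero)) s'))) ⟩
    (2 * r ∸ 1) ^ # (allFin (suc m)) q * r ^ suc m ∎
    where
    open ≤-Reasoning
    s' = # (allFin m) (q ∘ suc)
    W' : Fin (r ^ m) → ℕ
    W' c = 2 ^ misses (q ∘ suc) (t ∘ suc) (Fin.finToFun c)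
    S' = ∑ (allFin (r ^ m)) W'
    lem : ∀ a b c d → a * b * (c * d) ≡ a * c * (b * d)
    lem = solve-∀
    lem₂ : ∀ a r b c → a * r * (b * c) ≡ a * b * (r * c)
    lem₂ = solve-∀
    split : ∀ c → 2 ^ misses q t (Fin.finToFun c) ≡
      2 ^ 𝟙 (q zero ∧ not (does (proj₁ (Fin.remQuot (r ^ m) c) Fin.≟ t zero))) * W' (proj₂ (Fin.remQuot {r} (r ^ m) c))
    split c = trans (cong (2 ^_) (∑-allFin-suc m (λ P → 𝟙 (q P ∧ not (does (Fin.finToFun {r} {suc m} c P Fin.≟ t P))))))
      (^-distribˡ-+-* 2 (𝟙 (q zero ∧ not (does (proj₁ (Fin.remQuot (r ^ m) c) Fin.≟ t zero)))) _)
    head : ∀ b → ∑ (allFin r) (λ a → 2 ^ 𝟙 (b ∧ not (does (a Fin.≟ t zero)))) * r ^ 𝟙 b ≤ (2 * r ∸ 1) ^ 𝟙 b * r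
    head false = ≤-reflexive (trans (*-identityʳ _) (trans (∑-const (allFin r) 1) (trans (*-identityʳ _) (trans (length-allFin r) (sym (*-identityˡ r))))))
    head true = *-mono-≤ (≤-trans (m+n≤o⇒m≤o∸n A {1} (≤-trans (≤-reflexive (+-comm A 1)) (colour-weight (t zero)))) (≤-reflexive (sym (*-identityʳ (2 * r ∸ 1))))) (≤-reflexive (*-identityʳ r))
      where A = ∑ (allFin r) (λ a → 2 ^ 𝟙 (not (does (a Fin.≟ t zero))))

  power-gap : ∀ a e f → (2 ^ e * a ^ (suc a * e + f)) ≤ suc a ^ (suc a * e + f)
  power-gap a zero f rewrite *-zeroʳ a = ≤-trans (≤-reflexive (*-identityˡ _)) (^-monoˡ-≤ f (n≤1+n a))
  power-gap a (suc e) f = begin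
    2 * 2 ^ e * a ^ (suc a * suc e + f) ≡⟨ cong (2 * 2 ^ e *_) (trans (cong (a ^_) ex) (^-distribˡ-+-* a (suc a) (suc a * e + f))) ⟩
    2 * 2 ^ e * (a ^ suc a * a ^ (suc a * e + f)) ≡⟨ lem 2 (2 ^ e) (a ^ suc a) (a ^ (suc a * e + f)) ⟩
    2 * a ^ suc a * (2 ^ e * a ^ (suc a * e + f)) ≤⟨ *-mono-≤ base (power-gap a e f) ⟩
    suc a ^ suc a * suc a ^ (suc a * e + f) ≡⟨ sym (trans (cong (suc a ^_) ex) (^-distribˡ-+-* (suc a) (suc a) (suc a * e + f))) ⟩
    suc a ^ (suc a * suc e + f) ∎
    where
    open ≤-Reasoning
    ex : suc a * suc e + f ≡ suc a + (suc a * e + f)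
    ex = trans (cong (_+ f) (*-suc (suc a) e)) (+-assoc (suc a) _ f)
    lem : ∀ a b c d → a * b * (c * d) ≡ a * c * (b * d)
    lem = solve-∀
    lem₂ : ∀ a b → 2 * (a * b) ≡ a * b + a * 1 * b
    lem₂ = solve-∀
    base : 2 * a ^ suc a ≤ suc a ^ suc a
    base = begin
      2 * (a * a ^ a) ≡⟨ lem₂ a (a ^ a) ⟩
      a * a ^ a + a * 1 * a ^ a ≤⟨ +-monoʳ-≤ (a * a ^ a) (*-monoˡ-≤ (a ^ a) (*-monoˡ-≤ 1 (n≤1+n a))) ⟩
      a ^ suc a + suc a * 1 * a ^ a ≤⟨ bernoulli 1 a a ⟩
      (1 + a) ^ suc a ∎

  low-hits : ∀ m (q : Fin m → Bool) t H e → 1 ≤ r → 2 * r * e ≤ # (allFin m) q →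
    # (allFin (r ^ m)) (λ c → not (H ≤ᵇ hits q t (Fin.finToFun c))) * 2 ^ e ≤ 2 ^ H * r ^ m
  low-hits m q t H e r>0 long = *-cancelʳ-≤ _ _ (a ^ s) {{m^n≢0 a s {{>-nonZero a>0}}}} (begin
      L * 2 ^ e * a ^ s ≡⟨ *-assoc L (2 ^ e) (a ^ s) ⟩
      L * (2 ^ e * a ^ s) ≤⟨ *-monoʳ-≤ L (subst (λ s → 2 ^ e * a ^ s ≤ suc a ^ s) s≡ (power-gap a e (s ∸ suc a * e))) ⟩
      L * suc a ^ s ≡⟨ cong (λ b → L * b ^ s) a≡ ⟩
      L * (2 * r) ^ s ≡⟨ cong (L *_) (^-distribʳ-* s 2 r) ⟩
      L * (2 ^ s * r ^ s) ≡⟨ sym (*-assoc L (2 ^ s) (r ^ s)) ⟩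
      L * 2 ^ s * r ^ s ≤⟨ *-monoˡ-≤ (r ^ s) markov ⟩
      2 ^ H * ∑ (allFin (r ^ m)) (λ c → 2 ^ misses q t (Fin.finToFun c)) * r ^ s ≡⟨ *-assoc (2 ^ H) _ (r ^ s) ⟩
      2 ^ H * (∑ (allFin (r ^ m)) (λ c → 2 ^ misses q t (Fin.finToFun c)) * r ^ s) ≤⟨ *-monoʳ-≤ (2 ^ H) (total-weight m q t) ⟩
      2 ^ H * (a ^ s * r ^ m) ≡⟨ lem (2 ^ H) (a ^ s) (r ^ m) ⟩
      2 ^ H * r ^ m * a ^ s ∎)
    where
    open ≤-Reasoning
    s = # (allFin m) q
    a = 2 * r ∸ 1
    L = # (allFin (r ^ m)) (λ c → not (H ≤ᵇ hits q t (Fin.finToFun c)))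
    2r>1 : 2 ≤ 2 * r
    2r>1 = *-monoʳ-≤ 2 r>0
    a>0 : 1 ≤ a
    a>0 = m+n≤o⇒m≤o∸n 1 2r>1
    a≡ : suc a ≡ 2 * r
    a≡ = m+[n∸m]≡n {1} (≤-trans (s≤s z≤n) 2r>1)
    s≡ : suc a * e + (s ∸ suc a * e) ≡ s
    s≡ = m+[n∸m]≡n (subst (λ b → b * e ≤ s) (sym a≡) long)
    lem : ∀ a b c → a * (b * c) ≡ a * c * b
    lem = solve-∀
    markov : L * 2 ^ s ≤ 2 ^ H * ∑ (allFin (r ^ m)) (λ c → 2 ^ misses q t (Fin.finToFun c))
    markov = ≤-trans (≤-reflexive (sym (∑-*ʳ (allFin (r ^ m)) (2 ^ s) _)))
      (≤-trans (∑-mono (allFin (r ^ m)) bnd) (≤-reflexive (∑-*ˡ (allFin (r ^ m)) (2 ^ H) _)))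
      where
      bnd : ∀ c → 𝟙 (not (H ≤ᵇ hits q t (Fin.finToFun c))) * 2 ^ s ≤ 2 ^ H * 2 ^ misses q t (Fin.finToFun c)
      bnd c with bool-cases (H ≤ᵇ hits q t (Fin.finToFun c))
      ... | inj₁ e rewrite e = z≤n
      ... | inj₂ e rewrite e = ≤-trans (≤-reflexive (trans (*-identityˡ _) (trans (cong (2 ^_) (hits+misses q t (Fin.finToFun c))) (^-distribˡ-+-* 2 (hits q t (Fin.finToFun c)) _))))
            (*-monoˡ-≤ (2 ^ misses q t (Fin.finToFun c)) (^-monoʳ-≤ 2 (<⇒≤ (false-≤ᵇ H _ e))))

minimum : ∀ r → 1 ≤ r → (f : Fin r → ℕ) → ∃ λ i → ∀ j → f i ≤ f j
minimum (suc zero) _ f = zero , λ { zero → ≤-refl }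
minimum (suc (suc r)) _ f with minimum (suc r) (s≤s z≤n) (f ∘ suc)
... | i , h with ≤-total (f zero) (f (suc i))
... | inj₁ le = zero , λ { zero → ≤-refl ; (suc j) → ≤-trans le (h j) }
... | inj₂ ge = suc i , λ { zero → ge ; (suc j) → h j }

-- Vertex i of the final graph picks a line from the i-th group of g lines and a colouring of all points,
-- so distinct vertices have distinct lines.
module Space (p : ℕ) (Geo : Geometry p) (r : ℕ) (r>0 : 1 ≤ r) (n g : ℕ) (ng≤ : n * g ≤ Geometry.lines Geo) where
  open Geometry Geo
  open Hits r

  np R h : ℕ
  np = p * (p * p)
  R = r ^ np
  h = g * R

  Elt : Set
  Elt = Fin n × Fin h

  pts : List (Fin np)
  pts = allFin np

  es : List Elt
  es = cartesianProduct (allFin n) (allFin h)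

  line : Elt → Fin lines
  line (i , x) = Fin.inject≤ (Fin.combine i (proj₁ (Fin.remQuot {g} R x))) ng≤

  col : Elt → Fin np → Fin r
  col (i , x) = Fin.finToFun (proj₂ (Fin.remQuot {g} R x))

  on : Elt → Fin np → Fin r → Bool
  on u P j = inc (line u) P ∧ does (col u P Fin.≟ j)

  line-group : ∀ u v → line u ≡ line v → proj₁ u ≡ proj₁ v
  line-group (i , x) (j , y) e = FinP.combine-injectiveˡ i (proj₁ (Fin.remQuot {g} R x)) j (proj₁ (Fin.remQuot {g} R y)) (FinP.inject≤-injective ng≤ ng≤ _ _ e)

  ∑-es : ∀ f → ∑ es f ≡ ∑ (allFin n) (λ i → ∑ (allFin g) (λ l → ∑ (allFin R) (λ c → f (i , Fin.combine l c))))
  ∑-es f = trans (∑-× (allFin n) (allFin h) f) (∑-cong (allFin n) λ i → ∑-combine g R (λ x → f (i , x)))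

  low-hitting : ∀ H e → (∀ ℓ → 2 * r * (H + e) ≤ # pts (inc ℓ)) → ∀ (t : Fin np → Fin r) →
    # es (λ u → not (H ≤ᵇ # pts (λ P → on u P (t P)))) * 2 ^ e ≤ n * g * R
  low-hitting H e long t = begin
    # es low * 2 ^ e ≡⟨ cong (_* 2 ^ e) (∑-es _) ⟩
    ∑ (allFin n) (λ i → ∑ (allFin g) (λ l → ∑ (allFin R) (λ c → 𝟙 (low (i , Fin.combine l c))))) * 2 ^ e
      ≡⟨ trans (sym (∑-*ʳ (allFin n) (2 ^ e) _)) (∑-cong (allFin n) λ i → sym (∑-*ʳ (allFin g) (2 ^ e) _)) ⟩
    ∑ (allFin n) (λ i → ∑ (allFin g) (λ l → ∑ (allFin R) (λ c → 𝟙 (low (i , Fin.combine l c))) * 2 ^ e))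
      ≤⟨ ∑-mono (allFin n) (λ i → ∑-mono (allFin g) λ l → bnd i l) ⟩
    ∑ (allFin n) (λ i → ∑ (allFin g) (λ l → R)) ≡⟨ trans (∑-cong (allFin n) λ i → trans (∑-const (allFin g) R) (cong (_* R) (length-allFin g))) (trans (∑-const (allFin n) (g * R)) (cong (_* (g * R)) (length-allFin n))) ⟩
    n * (g * R) ≡⟨ sym (*-assoc n g R) ⟩
    n * g * R ∎
    where
    open ≤-Reasoning
    low : Elt → Bool
    low u = not (H ≤ᵇ # pts (λ P → on u P (t P)))
    at : ∀ i l c → low (i , Fin.combine l c) ≡ not (H ≤ᵇ hits (inc (Fin.inject≤ (Fin.combine i l) ng≤)) t (Fin.finToFun c))
    at i l c = cong (λ { (l , c) → not (H ≤ᵇ hits (inc (Fin.inject≤ (Fin.combine i l) ng≤)) t (Fin.finToFun c)) }) (FinP.remQuot-combine {g} {R} l c)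
    bnd : ∀ i l → ∑ (allFin R) (λ c → 𝟙 (low (i , Fin.combine l c))) * 2 ^ e ≤ R
    bnd i l = *-cancelˡ-≤ (2 ^ H) {{m^n≢0 2 H}} (begin
      2 ^ H * (∑ (allFin R) (λ c → 𝟙 (low (i , Fin.combine l c))) * 2 ^ e) ≡⟨ cong (λ z → 2 ^ H * (z * 2 ^ e)) (∑-cong (allFin R) λ c → cong 𝟙 (at i l c)) ⟩
      2 ^ H * (# (allFin R) (λ c → not (H ≤ᵇ hits (inc (Fin.inject≤ (Fin.combine i l) ng≤)) t (Fin.finToFun c))) * 2 ^ e) ≡⟨ lem (2 ^ H) (# (allFin R) (λ c → not (H ≤ᵇ hits (inc (Fin.inject≤ (Fin.combine i l) ng≤)) t (Fin.finToFun c)))) (2 ^ e) ⟩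
      # (allFin R) (λ c → not (H ≤ᵇ hits (inc (Fin.inject≤ (Fin.combine i l) ng≤)) t (Fin.finToFun c))) * (2 ^ H * 2 ^ e)
        ≡⟨ cong (# (allFin R) (λ c → not (H ≤ᵇ hits (inc (Fin.inject≤ (Fin.combine i l) ng≤)) t (Fin.finToFun c))) *_) (sym (^-distribˡ-+-* 2 H e)) ⟩
      # (allFin R) (λ c → not (H ≤ᵇ hits (inc (Fin.inject≤ (Fin.combine i l) ng≤)) t (Fin.finToFun c))) * 2 ^ (H + e) ≤⟨ low-hits np (inc (Fin.inject≤ (Fin.combine i l) ng≤)) t H (H + e) r>0 (long (Fin.inject≤ (Fin.combine i l) ng≤)) ⟩
      2 ^ H * R ∎)
      where
      lem : ∀ a b c → a * (b * c) ≡ b * (a * c)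
      lem = solve-∀

  module Saturated (V : Elt → Bool) where
    N : ℕ
    N = # es V

    class : Fin np → Fin r → Elt → Bool
    class P i u = V u ∧ on u P i

    rare : Fin np → Fin r
    rare P = proj₁ (minimum r r>0 (λ i → # es (class P i)))

    w : Fin np → ℕ
    w P = # es (class P (rare P))

    w≤class : ∀ P j → w P ≤ # es (class P j)
    w≤class P = proj₂ (minimum r r>0 (λ i → # es (class P i)))

    supersaturation : ∀ H e → (∀ ℓ → 2 * r * (H + e) ≤ # pts (inc ℓ)) → 2 * (n * g * R) ≤ N * 2 ^ e →
      H * N ≤ 2 * ∑ pts w
    supersaturation H e long large = +-cancelʳ-≤ (H * N) _ _ (begin
      H * N + H * N ≡⟨ cong (H * N +_) (sym (+-identityʳ (H * N))) ⟩
      2 * (H * N) ≤⟨ *-monoʳ-≤ 2 step ⟩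
      2 * (∑ pts w + H * L) ≡⟨ lem (∑ pts w) H L ⟩
      2 * ∑ pts w + H * (2 * L) ≤⟨ +-monoʳ-≤ (2 * ∑ pts w) (*-monoʳ-≤ H 2L≤N) ⟩
      2 * ∑ pts w + H * N ∎)
      where
      open ≤-Reasoning
      lem : ∀ a H L → 2 * (a + H * L) ≡ 2 * a + H * (2 * L)
      lem = solve-∀
      hit# : Elt → ℕ
      hit# u = # pts (λ P → on u P (rare P))
      L = # es (λ u → not (H ≤ᵇ hit# u))
      2L≤N : 2 * L ≤ N
      2L≤N = *-cancelʳ-≤ (2 * L) N (2 ^ e) {{m^n≢0 2 e}} (≤-trans (≤-reflexive (*-assoc 2 L (2 ^ e))) (≤-trans (*-monoʳ-≤ 2 (low-hitting H e long rare)) large))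
      ∑w : ∑ pts w ≡ ∑ es (λ u → 𝟙 (V u) * hit# u)
      ∑w = trans (∑-swap pts es _) (∑-cong es λ u → trans (∑-cong pts λ P → 𝟙-∧ (V u) _) (∑-*ˡ pts (𝟙 (V u)) _))
      step : H * N ≤ ∑ pts w + H * L
      step = begin
        H * N ≡⟨ sym (∑-*ˡ es H _) ⟩
        ∑ es (λ u → H * 𝟙 (V u)) ≤⟨ ∑-mono es bnd ⟩
        ∑ es (λ u → 𝟙 (V u) * hit# u + H * 𝟙 (not (H ≤ᵇ hit# u))) ≡⟨ trans (∑-+ es _ _) (cong₂ _+_ (sym ∑w) (∑-*ˡ es H _)) ⟩
        ∑ pts w + H * L ∎
        where
        bnd : ∀ u → H * 𝟙 (V u) ≤ 𝟙 (V u) * hit# u + H * 𝟙 (not (H ≤ᵇ hit# u))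
        bnd u with bool-cases (H ≤ᵇ hit# u)
        ... | inj₁ e rewrite e = ≤-trans (≤-reflexive (*-comm H (𝟙 (V u)))) (≤-trans (*-monoʳ-≤ (𝟙 (V u)) (true-≤ᵇ H (hit# u) e)) (m≤m+n _ (H * 0)))
        ... | inj₂ e rewrite e = ≤-trans (*-monoʳ-≤ H (𝟙≤1 (V u))) (m≤n+m (H * 1) _)

∑-cong∈ : ∀ {A : Set} (xs : List A) {f g : A → ℕ} → (∀ x → x ∈ xs → f x ≡ g x) → ∑ xs f ≡ ∑ xs g
∑-cong∈ xs H = ≤-antisym (∑-mono∈ xs λ x p → ≤-reflexive (H x p)) (∑-mono∈ xs λ x p → ≤-reflexive (sym (H x p)))

module Chunks {A : Set} (_≟_ : (x y : A) → Dec (x ≡ y)) (q : A → Bool) where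
  rank : List A → A → ℕ
  rank [] u = 0
  rank (x ∷ xs) u = if does (u ≟ x) then 0 else 𝟙 (q x) + rank xs u

  rank-count : ∀ xs → Unique xs → ∀ c → # xs (λ u → q u ∧ (suc (rank xs u) ≤ᵇ c)) ≡ c ⊓ # xs q
  rank-count [] [] c = sym (⊓-zeroʳ c)
  rank-count (x ∷ xs) (x∉ ∷ un) c = trans (cong₂ _+_ (cong 𝟙 first) (∑-cong∈ xs others)) (go (q x) c)
    where
    first : (q x ∧ (suc (rank (x ∷ xs) x) ≤ᵇ c)) ≡ (q x ∧ (1 ≤ᵇ c))
    first rewrite does-true (x ≟ x) refl = refl
    others : ∀ u → u ∈ xs → 𝟙 (q u ∧ (suc (rank (x ∷ xs) u) ≤ᵇ c)) ≡ 𝟙 (q u ∧ (suc (𝟙 (q x) + rank xs u) ≤ᵇ c))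
    others u u∈ rewrite does-false (u ≟ x) (λ { refl → All.lookup x∉ u∈ refl }) = refl
    go : ∀ a c → 𝟙 (a ∧ (1 ≤ᵇ c)) + ∑ xs (λ u → 𝟙 (q u ∧ (suc (𝟙 a + rank xs u) ≤ᵇ c))) ≡ c ⊓ (𝟙 a + # xs q)
    go false c = rank-count xs un c
    go true zero = ∑-zero xs λ u → lem (q u)
      where
      lem : ∀ b → 𝟙 (b ∧ false) ≡ 0
      lem true = refl
      lem false = refl
    go true (suc c) = cong suc (rank-count xs un c)

  module _ (xs : List A) (un : Unique xs) (ρ : ℕ) where
    slot : ℕ → A → Bool
    slot k u = (k * ρ ≤ᵇ rank xs u) ∧ (suc (rank xs u) ≤ᵇ suc k * ρ)

    chunk : ℕ → A → Bool
    chunk k u = q u ∧ slot k u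

    chunk-count : ∀ k → # xs (chunk k) + (k * ρ) ⊓ # xs q ≡ (suc k * ρ) ⊓ # xs q
    chunk-count k = trans (cong (# xs (chunk k) +_) (sym (rank-count xs un (k * ρ))))
      (trans (sym (∑-+ xs _ _)) (trans (∑-cong xs λ u → pick (q u) (rank xs u)) (rank-count xs un (suc k * ρ))))
      where
      pick : ∀ b x → 𝟙 (b ∧ ((k * ρ ≤ᵇ x) ∧ (suc x ≤ᵇ suc k * ρ))) + 𝟙 (b ∧ (suc x ≤ᵇ k * ρ)) ≡ 𝟙 (b ∧ (suc x ≤ᵇ suc k * ρ))
      pick false x = refl
      pick true x with bool-cases (k * ρ ≤ᵇ x)
      ... | inj₁ e rewrite e | ¬true⇒false {suc x ≤ᵇ k * ρ} (λ e' → <⇒≱ (true-≤ᵇ (suc x) (k * ρ) e') (true-≤ᵇ (k * ρ) x e)) = +-identityʳ _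
      ... | inj₂ f rewrite f | ≤ᵇ-true (false-≤ᵇ (k * ρ) x f) | ≤ᵇ-true (≤-trans (false-≤ᵇ (k * ρ) x f) (m≤n+m (k * ρ) ρ)) = refl

    chunk-full : ∀ k → suc k * ρ ≤ # xs q → # xs (chunk k) ≡ ρ
    chunk-full k le = +-cancelʳ-≡ (k * ρ) _ _ (trans (cong (# xs (chunk k) +_) (sym (m≤n⇒m⊓n≡m (≤-trans (m≤n+m (k * ρ) ρ) le))))
      (trans (chunk-count k) (m≤n⇒m⊓n≡m le)))

    chunk≤ : ∀ k → # xs (chunk k) ≤ ρ
    chunk≤ k with ≤-total (k * ρ) (# xs q)
    ... | inj₁ le = +-cancelʳ-≤ (k * ρ) _ _ (≤-trans (≤-reflexive (trans (cong (# xs (chunk k) +_) (sym (m≤n⇒m⊓n≡m le))) (chunk-count k))) (m⊓n≤m _ _))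
    ... | inj₂ ge = ≤-trans (≤-reflexive (+-cancelʳ-≡ (# xs q) (# xs (chunk k)) 0 (trans (cong (# xs (chunk k) +_) (sym (m≥n⇒m⊓n≡n ge)))
          (trans (chunk-count k) (m≥n⇒m⊓n≡n (≤-trans ge (m≤n+m (k * ρ) ρ))))))) z≤n

    slots≤1 : ∀ K u → # (downFrom K) (λ k → slot k u) ≤ 1
    slots≤1 K u = ≤-trans (≤-reflexive (go K)) (𝟙≤1 _)
      where
      x = rank xs u
      go : ∀ K → # (downFrom K) (λ k → slot k u) ≡ 𝟙 (suc x ≤ᵇ K * ρ)
      go zero = refl
      go (suc K) with bool-cases (K * ρ ≤ᵇ x)
      ... | inj₁ e rewrite go K | e | ¬true⇒false {suc x ≤ᵇ K * ρ} (λ e' → <⇒≱ (true-≤ᵇ (suc x) (K * ρ) e') (true-≤ᵇ (K * ρ) x e)) = +-identityʳ _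
      ... | inj₂ f rewrite go K | f | ≤ᵇ-true (false-≤ᵇ (K * ρ) x f) | ≤ᵇ-true (≤-trans (false-≤ᵇ (K * ρ) x f) (m≤n+m (K * ρ) ρ)) = refl

all-slots : ∀ K ρ w → K * ρ ≤ w → # (downFrom K) (λ k → suc k * ρ ≤ᵇ w) ≡ K
all-slots zero ρ w _ = refl
all-slots (suc K) ρ w le rewrite ≤ᵇ-true le = cong suc (all-slots K ρ w (≤-trans (m≤n+m (K * ρ) ρ) le))

full-slots : ∀ K ρ w → w ≤ K * ρ → w ≤ ρ + # (downFrom K) (λ k → suc k * ρ ≤ᵇ w) * ρ
full-slots zero ρ w w≤ = ≤-trans w≤ z≤n
full-slots (suc K) ρ w w≤ with ≤-total (suc K * ρ) w
... | inj₁ le rewrite ≤ᵇ-true le | all-slots K ρ w (≤-trans (m≤n+m (K * ρ) ρ) le) = ≤-trans w≤ (m≤n+m _ ρ)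
... | inj₂ ge with ≤-total w (K * ρ)
... | inj₁ w≤K = ≤-trans (full-slots K ρ w w≤K) (+-monoʳ-≤ ρ (*-monoˡ-≤ ρ (m≤n+m _ (𝟙 (suc K * ρ ≤ᵇ w)))))
... | inj₂ K≤w = ≤-trans ge (+-monoʳ-≤ ρ (*-monoˡ-≤ ρ (≤-trans (≤-reflexive (sym (all-slots K ρ w K≤w))) (m≤n+m _ (𝟙 (suc K * ρ ≤ᵇ w))))))

module Containers (p : ℕ) (Geo : Geometry p) (r : ℕ) (r>0 : 1 ≤ r) (n g : ℕ) (ng≤ : n * g ≤ Geometry.lines Geo)
  (pat : List (Fin r)) (k : ℕ) (pat-length : length pat ≡ suc k) (Π t m d H e : ℕ)
  (Π>0 : 1 ≤ Π) (t>0 : 1 ≤ t) (d>0 : 1 ≤ d)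
  (few-lines : 2 * (n * g) ≤ Π * 2 ^ e)
  (hits-large : 2 * (p * (p * p)) * 4 ^ k + 8 * (32 * t) ^ k * Π ≤ H * Π)
  (degree : 2 * p ≤ d * (32 * t) ^ k)
  (lines-long : ∀ ℓ → 2 * r * (H + e) ≤ # (allFin (p * (p * p))) (Geometry.inc Geo ℓ))
  (m-large : 8 * Π ≤ m * (32 * t))
  where

  open Geometry Geo
  open Space p Geo r r>0 n g ng≤

  Indep : PF n h → Set
  Indep γ = ∀ P us → Pointwise (λ u j → on u P j ≡ true) us pat → All (γ ∋_) us →
    AllPairs (λ u v → proj₁ u ≢ proj₁ v) us → ⊥

  Y : ℕ
  Y = Π * R

  open Cover n h Y Indep hiding (Elt) public

  R>0 : 1 ≤ R
  R>0 = m^n>0 r {{>-nonZero r>0}} np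

  es-unique : Unique es
  es-unique = UniqueP.cartesianProduct⁺ (UniqueP.allFin⁺ n) (UniqueP.allFin⁺ h)

  ∈es : ∀ u → u ∈ es
  ∈es (i , x) = ∈P.∈-cartesianProduct⁺ (∈-allFin i) (∈-allFin x)

  mate : Elt → Elt → Bool
  mate v u = does (line u Fin.≟ line v)

  mates≤R : ∀ v → # es (mate v) ≤ R
  mates≤R v@(i , x) = begin
    # es (mate v) ≡⟨ ∑-es _ ⟩
    ∑ (allFin n) (λ j → ∑ (allFin g) (λ l → ∑ (allFin R) (λ c → 𝟙 (mate v (j , Fin.combine l c)))))
      ≤⟨ ∑-mono (allFin n) (λ j → ∑-mono (allFin g) λ l → ∑-mono (allFin R) λ c → same j l c) ⟩
    ∑ (allFin n) (λ j → ∑ (allFin g) (λ l → ∑ (allFin R) (λ c → 𝟙 (does (j Fin.≟ i)) * 𝟙 (does (l Fin.≟ l₀)))))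
      ≡⟨ ∑-cong (allFin n) (λ j → ∑-cong (allFin g) λ l → trans (∑-const (allFin R) _) (cong (_* (𝟙 (does (j Fin.≟ i)) * 𝟙 (does (l Fin.≟ l₀)))) (length-allFin R))) ⟩
    ∑ (allFin n) (λ j → ∑ (allFin g) (λ l → R * (𝟙 (does (j Fin.≟ i)) * 𝟙 (does (l Fin.≟ l₀)))))
      ≡⟨ ∑-cong (allFin n) (λ j → trans (∑-cong (allFin g) λ l → lem R (𝟙 (does (j Fin.≟ i))) (𝟙 (does (l Fin.≟ l₀)))) (∑-*ˡ (allFin g) (𝟙 (does (j Fin.≟ i))) _)) ⟩
    ∑ (allFin n) (λ j → 𝟙 (does (j Fin.≟ i)) * ∑ (allFin g) (λ l → 𝟙 (does (l Fin.≟ l₀)) * R)) ≤⟨ ∑-δ i _ ⟩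
    ∑ (allFin g) (λ l → 𝟙 (does (l Fin.≟ l₀)) * R) ≤⟨ ∑-δ l₀ R ⟩
    R ∎
    where
    open ≤-Reasoning
    l₀ : Fin g
    l₀ = proj₁ (Fin.remQuot {g} R x)
    lem : ∀ R a b → R * (a * b) ≡ a * (b * R)
    lem = solve-∀
    same : ∀ j l c → 𝟙 (mate v (j , Fin.combine l c)) ≤ 𝟙 (does (j Fin.≟ i)) * 𝟙 (does (l Fin.≟ l₀))
    same j l c with bool-cases (mate v (j , Fin.combine l c))
    ... | inj₂ f rewrite f = z≤n
    ... | inj₁ q = ≤-trans (𝟙≤1 _) (≤-reflexive (sym (cong₂ _*_ (cong 𝟙 (does-true (j Fin.≟ i) j≡i)) (cong 𝟙 (does-true (l Fin.≟ l₀) l≡l₀)))))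
      where
      eq : Fin.combine j (proj₁ (Fin.remQuot {g} R (Fin.combine l c))) ≡ Fin.combine i l₀
      eq = FinP.inject≤-injective ng≤ ng≤ _ _ (true-does (line (j , Fin.combine l c) Fin.≟ line v) q)
      j≡i : j ≡ i
      j≡i = FinP.combine-injectiveˡ j _ i l₀ eq
      l≡l₀ : l ≡ l₀
      l≡l₀ = trans (sym (cong proj₁ (FinP.remQuot-combine {g} {R} l c))) (FinP.combine-injectiveʳ j _ i l₀ eq)

  ω z w κ : ℕ
  ω = r * 4 ^ k
  z = 32 * t
  w = 64 * ω
  κ = w ^ k * d

  ω>0 : 1 ≤ ω
  ω>0 = *-mono-≤ r>0 (m^n>0 4 k)

  κ>0 : 1 ≤ κ
  κ>0 = *-mono-≤ (m^n>0 w {{>-nonZero (≤-trans ω>0 (m≤n*m ω 64))}} k) d>0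

  module Round (V : Elt → Bool) (Y≤N : Y ≤ # es V) where
    open Saturated V using (N; class; rare; w≤class; supersaturation) renaming (w to least)
    instance
      Π≢0 : NonZero Π
      Π≢0 = >-nonZero Π>0

    ρ* ρ₀ K : ℕ
    ρ* = N / Π
    ρ₀ = 4 ^ k * ρ*
    K = length es

    ρ*Π≤N : ρ* * Π ≤ N
    ρ*Π≤N = m/n*n≤m N Π

    R≤ρ* : R ≤ ρ*
    R≤ρ* = ≤-trans (≤-reflexive (sym (m*n/n≡m R Π))) (/-monoˡ-≤ Π (≤-trans (≤-reflexive (*-comm R Π)) Y≤N))

    ρ*>0 : 1 ≤ ρ*
    ρ*>0 = ≤-trans R>0 R≤ρ*

    N≤2Πρ* : N ≤ 2 * Π * ρ*
    N≤2Πρ* = begin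
      N ≡⟨ m≡m%n+[m/n]*n N Π ⟩
      N % Π + ρ* * Π ≤⟨ +-monoˡ-≤ _ (≤-trans (<⇒≤ (m%n<n N Π)) (m≤n*m Π ρ* {{>-nonZero ρ*>0}})) ⟩
      ρ* * Π + ρ* * Π ≡⟨ lem ρ* Π ⟩
      2 * Π * ρ* ∎
      where
      open ≤-Reasoning
      lem : ∀ a b → a * b + a * b ≡ 2 * b * a
      lem = solve-∀

    Block : Set
    Block = Fin np × ℕ

    bs : List Block
    bs = cartesianProduct pts (downFrom K)

    open module Ch (P : Fin np) (j : Fin r) = Chunks _≟E_ (class P j) using (slot; chunk; chunk-full; chunk≤; slots≤1)

    mem₀ : Block → Fin r → Elt → Bool
    mem₀ (P , i) j = chunk P j es es-unique ρ₀ i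

    A₀ : Block → Bool
    A₀ (P , i) = suc i * ρ₀ ≤ᵇ least P

    mem₀-class : ∀ b j u → mem₀ b j u ≡ true → class (proj₁ b) j u ≡ true
    mem₀-class (P , i) j u q = proj₁ (∧-true {class P j u} q)

    mem₀-V : ∀ b j u → mem₀ b j u ≡ true → V u ≡ true
    mem₀-V b j u q = proj₁ (∧-true {V u} (mem₀-class b j u q))

    mem₀-on : ∀ b j u → mem₀ b j u ≡ true → on u (proj₁ b) j ≡ true
    mem₀-on b j u q = proj₂ (∧-true {V u} (mem₀-class b j u q))

    one-colour : ∀ u P → # (allFin r) (on u P) ≤ 𝟙 (inc (line u) P)
    one-colour u P with bool-cases (inc (line u) P)
    ... | inj₂ f = ≤-trans (≤-reflexive (∑-zero (allFin r) λ j → cong (λ b → 𝟙 (b ∧ does (col u P Fin.≟ j))) f)) z≤n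
    ... | inj₁ q rewrite q = #≤1 r _ λ i j a b → trans (sym (true-does (col u P Fin.≟ i) a)) (true-does (col u P Fin.≟ j) b)

    block-sum : ∀ u (f : Fin np → ℕ) →
      ∑ bs (λ b → f (proj₁ b) * ∑ (allFin r) (λ j → 𝟙 (mem₀ b j u))) ≤ ∑ pts (λ P → f P * 𝟙 (inc (line u) P))
    block-sum u f = begin
      ∑ bs (λ b → f (proj₁ b) * ∑ (allFin r) (λ j → 𝟙 (mem₀ b j u))) ≡⟨ ∑-× pts (downFrom K) _ ⟩
      ∑ pts (λ P → ∑ (downFrom K) (λ i → f P * ∑ (allFin r) (λ j → 𝟙 (mem₀ (P , i) j u)))) ≤⟨ ∑-mono pts at ⟩
      ∑ pts (λ P → f P * 𝟙 (inc (line u) P)) ∎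
      where
      open ≤-Reasoning
      at : ∀ P → ∑ (downFrom K) (λ i → f P * ∑ (allFin r) (λ j → 𝟙 (mem₀ (P , i) j u))) ≤ f P * 𝟙 (inc (line u) P)
      at P = begin
        ∑ (downFrom K) (λ i → f P * ∑ (allFin r) (λ j → 𝟙 (mem₀ (P , i) j u))) ≡⟨ ∑-*ˡ (downFrom K) (f P) _ ⟩
        f P * ∑ (downFrom K) (λ i → ∑ (allFin r) (λ j → 𝟙 (mem₀ (P , i) j u))) ≡⟨ cong (f P *_) (∑-swap (downFrom K) (allFin r) _) ⟩
        f P * ∑ (allFin r) (λ j → ∑ (downFrom K) (λ i → 𝟙 (mem₀ (P , i) j u))) ≤⟨ *-monoʳ-≤ (f P) (∑-mono (allFin r) λ j →
            ≤-trans (≤-reflexive (trans (∑-cong (downFrom K) λ i → 𝟙-∧ (class P j u) _) (∑-*ˡ (downFrom K) (𝟙 (class P j u)) _)))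
              (≤-trans (*-monoʳ-≤ (𝟙 (class P j u)) (slots≤1 P j es es-unique ρ₀ K u)) (≤-trans (≤-reflexive (*-identityʳ _)) (𝟙-mono {class P j u} λ q → proj₂ (∧-true {V u} q))))) ⟩
        f P * # (allFin r) (on u P) ≤⟨ *-monoʳ-≤ (f P) (one-colour u P) ⟩
        f P * 𝟙 (inc (line u) P) ∎

    linear : ∀ v u i → mate v u ≡ false → ∑ bs (λ b → 𝟙 (mem₀ b i v) * ∑ (allFin r) (λ j → 𝟙 (mem₀ b j u))) ≤ 1
    linear v u i nm = begin
      ∑ bs (λ b → 𝟙 (mem₀ b i v) * ∑ (allFin r) (λ j → 𝟙 (mem₀ b j u)))
        ≤⟨ ∑-mono bs (λ b → *-monoˡ-≤ _ (𝟙-mono {mem₀ b i v} λ q → proj₁ (∧-true {inc (line v) (proj₁ b)} (mem₀-on b i v q)))) ⟩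
      ∑ bs (λ b → 𝟙 (inc (line v) (proj₁ b)) * ∑ (allFin r) (λ j → 𝟙 (mem₀ b j u))) ≤⟨ block-sum u (λ P → 𝟙 (inc (line v) P)) ⟩
      ∑ pts (λ P → 𝟙 (inc (line v) P) * 𝟙 (inc (line u) P)) ≡⟨ ∑-cong pts (λ P → sym (𝟙-∧ (inc (line v) P) _)) ⟩
      # pts (λ P → inc (line v) P ∧ inc (line u) P) ≤⟨ #≤1 np _ (λ P Q a b → meet (line v) (line u) P Q
          (λ e → true≢false (does-true (line u Fin.≟ line v) (sym e)) nm)
          (proj₁ (∧-true {inc (line v) P} a)) (proj₂ (∧-true {inc (line v) P} a)) (proj₁ (∧-true {inc (line v) Q} b)) (proj₂ (∧-true {inc (line v) Q} b))) ⟩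
      1 ∎
      where open ≤-Reasoning

    size₀ : ∀ b → ∑ (allFin r) (λ j → # es (mem₀ b j)) ≤ ρ* * ω
    size₀ (P , i) = begin
      ∑ (allFin r) (λ j → # es (mem₀ (P , i) j)) ≤⟨ ∑-mono (allFin r) (λ j → chunk≤ P j es es-unique ρ₀ i) ⟩
      ∑ (allFin r) (λ _ → ρ₀) ≡⟨ trans (∑-const (allFin r) ρ₀) (cong (_* ρ₀) (length-allFin r)) ⟩
      r * (4 ^ k * ρ*) ≡⟨ lem r (4 ^ k) ρ* ⟩
      ρ* * ω ∎
      where
      open ≤-Reasoning
      lem : ∀ a b c → a * (b * c) ≡ c * (a * b)
      lem = solve-∀

    m-large′ : 4 * N ≤ m * z * ρ*
    m-large′ = begin
      4 * N ≤⟨ *-monoʳ-≤ 4 N≤2Πρ* ⟩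
      4 * (2 * Π * ρ*) ≡⟨ lem Π ρ* ⟩
      8 * Π * ρ* ≤⟨ *-monoˡ-≤ ρ* m-large ⟩
      m * z * ρ* ∎
      where
      open ≤-Reasoning
      lem : ∀ a b → 4 * (2 * a * b) ≡ 8 * a * b
      lem = solve-∀

    open Batches n h Y Indep r on pat (λ γ fr → fr) bs proj₁ mem₀ mem₀-on es ∈es
      (λ X → sym (∑-× (allFin n) (allFin h) _)) mate linear ρ* ω t m z w refl refl ρ*>0 ω>0 t>0
      (λ v → ≤-trans (mates≤R v) R≤ρ*) V mem₀-V size₀ m-large′ using (State; Full; Shrunk; _⊂V; round)

    initial : ∀ U → State k [] d U A₀ mem₀
    initial U = record
      { sub = λ b j u q → q
      ; chain = λ b _ → [] , empty U , []
      ; rich = λ { (P , i) q j → ≤-reflexive (sym (chunk-full P j es es-unique ρ₀ i (≤-trans (true-≤ᵇ (suc i * ρ₀) (least P) q) (w≤class P j)))) }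
      ; deg = λ u → ≤-trans (∑-mono bs λ b → *-monoˡ-≤ _ (𝟙≤1 (A₀ b)))
          (≤-trans (block-sum u (λ _ → 1)) (≤-trans (≤-reflexive (∑-cong pts λ P → *-identityˡ _)) (≤-trans (short (line u)) degree)))
      }
      where
      empty : ∀ (U : List Elt) → [] ⊆ U
      empty [] = []
      empty (u ∷ U) = u ∷ʳ empty U

    enough : ∑ pts least ≤ np * ρ₀ + # bs A₀ * ρ₀
    enough = begin
      ∑ pts least ≤⟨ ∑-mono pts (λ P → full-slots K ρ₀ (least P) (≤-trans (#≤length es (class P (rare P))) (m≤m*n K ρ₀ {{>-nonZero (≤-trans ρ*>0 (m≤n*m ρ* (4 ^ k) {{m^n≢0 4 k}}))}}))) ⟩
      ∑ pts (λ P → ρ₀ + # (downFrom K) (λ i → A₀ (P , i)) * ρ₀) ≡⟨ trans (∑-+ pts _ _) (cong₂ _+_ (trans (∑-const pts ρ₀) (cong (_* ρ₀) (length-allFin np))) (trans (∑-*ʳ pts ρ₀ _) (cong (_* ρ₀) (sym (∑-× pts (downFrom K) _))))) ⟩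
      np * ρ₀ + # bs A₀ * ρ₀ ∎
      where open ≤-Reasoning

    full : Full k A₀
    full = *-cancelˡ-≤ (2 * Π) {{m*n≢0 2 Π}} (+-cancelˡ-≤ (2 * np * 4 ^ k * N) _ _ (begin
      2 * np * 4 ^ k * N + 2 * Π * (N * (4 * z ^ k)) ≡⟨ lem₁ np (4 ^ k) N Π (z ^ k) ⟩
      N * (2 * np * 4 ^ k + 8 * z ^ k * Π) ≤⟨ *-monoʳ-≤ N hits-large ⟩
      N * (H * Π) ≡⟨ lem₂ N H Π ⟩
      Π * (H * N) ≤⟨ *-monoʳ-≤ Π (supersaturation H e lines-long large) ⟩
      Π * (2 * ∑ pts least) ≤⟨ *-monoʳ-≤ Π (*-monoʳ-≤ 2 enough) ⟩
      Π * (2 * (np * ρ₀ + # bs A₀ * ρ₀)) ≡⟨ lem₃ Π np (4 ^ k) ρ* (# bs A₀) ⟩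
      2 * np * 4 ^ k * (ρ* * Π) + 2 * Π * (# bs A₀ * ρ₀) ≤⟨ +-monoˡ-≤ _ (*-monoʳ-≤ (2 * np * 4 ^ k) ρ*Π≤N) ⟩
      2 * np * 4 ^ k * N + 2 * Π * (# bs A₀ * ρ₀) ∎))
      where
      open ≤-Reasoning
      lem₁ : ∀ np f N Π Z → 2 * np * f * N + 2 * Π * (N * (4 * Z)) ≡ N * (2 * np * f + 8 * Z * Π)
      lem₁ = solve-∀
      lem₂ : ∀ N H Π → N * (H * Π) ≡ Π * (H * N)
      lem₂ = solve-∀
      lem₃ : ∀ Π np f ρ a → Π * (2 * (np * (f * ρ) + a * (f * ρ))) ≡ 2 * np * f * (ρ * Π) + 2 * Π * (a * (f * ρ))
      lem₃ = solve-∀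
      large : 2 * (n * g * R) ≤ N * 2 ^ e
      large = begin
        2 * (n * g * R) ≡⟨ sym (*-assoc 2 (n * g) R) ⟩
        2 * (n * g) * R ≤⟨ *-monoˡ-≤ R few-lines ⟩
        Π * 2 ^ e * R ≡⟨ lem₅ Π (2 ^ e) R ⟩
        Π * R * 2 ^ e ≤⟨ *-monoˡ-≤ (2 ^ e) Y≤N ⟩
        N * 2 ^ e ∎
        where
        lem₅ : ∀ a b c → a * b * c ≡ a * c * b
        lem₅ = solve-∀

    one-round : ∀ b₀ U → (∀ U X → N + κ * ∣ X ∣ₑ ≤ κ * N → Cov b₀ U X) → Cov (k * m + b₀) U V
    one-round b₀ U cont = round (reverse pat) [] k (trans (ListP.length-reverse pat) pat-length)
      (trans (ListP.ʳ++-defn (reverse pat)) (trans (ListP.++-identityʳ _) (ListP.reverse-involutive pat))) κ d b₀ d>0 ≤-refl U V A₀ mem₀ (λ u q → q)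
      (initial U) full (λ U X _ sh → cont U X sh)

  halving : ∀ i B b₀ U X → 2 * κ * ∣ X ∣ₑ ≤ κ * B + i * B → (∀ U X → 2 * ∣ X ∣ₑ ≤ B → Cov b₀ U X) →
    Cov (i * (k * m) + b₀) U X
  halving zero B b₀ U X le cont = cont U X (*-cancelˡ-≤ κ {{>-nonZero κ>0}} (begin
    κ * (2 * ∣ X ∣ₑ) ≡⟨ lem κ ∣ X ∣ₑ ⟩
    2 * κ * ∣ X ∣ₑ ≤⟨ le ⟩
    κ * B + 0 ≡⟨ +-identityʳ _ ⟩
    κ * B ∎))
    where
    open ≤-Reasoning
    lem : ∀ a b → a * (2 * b) ≡ 2 * a * b
    lem = solve-∀
  halving (suc i) B b₀ U X le cont with ∣ X ∣ₑ ≤? Y | 2 * ∣ X ∣ₑ ≤? B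
  ... | yes small | _ = leaf small
  ... | no _ | yes half = weaken* (suc i * (k * m)) (cont U X half)
  ... | no Y< | no B< = subst (λ b → Cov b U X) (sym (+-assoc (k * m) (i * (k * m)) b₀))
      (Round.one-round X Y≤N (i * (k * m) + b₀) U λ U' X' sh → halving i B b₀ U' X' (next X' sh) cont)
    where
    open ≤-Reasoning
    ∣X∣≡ : ∣ X ∣ₑ ≡ # es X
    ∣X∣≡ = sym (∑-× (allFin n) (allFin h) _)
    Y≤N : Y ≤ # es X
    Y≤N = subst (Y ≤_) ∣X∣≡ (<⇒≤ (≰⇒> Y<))
    lem₁ : ∀ a b c → 2 * a * b + 2 * c ≡ 2 * (c + a * b)
    lem₁ = solve-∀
    lem₂ : ∀ a b → 2 * (a * b) ≡ 2 * a * b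
    lem₂ = solve-∀
    lem₃ : ∀ a B i → a + (B + i) ≡ a + i + B
    lem₃ = solve-∀
    next : ∀ X' → # es X + κ * ∣ X' ∣ₑ ≤ κ * # es X → 2 * κ * ∣ X' ∣ₑ ≤ κ * B + i * B
    next X' sh = +-cancelʳ-≤ B _ _ (begin
      2 * κ * ∣ X' ∣ₑ + B ≤⟨ +-monoʳ-≤ _ (<⇒≤ (≰⇒> B<)) ⟩
      2 * κ * ∣ X' ∣ₑ + 2 * ∣ X ∣ₑ ≡⟨ lem₁ κ ∣ X' ∣ₑ ∣ X ∣ₑ ⟩
      2 * (∣ X ∣ₑ + κ * ∣ X' ∣ₑ) ≤⟨ *-monoʳ-≤ 2 (subst (λ N → N + κ * ∣ X' ∣ₑ ≤ κ * N) (sym ∣X∣≡) sh) ⟩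
      2 * (κ * ∣ X ∣ₑ) ≡⟨ lem₂ κ ∣ X ∣ₑ ⟩
      2 * κ * ∣ X ∣ₑ ≤⟨ le ⟩
      κ * B + (B + i * B) ≡⟨ lem₃ (κ * B) B (i * B) ⟩
      κ * B + i * B + B ∎)

  containers : ∀ G U X → ∣ X ∣ₑ ≤ 2 ^ G * Y → Cov (G * (κ * (k * m))) U X
  containers zero U X le = leaf (≤-trans le (≤-reflexive (*-identityˡ Y)))
  containers (suc G) U X le = halving κ (2 ^ suc G * Y) (G * (κ * (k * m))) U X (begin
      2 * κ * ∣ X ∣ₑ ≤⟨ *-monoʳ-≤ (2 * κ) le ⟩
      2 * κ * (2 ^ suc G * Y) ≡⟨ lem κ (2 ^ suc G * Y) ⟩
      κ * (2 ^ suc G * Y) + κ * (2 ^ suc G * Y) ∎)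
    (λ U X half → containers G U X (*-cancelˡ-≤ 2 (≤-trans half (≤-reflexive (*-assoc 2 (2 ^ G) Y)))))
    where
    open ≤-Reasoning
    lem : ∀ a b → 2 * a * b ≡ a * b + a * b
    lem = solve-∀

self-power≤ : ∀ T → T ^ T ≤ 4 ^ T * T !
self-power≤ T = *-cancelˡ-≤ (T !) {{>-nonZero (1≤n! T)}} (≤-trans (lower T) (≤-trans (upper T) (≤-reflexive (lem (4 ^ T) (T !)))))
  where
  lem : ∀ a f → a * (f * f) ≡ f * (a * f)
  lem = solve-∀
  lower : ∀ j → T ! * T ^ j ≤ (T + j) !
  lower zero = ≤-reflexive (trans (*-identityʳ _) (cong _! (sym (+-identityʳ T))))
  lower (suc j) rewrite +-suc T j = ≤-trans (≤-reflexive (lem₂ (T !) T (T ^ j))) (*-mono-≤ (≤-trans (m≤m+n T j) (n≤1+n _)) (lower j))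
    where
    lem₂ : ∀ f t p → f * (t * p) ≡ t * (f * p)
    lem₂ = solve-∀
  upper : ∀ h → (h + h) ! ≤ 4 ^ h * (h ! * h !)
  upper zero = ≤-refl
  upper (suc h) rewrite +-suc h h = begin
    (2 + (h + h)) * (suc (h + h) * (h + h) !) ≡⟨ sym (*-assoc (2 + (h + h)) (suc (h + h)) _) ⟩
    (2 + (h + h)) * suc (h + h) * (h + h) ! ≤⟨ *-mono-≤ (≤-trans (m≤m+n _ (2 * suc h)) (≤-reflexive (lem₄ h))) (upper h) ⟩
    4 * (suc h * suc h) * (4 ^ h * (h ! * h !)) ≡⟨ lem₃ (4 ^ h) h (h !) ⟩
    4 * 4 ^ h * (suc h * h ! * (suc h * h !)) ∎
    where
    open ≤-Reasoning
    lem₃ : ∀ a h f → 4 * ((1 + h) * (1 + h)) * (a * (f * f)) ≡ 4 * a * ((1 + h) * f * ((1 + h) * f))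
    lem₃ = solve-∀
    lem₄ : ∀ h → (2 + (h + h)) * (1 + (h + h)) + 2 * (1 + h) ≡ 4 * ((1 + h) * (1 + h))
    lem₄ = solve-∀

-- Each point lies on at most r of the more than r + 1 lines, since the colours there are distinct, so
-- enough lines avoid any given point to build an O'Nan configuration.
module Clique (p : ℕ) (Geo : Geometry p) (r m : ℕ) (r<m : r < m) (2≤r : 2 ≤ r)
  (L : Fin (suc m) → Fin (Geometry.lines Geo)) (c : Fin (suc m) → Fin (p * (p * p)) → Fin r)
  (L-inj : ∀ a b → a ≢ b → L a ≢ L b)
  (adjacent : ∀ a b → a ≢ b → ∃ λ P → Geometry.inc Geo (L a) P ≡ true × Geometry.inc Geo (L b) P ≡ true × c a P ≢ c b P)
  where
  open Geometry Geo

  _⟋_ : Fin (suc m) → Fin (p * (p * p)) → Bool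
  a ⟋ P = inc (L a) P

  off : ∀ P a₀ → ∃ λ b → b ≢ a₀ × b ⟋ P ≡ false
  off P a₀ with FinP.any? (λ i → (Fin.punchIn a₀ i ⟋ P) BoolP.≟ false)
  ... | yes (i , e) = Fin.punchIn a₀ i , FinP.punchInᵢ≢i a₀ i , e
  ... | no none with FinP.pigeonhole r<m (λ i → c (Fin.punchIn a₀ i) P)
  ... | i , j , i<j , same = ⊥-elim (differ (adjacent _ _ a≢b))
    where
    a≢b : Fin.punchIn a₀ i ≢ Fin.punchIn a₀ j
    a≢b e = FinP.<⇒≢ i<j (FinP.punchIn-injective a₀ i j e)
    through : ∀ i → Fin.punchIn a₀ i ⟋ P ≡ true
    through i with bool-cases (Fin.punchIn a₀ i ⟋ P)
    ... | inj₁ t = t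
    ... | inj₂ f = ⊥-elim (none (i , f))
    differ : (∃ λ Q → Fin.punchIn a₀ i ⟋ Q ≡ true × Fin.punchIn a₀ j ⟋ Q ≡ true × c (Fin.punchIn a₀ i) Q ≢ c (Fin.punchIn a₀ j) Q) → ⊥
    differ (Q , iQ , jQ , ne) = ne (subst (λ Q → c (Fin.punchIn a₀ i) Q ≡ c (Fin.punchIn a₀ j) Q)
      (meet _ _ P Q (L-inj _ _ a≢b) (through i) (through j) iQ jQ) same)

  separate : ∀ {a b P} → a ⟋ P ≡ true → b ⟋ P ≡ false → a ≢ b
  separate aP bP refl = true≢false aP bP

  same-point : ∀ a b P Q → a ≢ b → a ⟋ P ≡ true → b ⟋ P ≡ true → a ⟋ Q ≡ true → b ⟋ Q ≡ true → P ≡ Q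
  same-point a b P Q a≢b = meet (L a) (L b) P Q (L-inj a b a≢b)

  concurrent : ∀ a₁ a₂ a₃ a₄ P Q → a₁ ≢ a₂ → a₃ ≢ a₄ → a₁ ⟋ P ≡ true → a₂ ⟋ P ≡ true → a₃ ⟋ P ≡ false → a₄ ⟋ P ≡ false →
    a₃ ⟋ Q ≡ true → a₄ ⟋ Q ≡ true → a₁ ⟋ Q ≡ false → a₂ ⟋ Q ≡ true
  concurrent a₁ a₂ a₃ a₄ P Q a₁≢a₂ a₃≢a₄ 1P 2P 3P 4P 3Q 4Q 1Q with bool-cases (a₂ ⟋ Q)
  ... | inj₁ t = t
  ... | inj₂ 2Q with adjacent a₁ a₃ (separate 1P 3P) | adjacent a₁ a₄ (separate 1P 4P) | adjacent a₂ a₃ (separate 2P 3P) | adjacent a₂ a₄ (separate 2P 4P)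
  ... | P₁₃ , a , b , _ | P₁₄ , c , d , _ | P₂₃ , e , f , _ | P₂₄ , g , h , _ =
    ⊥-elim (onan (L a₁) (L a₂) (L a₃) (L a₄) P P₁₃ P₁₄ P₂₃ P₂₄ Q (L-inj a₁ a₂ a₁≢a₂) (L-inj a₃ a₄ a₃≢a₄) 1P 2P a b c d e f g h 3Q 4Q 3P 4P 1Q 2Q)

  fifth : ∀ a₁ a₂ a₃ a₄ P Q → a₁ ≢ a₂ → a₃ ≢ a₄ → a₁ ⟋ P ≡ true → a₂ ⟋ P ≡ true → a₃ ⟋ P ≡ false → a₄ ⟋ P ≡ false →
    a₃ ⟋ Q ≡ true → a₄ ⟋ Q ≡ true → a₁ ⟋ Q ≡ true → ⊥
  fifth a₁ a₂ a₃ a₄ P Q a₁≢a₂ a₃≢a₄ 1P 2P 3P 4P 3Q 4Q 1Q with off Q a₂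
  ... | a₅ , a₅≢a₂ , 5Q with bool-cases (a₅ ⟋ P)
  ... | inj₁ 5P = true≢false (concurrent a₅ a₂ a₃ a₄ P Q a₅≢a₂ a₃≢a₄ 5P 2P 3P 4P 3Q 4Q 5Q) 2Q
    where
    2Q : a₂ ⟋ Q ≡ false
    2Q = ¬true⇒false λ t → true≢false (subst (λ R → a₃ ⟋ R ≡ true) (same-point a₁ a₂ Q P a₁≢a₂ 1Q t 1P 2P) 3Q) 3P
  ... | inj₂ 5P = meets (adjacent a₃ a₅ (separate 3Q 5Q)) (adjacent a₄ a₅ (separate 4Q 5Q))
    where
    2Q : a₂ ⟋ Q ≡ false
    2Q = ¬true⇒false λ t → true≢false (subst (λ R → a₃ ⟋ R ≡ true) (same-point a₁ a₂ Q P a₁≢a₂ 1Q t 1P 2P) 3Q) 3P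
    on-2 : ∀ a R → a ⟋ Q ≡ true → a ⟋ P ≡ false → a ⟋ R ≡ true → a₅ ⟋ R ≡ true → a₂ ⟋ R ≡ true
    on-2 a R aQ aP aR 5R = concurrent a₁ a₂ a a₅ P R a₁≢a₂ (separate aQ 5Q) 1P 2P aP 5P aR 5R
      (¬true⇒false λ t → true≢false (subst (λ S → a₅ ⟋ S ≡ true) (same-point a₁ a R Q (separate 1P aP) t aR 1Q aQ) 5R) 5Q)
    meets : (∃ λ R → a₃ ⟋ R ≡ true × a₅ ⟋ R ≡ true × c a₃ R ≢ c a₅ R) → (∃ λ R → a₄ ⟋ R ≡ true × a₅ ⟋ R ≡ true × c a₄ R ≢ c a₅ R) → ⊥
    meets (R , 3R , 5R , _) (R' , 4R' , 5R' , _) = true≢false (subst (λ S → a₂ ⟋ S ≡ true) R≡Q (on-2 a₃ R 3Q 3P 3R 5R)) 2Q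
      where
      R≡R' : R ≡ R'
      R≡R' = same-point a₅ a₂ R R' a₅≢a₂ 5R (on-2 a₃ R 3Q 3P 3R 5R) 5R' (on-2 a₄ R' 4Q 4P 4R' 5R')
      R≡Q : R ≡ Q
      R≡Q = same-point a₃ a₄ R Q a₃≢a₄ 3R (subst (λ S → a₄ ⟋ S ≡ true) (sym R≡R') 4R') 3Q 4Q

  no-clique : ⊥
  no-clique = start zero other (λ ())
    where
    other : Fin (suc m)
    other = Fin.fromℕ< (s≤s (≤-trans (s≤s z≤n) (≤-trans 2≤r (<⇒≤ r<m))))
    start : ∀ a₁ a₂ → a₁ ≢ a₂ → ⊥
    start a₁ a₂ a₁≢a₂ with adjacent a₁ a₂ a₁≢a₂
    ... | P , 1P , 2P , _ with off P a₁
    ... | a₃ , _ , 3P with off P a₃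
    ... | a₄ , a₄≢a₃ , 4P with adjacent a₃ a₄ (a₄≢a₃ ∘ sym)
    ... | Q , 3Q , 4Q , _ with bool-cases (a₁ ⟋ Q)
    ... | inj₁ 1Q = fifth a₁ a₂ a₃ a₄ P Q a₁≢a₂ (a₄≢a₃ ∘ sym) 1P 2P 3P 4P 3Q 4Q 1Q
    ... | inj₂ 1Q = fifth a₂ a₁ a₃ a₄ P Q (a₁≢a₂ ∘ sym) (a₄≢a₃ ∘ sym) 2P 1P 3P 4P 3Q 4Q
          (concurrent a₁ a₂ a₃ a₄ P Q a₁≢a₂ (a₄≢a₃ ∘ sym) 1P 2P 3P 4P 3Q 4Q 1Q)

MVertex : (r : ℕ) → (Fin r → ℕ) → Set
MVertex r s = Σ (Fin r) (λ i → Fin (s i))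

mvertices : ∀ r s → List (MVertex r s)
mvertices zero s = []
mvertices (suc r) s = map (zero ,_) (allFin (s zero)) ++ map (λ { (i , k) → suc i , k }) (mvertices r (s ∘ suc))

∈mvertices : ∀ r s w → w ∈ mvertices r s
∈mvertices (suc r) s (zero , k) = ∈P.∈-++⁺ˡ (∈P.∈-map⁺ (zero ,_) (∈-allFin k))
∈mvertices (suc r) s (suc i , k) = ∈P.∈-++⁺ʳ (map (zero ,_) (allFin (s zero))) (∈P.∈-map⁺ (λ { (i , k) → suc i , k }) (∈mvertices r (s ∘ suc) (i , k)))

length-mvertices : ∀ r s → length (mvertices r s) ≡ sumFin r s
length-mvertices zero s = refl
length-mvertices (suc r) s = trans (ListP.length-++ (map (zero ,_) (allFin (s zero))))
  (cong₂ _+_ (trans (ListP.length-map _ (allFin (s zero))) (length-allFin (s zero)))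
    (trans (ListP.length-map _ (mvertices r (s ∘ suc))) (length-mvertices r (s ∘ suc))))

colour-pattern : ∀ r → (Fin r → ℕ) → List (Fin r)
colour-pattern r s = map proj₁ (mvertices r s)

partner : ∀ {U W C : Set} {Q : U → C → Set} {f : W → C} {us ws} → Pointwise Q us (map f ws) → ∀ {w} → w ∈ ws → ∃ λ u → u ∈ us × Q u (f w)
partner {us = u ∷ us} {w ∷ ws} (q ∷ pw) (here refl) = u , here refl , q
partner {us = u ∷ us} {w ∷ ws} (q ∷ pw) (there m) = let v , v∈ , q' = partner pw m in v , there v∈ , q'

partner-injective : ∀ {U W C X : Set} {Q : U → C → Set} {f : W → C} {us ws} (key : U → X) (pw : Pointwise Q us (map f ws)) →
  AllPairs (λ u v → key u ≢ key v) us → ∀ {w w'} (a : w ∈ ws) (b : w' ∈ ws) →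
  key (proj₁ (partner {f = f} pw a)) ≡ key (proj₁ (partner {f = f} pw b)) → w ≡ w'
partner-injective {us = u ∷ us} {w ∷ ws} key (q ∷ pw) (un ∷ uns) (here refl) (here refl) e = refl
partner-injective {us = u ∷ us} {w ∷ ws} key (q ∷ pw) (un ∷ uns) (here refl) (there b) e = ⊥-elim (All.lookup un (proj₁ (proj₂ (partner pw b))) e)
partner-injective {us = u ∷ us} {w ∷ ws} key (q ∷ pw) (un ∷ uns) (there a) (here refl) e = ⊥-elim (All.lookup un (proj₁ (proj₂ (partner pw a))) (sym e))
partner-injective {us = u ∷ us} {w ∷ ws} key (q ∷ pw) (un ∷ uns) (there a) (there b) e = partner-injective key pw uns a b e

trim : ∀ {n} (s : Subset n) T → T ≤ ∣ s ∣ → ∃ λ (s' : Subset n) → ∣ s' ∣ ≡ T × (∀ i → lookup s' i ≡ true → lookup s i ≡ true)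
trim [] zero _ = [] , refl , λ ()
trim (false ∷ s) T T≤ with trim s T T≤
... | s' , e , sub = false ∷ s' , e , λ { zero () ; (suc i) q → sub i q }
trim (true ∷ s) (suc T) (s≤s T≤) with trim s T T≤
... | s' , e , sub = true ∷ s' , cong suc e , λ { zero q → refl ; (suc i) q → sub i q }
trim (true ∷ s) zero T≤ with trim s zero z≤n
... | s' , e , sub = false ∷ s' , e , λ { zero () ; (suc i) q → sub i q }

module Sampled (p : ℕ) (Geo : Geometry p) (r : ℕ) (r>0 : 1 ≤ r) (n g : ℕ) (ng≤ : n * g ≤ Geometry.lines Geo)
  (f : Vec (Fin (Space.h p Geo r r>0 n g ng≤)) n) where
  open Space p Geo r r>0 n g ng≤
  open Geometry Geo

  elt : Fin n → Elt
  elt i = i , lookup f i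

  clash : Fin n → Fin n → Fin np → Bool
  clash i j P = (inc (line (elt i)) P ∧ inc (line (elt j)) P) ∧ not (does (col (elt i) P Fin.≟ col (elt j) P))

  clash-sym : ∀ i j P → clash i j P ≡ clash j i P
  clash-sym i j P = cong₂ _∧_ (BoolP.∧-comm (inc (line (elt i)) P) _) (cong not (does-sym (col (elt i) P) (col (elt j) P)))
    where
    does-sym : ∀ {r} (a b : Fin r) → does (a Fin.≟ b) ≡ does (b Fin.≟ a)
    does-sym a b with a Fin.≟ b
    ... | yes refl = sym (does-true (a Fin.≟ a) refl)
    ... | no a≢b = sym (does-false (b Fin.≟ a) (a≢b ∘ sym))

  graph : Graph (Fin n)
  graph = record
    { adj = λ i j → 1 ≤ᵇ # pts (clash i j)
    ; adj-sym = λ i j → cong (1 ≤ᵇ_) (∑-cong pts λ P → cong 𝟙 (clash-sym i j P))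
    ; adj-irrefl = λ i → cong (1 ≤ᵇ_) (∑-zero pts λ P → cong 𝟙 (irr i P)) }
    where
    irr : ∀ i P → clash i i P ≡ false
    irr i P = trans (cong (λ b → (inc (line (elt i)) P ∧ inc (line (elt i)) P) ∧ not b) (does-true (col (elt i) P Fin.≟ col (elt i) P) refl)) (BoolP.∧-zeroʳ _)

  adj-point : ∀ i j → adj graph i j ≡ true → ∃ λ P → inc (line (elt i)) P ≡ true × inc (line (elt j)) P ≡ true × col (elt i) P ≢ col (elt j) P
  adj-point i j e with ∑-<⇒∃ pts (λ _ → 0) (𝟙 ∘ clash i j) (≤-trans (≤-reflexive (cong suc (∑-zero pts λ _ → refl))) (true-≤ᵇ 1 _ e))
  ... | P , _ , lt with bool-cases (clash i j P)
  ... | inj₂ f = ⊥-elim (<⇒≢ lt (sym (cong 𝟙 f)))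
  ... | inj₁ t = P , proj₁ (∧-true (proj₁ both)) , proj₂ (∧-true {inc (line (elt i)) P} (proj₁ both)) ,
        λ q → true≢false (does-true (col (elt i) P Fin.≟ col (elt j) P) q) (not-true (proj₂ both))
    where both = ∧-true {inc (line (elt i)) P ∧ inc (line (elt j)) P} t

  point-adj : ∀ i j P → inc (line (elt i)) P ≡ true → inc (line (elt j)) P ≡ true → col (elt i) P ≢ col (elt j) P → adj graph i j ≡ true
  point-adj i j P a b ne = ≤ᵇ-true (≤-trans (≤-reflexive (sym (cong 𝟙 (∧-intro (∧-intro a b) (cong not (does-false (col (elt i) P Fin.≟ col (elt j) P) ne)))))) (∑-∈ (𝟙 ∘ clash i j) (∈-allFin P)))

  clique-free : 2 ≤ r → Free (complete (r + 2)) graph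
  clique-free 2≤r S (φ , φ-inj , _ , φ-adj) = go (r + 2) ≤-refl φ φ-inj φ-adj
    where
    go : ∀ k → r + 2 ≤ k → (φ : Fin k → Fin n) → Injective _≡_ _≡_ φ → (∀ a b → adj (complete k) a b ≡ true → adj graph (φ a) (φ b) ≡ true) → ⊥
    go zero le _ _ _ = <⇒≱ (≤-trans (s≤s z≤n) (≤-trans (m≤n+m 2 r) le)) z≤n
    go (suc m) le φ φ-inj φ-adj = Clique.no-clique p Geo r m (≤-pred (≤-trans (≤-reflexive (+-comm 2 r)) le)) 2≤r
      (λ a → line (elt (φ a))) (λ a → col (elt (φ a)))
      (λ a b a≢b e → a≢b (φ-inj (line-group (elt (φ a)) (elt (φ b)) e)))
      (λ a b a≢b → adj-point (φ a) (φ b) (φ-adj a b (cong not (trans (isYes≗does (a Fin.≟ b)) (does-false (a Fin.≟ b) a≢b)))))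

  independent-free : ∀ s S → FIndependent (completeMultipartite r s) graph S → ∀ P us →
    Pointwise (λ u j → on u P j ≡ true) us (colour-pattern r s) → All (restrict f S ∋_) us →
    AllPairs (λ u v → proj₁ u ≢ proj₁ v) us → ⊥
  independent-free s S indep P us pw all-∋ apart = indep (φ , inj , inS , hom)
    where
    at : ∀ w → ∃ λ u → u ∈ us × on u P (proj₁ w) ≡ true
    at w = partner pw (∈mvertices r s w)
    φ : MVertex r s → Fin n
    φ w = proj₁ (proj₁ (at w))
    inj : Injective _≡_ _≡_ φ
    inj {w} {w'} e = partner-injective proj₁ pw apart (∈mvertices r s w) (∈mvertices r s w') e
    here-f : ∀ w → lookup S (φ w) ≡ true × lookup f (φ w) ≡ proj₂ (proj₁ (at w))
    here-f w = restrict-∋ f S (All.lookup all-∋ (proj₁ (proj₂ (at w))))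
    inS : ∀ w → φ w Subset.∈ S
    inS w = VecP.lookup⇒[]= (φ w) S (proj₁ (here-f w))
    on-elt : ∀ w → on (elt (φ w)) P (proj₁ w) ≡ true
    on-elt w = subst (λ x → on (φ w , x) P (proj₁ w) ≡ true) (sym (proj₂ (here-f w))) (proj₂ (proj₂ (at w)))
    hom : ∀ u v → adj (completeMultipartite r s) u v ≡ true → adj graph (φ u) (φ v) ≡ true
    hom u v e = point-adj (φ u) (φ v) P (proj₁ (∧-true {inc (line (elt (φ u))) P} (on-elt u))) (proj₁ (∧-true {inc (line (elt (φ v))) P} (on-elt v)))
      λ same → true≢false (trans (isYes≗does (proj₁ u Fin.≟ proj₁ v)) (does-true (proj₁ u Fin.≟ proj₁ v) (trans (sym (colour u)) (trans same (colour v))))) (not-true e)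
      where
      colour : ∀ w → col (elt (φ w)) P ≡ proj₁ w
      colour w = true-does (col (elt (φ w)) P Fin.≟ proj₁ w) (proj₂ (∧-true {inc (line (elt (φ w))) P} (on-elt w)))

few-free-functions : ∀ S Y b nh T h G → 1 ≤ Y → nh ≤ 2 ^ G * Y → 8 * Y ≤ h * T → (1 + 2 ^ G * T) ^ b < 2 ^ T →
  S * T ! * Y ^ b ≤ Y ^ T * (Y + nh * T) ^ b → S < h ^ T
few-free-functions S Y b nh T h G Y>0 nh≤ hT large bound = *-cancelʳ-< (T ! * Y ^ b) S (h ^ T) (begin-strict
    S * (T ! * Y ^ b) ≡⟨ sym (*-assoc S (T !) (Y ^ b)) ⟩
    S * T ! * Y ^ b ≤⟨ bound ⟩
    Y ^ T * (Y + nh * T) ^ b ≤⟨ *-monoʳ-≤ (Y ^ T) (^-monoˡ-≤ b (≤-trans (+-monoʳ-≤ Y (*-monoˡ-≤ T nh≤)) (≤-reflexive (lem₁ Y (2 ^ G) T)))) ⟩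
    Y ^ T * (Y * (1 + 2 ^ G * T)) ^ b ≡⟨ cong (Y ^ T *_) (^-distribʳ-* b Y (1 + 2 ^ G * T)) ⟩
    Y ^ T * (Y ^ b * (1 + 2 ^ G * T) ^ b) <⟨ *-monoʳ-< (Y ^ T) {{m^n≢0 Y T {{Y≢0}}}} (*-monoʳ-< (Y ^ b) {{m^n≢0 Y b {{Y≢0}}}} large) ⟩
    Y ^ T * (Y ^ b * 2 ^ T) ≡⟨ lem₂ (Y ^ T) (Y ^ b) (2 ^ T) ⟩
    2 ^ T * Y ^ T * Y ^ b ≤⟨ *-monoˡ-≤ (Y ^ b) 2Y ⟩
    h ^ T * T ! * Y ^ b ≡⟨ *-assoc (h ^ T) (T !) (Y ^ b) ⟩
    h ^ T * (T ! * Y ^ b) ∎)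
  where
  open ≤-Reasoning
  Y≢0 : NonZero Y
  Y≢0 = >-nonZero Y>0
  lem₁ : ∀ Y a T → Y + a * Y * T ≡ Y * (1 + a * T)
  lem₁ = solve-∀
  lem₂ : ∀ a b c → a * (b * c) ≡ c * a * b
  lem₂ = solve-∀
  lem₃ : ∀ a b c → a * (b * c) ≡ a * b * c
  lem₃ = solve-∀
  lem₄ : ∀ a b c → a * (b * c) ≡ b * (a * c)
  lem₄ = solve-∀
  2Y : 2 ^ T * Y ^ T ≤ h ^ T * T !
  2Y = *-cancelˡ-≤ (4 ^ T) {{m^n≢0 4 T}} (begin
    4 ^ T * (2 ^ T * Y ^ T) ≡⟨ lem₃ (4 ^ T) (2 ^ T) (Y ^ T) ⟩
    4 ^ T * 2 ^ T * Y ^ T ≡⟨ sym (trans (^-distribʳ-* T 8 Y) (cong (_* Y ^ T) (^-distribʳ-* T 4 2))) ⟩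
    (8 * Y) ^ T ≤⟨ ^-monoˡ-≤ T hT ⟩
    (h * T) ^ T ≡⟨ ^-distribʳ-* T h T ⟩
    h ^ T * T ^ T ≤⟨ *-monoʳ-≤ (h ^ T) (self-power≤ T) ⟩
    h ^ T * (4 ^ T * T !) ≡⟨ lem₄ (h ^ T) (4 ^ T) (T !) ⟩
    4 ^ T * (h ^ T * T !) ∎)

module Assembly (p : ℕ) (Geo : Geometry p) (r : ℕ) (2≤r : 2 ≤ r) (s : Fin r → ℕ) (n g : ℕ) (ng≤ : n * g ≤ Geometry.lines Geo)
  (k : ℕ) (s≡ : sumFin r s ≡ suc k) (Π t m d H e : ℕ)
  (Π>0 : 1 ≤ Π) (t>0 : 1 ≤ t) (d>0 : 1 ≤ d)
  (few-lines : 2 * (n * g) ≤ Π * 2 ^ e)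
  (hits-large : 2 * (p * (p * p)) * 4 ^ k + 8 * (32 * t) ^ k * Π ≤ H * Π)
  (degree : 2 * p ≤ d * (32 * t) ^ k)
  (lines-long : ∀ ℓ → 2 * r * (H + e) ≤ # (allFin (p * (p * p))) (Geometry.inc Geo ℓ))
  (m-large : 8 * Π ≤ m * (32 * t))
  where

  r>0 : 1 ≤ r
  r>0 = ≤-trans (s≤s z≤n) 2≤r

  module C = Containers p Geo r r>0 n g ng≤ (colour-pattern r s) k
    (trans (ListP.length-map proj₁ (mvertices r s)) (trans (length-mvertices r s) s≡))
    Π t m d H e Π>0 t>0 d>0 few-lines hits-large degree lines-long m-large
  open Space p Geo r r>0 n g ng≤ using (h; R)

  steps : ℕ → ℕ
  steps G = G * (C.κ * (k * m))

  small-independent : ∀ G T → n * g ≤ 2 ^ G * Π → 8 * Π ≤ g * T → (1 + 2 ^ G * T) ^ steps G < 2 ^ T →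
    Σ (Graph (Fin n)) λ Γ → Free (complete (r + 2)) Γ ×
      (∀ S → FIndependent (completeMultipartite r s) Γ S → ∣ S ∣ < T)
  small-independent G T ng hT large = graph , clique-free 2≤r , λ S indep → ≰⇒> (λ T≤ → small S indep (trim S T T≤))
    where
    open ≤-Reasoning
    all : Fin n × Fin h → Bool
    all _ = true
    Y>0 : 1 ≤ C.Y
    Y>0 = *-mono-≤ Π>0 C.R>0
    ∣all∣ : C.∣ all ∣ₑ ≡ n * h
    ∣all∣ = trans (∑-cong (allFin n) λ i → trans (∑-const (allFin h) 1) (trans (*-identityʳ _) (length-allFin h)))
      (trans (∑-const (allFin n) h) (cong (_* h) (length-allFin n)))
    nh≤ : n * h ≤ 2 ^ G * C.Y
    nh≤ = begin
      n * (g * R) ≡⟨ sym (*-assoc n g R) ⟩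
      n * g * R ≤⟨ *-monoˡ-≤ R ng ⟩
      2 ^ G * Π * R ≡⟨ *-assoc (2 ^ G) Π R ⟩
      2 ^ G * C.Y ∎
    8Y≤ : 8 * C.Y ≤ h * T
    8Y≤ = begin
      8 * (Π * R) ≡⟨ sym (*-assoc 8 Π R) ⟩
      8 * Π * R ≤⟨ *-monoˡ-≤ R hT ⟩
      g * T * R ≡⟨ lem g T R ⟩
      h * T ∎
      where
      lem : ∀ g T R → g * T * R ≡ g * R * T
      lem = solve-∀
    h>0 : 0 < h
    h>0 = n≢0⇒n>0 λ h≡0 → <⇒≱ Y>0 (≤-trans (m≤n*m C.Y 8) (≤-trans 8Y≤ (≤-reflexive (cong (_* T) h≡0))))
    open C.Cov (C.containers G [] all (≤-trans (≤-reflexive ∣all∣) nh≤))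
    avoiding : ∃ λ f → ∀ S → ∣ S ∣ ≡ T → weight (restrict f S) ≡ 0
    avoiding = avoid-restrictions n h T weight h>0
      (few-free-functions (S n h T weight) C.Y (steps G) (n * h) T h G Y>0 nh≤ 8Y≤ large
        (subst (λ c → S n h T weight * T ! * C.Y ^ steps G ≤ C.Y ^ T * (C.Y + c * T) ^ steps G) ∣all∣ (bound T)))
    f = proj₁ avoiding
    open Sampled p Geo r r>0 n g ng≤ f using (graph; clique-free; independent-free)
    small : ∀ S → FIndependent (completeMultipartite r s) graph S →
      (∃ λ (S' : Subset n) → ∣ S' ∣ ≡ T × (∀ i → lookup S' i ≡ true → lookup S i ≡ true)) → ⊥
    small S indep (S' , size , sub) = <⇒≢ (covers (restrict f S') (∋-inside _ (restrict f S') λ _ _ _ → refl) good)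
        (sym (proj₂ avoiding S' size))
      where
      indep' : FIndependent (completeMultipartite r s) graph S'
      indep' (φ , inj , inS , hom) = indep (φ , inj , (λ w → VecP.lookup⇒[]= (φ w) S (sub (φ w) (VecP.[]=⇒lookup (inS w)))) , hom)
      good : C.Good [] (restrict f S')
      good = record { whole = restrict f S' ; free = independent-free s S' indep' ; chosen = [] ; apart = [] ; rest = λ _ q → q ; fresh = λ _ _ → [] }

least : ∀ {P : ℕ → Set} → (∀ m → Dec (P m)) → ∀ b → P b → ∃ λ m → P m × (∀ j → j < m → ¬ P j)
least {P} P? zero Pb = zero , Pb , λ _ ()
least {P} P? (suc b) Pb with P? zero
... | yes P0 = zero , P0 , λ _ ()
... | no ¬P0 with least (P? ∘ suc) b Pb
... | m , Pm , below = suc m , Pm , λ { zero _ → ¬P0 ; (suc j) (s≤s j<m) → below j j<m }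

<-div : ∀ a b .{{_ : NonZero b}} → a < suc (a / b) * b
<-div a b = ≤-trans (≤-reflexive (cong suc (m≡m%n+[m/n]*n a b))) (+-monoˡ-≤ (a / b * b) (m%n<n a b))

n<2^n : ∀ n → n < 2 ^ n
n<2^n zero = s≤s z≤n
n<2^n (suc n) = ≤-trans (+-mono-≤ (m^n>0 2 n) (n<2^n n)) (≤-reflexive (cong (2 ^ n +_) (sym (+-identityʳ (2 ^ n)))))

polynomial<exponential : ∀ C q → ∃ λ L → ∀ ℓ → L ≤ ℓ → C * ℓ ^ q < 2 ^ ℓ
polynomial<exponential C q = C * Q ^ q * Q , λ ℓ L≤ℓ → bound ℓ L≤ℓ
  where
  open ≤-Reasoning
  Q = suc q
  bound : ∀ ℓ → C * Q ^ q * Q ≤ ℓ → C * ℓ ^ q < 2 ^ ℓ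
  bound ℓ L≤ℓ = begin-strict
    C * ℓ ^ q ≤⟨ *-monoʳ-≤ C (^-monoˡ-≤ q (<⇒≤ (<-div ℓ Q))) ⟩
    C * (suc a * Q) ^ q ≡⟨ cong (C *_) (^-distribʳ-* q (suc a) Q) ⟩
    C * (suc a ^ q * Q ^ q) ≡⟨ lem C (suc a ^ q) (Q ^ q) ⟩
    C * Q ^ q * suc a ^ q <⟨ *-monoˡ-< (suc a ^ q) {{m^n≢0 (suc a) q}} (s≤s (≤-trans (≤-reflexive (sym (m*n/n≡m (C * Q ^ q) Q))) (/-monoˡ-≤ Q L≤ℓ))) ⟩
    suc a * suc a ^ q ≤⟨ ^-monoˡ-≤ Q (n<2^n a) ⟩
    (2 ^ a) ^ Q ≡⟨ ^-*-assoc 2 a Q ⟩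
    2 ^ (a * Q) ≤⟨ ^-monoʳ-≤ 2 (m/n*n≤m ℓ Q) ⟩
    2 ^ ℓ ∎
    where
    a = ℓ / Q
    lem : ∀ a b c → a * (b * c) ≡ a * c * b
    lem = solve-∀

n<2^[1+log] : ∀ n → n < 2 ^ suc ⌊log₂ n ⌋
n<2^[1+log] n = ≰⇒> λ le → <⇒≱ (n<1+n ⌊log₂ n ⌋) (subst (_≤ ⌊log₂ n ⌋) (⌊log₂[2^n]⌋≡n (suc ⌊log₂ n ⌋)) (⌊log₂⌋-mono-≤ le))

2^log≤n : ∀ n → 1 ≤ n → 2 ^ ⌊log₂ n ⌋ ≤ n
2^log≤n = <-rec (λ n → 1 ≤ n → 2 ^ ⌊log₂ n ⌋ ≤ n) step
  where
  step : ∀ n → (∀ {m} → m < n → 1 ≤ m → 2 ^ ⌊log₂ m ⌋ ≤ m) → 1 ≤ n → 2 ^ ⌊log₂ n ⌋ ≤ n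
  step 1 rec _ = ≤-refl
  step n@(suc (suc n')) rec _ = go ⌊log₂ n ⌋ refl
    where
    go : ∀ l → ⌊log₂ n ⌋ ≡ l → 2 ^ l ≤ n
    go zero _ = s≤s z≤n
    go (suc l) eq = ≤-trans (*-monoʳ-≤ 2 (subst (λ j → 2 ^ j ≤ ⌊ n /2⌋) (trans (⌊log₂⌊n/2⌋⌋≡⌊log₂n⌋∸1 n) (cong (_∸ 1) eq)) (rec (⌊n/2⌋<n (suc n')) (s≤s z≤n))))
      (≤-trans (+-monoʳ-≤ ⌊ n /2⌋ (≤-trans (≤-reflexive (+-identityʳ ⌊ n /2⌋)) (⌊n/2⌋≤⌈n/2⌉ n))) (≤-reflexive (⌊n/2⌋+⌈n/2⌉≡n n)))

^-cancel-≤ : ∀ k {a b} → 1 ≤ k → a ^ k ≤ b ^ k → a ≤ b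
^-cancel-≤ k {a} {b} k>0 le = ≮⇒≥ λ b<a → <⇒≱ (^-monoˡ-< k {{>-nonZero k>0}} b<a) le

module Numerics (k₀ : ℕ) (d A : ℕ) where
  k E D B₁ B₂ : ℕ
  k = suc k₀
  E = 3 + 4 * k₀
  D = 1 + 2 * k₀
  B₁ = d * A ^ k * 16 ^ k * 9 ^ D
  B₂ = B₁ ^ E * (2 ^ E) ^ (k * D)

  square-power : ∀ x → (x * x) ^ k ≡ x ^ D * x
  square-power x = trans (^-distribʳ-* k x x) (trans (sym (^-distribˡ-+-* x k k)) (trans (cong (x ^_) (lem k₀)) (*-comm x (x ^ D))))
    where
    lem : ∀ a → (1 + a) + (1 + a) ≡ 1 + (1 + 2 * a)
    lem = solve-∀

  final-bound : ∀ T z p G τ ℓ n → 1 ≤ ℓ → 1 ≤ p → 1 ≤ B₂ → T * z ≤ A * (G * G) * (p * p) → 2 * p ≤ d * z ^ k →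
    G * G ≤ 16 * (ℓ * ℓ) → p ≤ 9 * (τ ^ k * ℓ) → τ ^ E * (ℓ * ℓ) ≤ 2 ^ E * n →
    T ^ E ≤ B₂ * n ^ D * ℓ ^ (3 * E)
  final-bound T z p G τ ℓ n ℓ>0 p>0 B₂>0 Tz dz GG p≤ τ≤ = ^-cancel-≤ k (s≤s z≤n) (begin
      (T ^ E) ^ k ≤⟨ u₄ ⟩
      B₂ * (n ^ D * ℓ ^ (3 * E)) ^ k ≤⟨ *-monoˡ-≤ _ (≤-trans (≤-reflexive (sym (*-identityʳ B₂))) (^-monoʳ-≤ B₂ {{>-nonZero B₂>0}} {1} {k} (s≤s z≤n))) ⟩
      B₂ ^ k * (n ^ D * ℓ ^ (3 * E)) ^ k ≡⟨ sym (^-distribʳ-* k B₂ (n ^ D * ℓ ^ (3 * E))) ⟩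
      (B₂ * (n ^ D * ℓ ^ (3 * E))) ^ k ≡⟨ cong (_^ k) (sym (*-assoc B₂ (n ^ D) (ℓ ^ (3 * E)))) ⟩
      (B₂ * n ^ D * ℓ ^ (3 * E)) ^ k ∎)
    where
    open ≤-Reasoning
    e₁ : ∀ a p → a * (2 * p) ≡ 2 * a * p
    e₁ = solve-∀
    e₂ : ∀ a d z → a * (d * z) ≡ d * (a * z)
    e₂ = solve-∀
    e₃ : ∀ d A G P p → d * (A * G * (P * p)) ≡ d * A * G * P * p
    e₃ = solve-∀
    u₂ : T ^ k ≤ d * A ^ k * (G * G) ^ k * p ^ D
    u₂ = *-cancelʳ-≤ (T ^ k) _ p {{>-nonZero p>0}} (begin
      T ^ k * p ≤⟨ *-monoˡ-≤ p (m≤n*m (T ^ k) 2) ⟩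
      2 * T ^ k * p ≡⟨ sym (e₁ (T ^ k) p) ⟩
      T ^ k * (2 * p) ≤⟨ *-monoʳ-≤ (T ^ k) dz ⟩
      T ^ k * (d * z ^ k) ≡⟨ e₂ (T ^ k) d (z ^ k) ⟩
      d * (T ^ k * z ^ k) ≡⟨ cong (d *_) (sym (^-distribʳ-* k T z)) ⟩
      d * (T * z) ^ k ≤⟨ *-monoʳ-≤ d (^-monoˡ-≤ k Tz) ⟩
      d * (A * (G * G) * (p * p)) ^ k ≡⟨ cong (d *_) (trans (^-distribʳ-* k (A * (G * G)) (p * p)) (cong₂ _*_ (^-distribʳ-* k A (G * G)) (square-power p))) ⟩
      d * (A ^ k * (G * G) ^ k * (p ^ D * p)) ≡⟨ e₃ d (A ^ k) ((G * G) ^ k) (p ^ D) p ⟩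
      d * A ^ k * (G * G) ^ k * p ^ D * p ∎)
    ℓ-power : (ℓ * ℓ) ^ k * ℓ ^ D ≡ ℓ ^ E
    ℓ-power = trans (cong (_* ℓ ^ D) (trans (square-power ℓ) (*-comm (ℓ ^ D) ℓ))) (trans (sym (^-distribˡ-+-* ℓ (suc D) D)) (cong (ℓ ^_) (lem k₀)))
      where
      lem : ∀ a → (1 + (1 + 2 * a)) + (1 + 2 * a) ≡ 3 + 4 * a
      lem = solve-∀
    e₅ : ∀ x q a c t M → x * (q * a) * (c * (t * M)) ≡ x * q * c * (a * M * t)
    e₅ = solve-∀
    u₃ : T ^ k ≤ B₁ * (ℓ ^ E * τ ^ (k * D))
    u₃ = begin
      T ^ k ≤⟨ u₂ ⟩
      d * A ^ k * (G * G) ^ k * p ^ D ≤⟨ *-mono-≤ (*-monoʳ-≤ (d * A ^ k) (^-monoˡ-≤ k GG)) (^-monoˡ-≤ D p≤) ⟩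
      d * A ^ k * (16 * (ℓ * ℓ)) ^ k * (9 * (τ ^ k * ℓ)) ^ D
        ≡⟨ cong₂ (λ a b → d * A ^ k * a * b) (^-distribʳ-* k 16 (ℓ * ℓ)) (trans (^-distribʳ-* D 9 (τ ^ k * ℓ)) (cong (9 ^ D *_) (^-distribʳ-* D (τ ^ k) ℓ))) ⟩
      d * A ^ k * (16 ^ k * (ℓ * ℓ) ^ k) * (9 ^ D * ((τ ^ k) ^ D * ℓ ^ D)) ≡⟨ e₅ (d * A ^ k) (16 ^ k) ((ℓ * ℓ) ^ k) (9 ^ D) ((τ ^ k) ^ D) (ℓ ^ D) ⟩
      B₁ * ((ℓ * ℓ) ^ k * ℓ ^ D * (τ ^ k) ^ D) ≡⟨ cong (B₁ *_) (cong₂ _*_ ℓ-power (^-*-assoc τ k D)) ⟩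
      B₁ * (ℓ ^ E * τ ^ (k * D)) ∎
    kD = k * D
    exponents : E * E ≤ 3 * E * k + 2 * kD
    exponents = ≤-trans (m≤m+n (E * E) (2 + 3 * k₀)) (≤-reflexive (lem k₀))
      where
      lem : ∀ a → (3 + 4 * a) * (3 + 4 * a) + (2 + 3 * a) ≡ 3 * (3 + 4 * a) * (1 + a) + 2 * ((1 + a) * (1 + 2 * a))
      lem = solve-∀
    swap-power : ∀ x a b → (x ^ a) ^ b ≡ (x ^ b) ^ a
    swap-power x a b = trans (^-*-assoc x a b) (trans (cong (x ^_) (*-comm a b)) (sym (^-*-assoc x b a)))
    ℓℓ : (ℓ * ℓ) ^ kD ≡ ℓ ^ (2 * kD)
    ℓℓ = trans (^-distribʳ-* kD ℓ ℓ) (trans (sym (^-distribˡ-+-* ℓ kD kD)) (cong (ℓ ^_) (cong (kD +_) (sym (+-identityʳ kD)))))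
    e₆ : ∀ a b c x → a * (b * c) * x ≡ a * b * (c * x)
    e₆ = solve-∀
    e₇ : ∀ a b c e f → a * (b * c) * (e * f) ≡ a * e * (f * b) * c
    e₇ = solve-∀
    u₄ : (T ^ E) ^ k ≤ B₂ * (n ^ D * ℓ ^ (3 * E)) ^ k
    u₄ = *-cancelʳ-≤ _ _ (ℓ ^ (2 * kD)) {{m^n≢0 ℓ (2 * kD) {{>-nonZero ℓ>0}}}} (begin
      (T ^ E) ^ k * ℓ ^ (2 * kD) ≡⟨ cong₂ _*_ (swap-power T E k) (sym ℓℓ) ⟩
      (T ^ k) ^ E * (ℓ * ℓ) ^ kD ≤⟨ *-monoˡ-≤ _ (^-monoˡ-≤ E u₃) ⟩
      (B₁ * (ℓ ^ E * τ ^ kD)) ^ E * (ℓ * ℓ) ^ kD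
        ≡⟨ cong (_* (ℓ * ℓ) ^ kD) (trans (^-distribʳ-* E B₁ _) (cong (B₁ ^ E *_) (trans (^-distribʳ-* E (ℓ ^ E) (τ ^ kD)) (cong₂ _*_ (^-*-assoc ℓ E E) (swap-power τ kD E))))) ⟩
      B₁ ^ E * (ℓ ^ (E * E) * (τ ^ E) ^ kD) * (ℓ * ℓ) ^ kD ≡⟨ e₆ (B₁ ^ E) (ℓ ^ (E * E)) ((τ ^ E) ^ kD) ((ℓ * ℓ) ^ kD) ⟩
      B₁ ^ E * ℓ ^ (E * E) * ((τ ^ E) ^ kD * (ℓ * ℓ) ^ kD) ≡⟨ cong (B₁ ^ E * ℓ ^ (E * E) *_) (sym (^-distribʳ-* kD (τ ^ E) (ℓ * ℓ))) ⟩
      B₁ ^ E * ℓ ^ (E * E) * (τ ^ E * (ℓ * ℓ)) ^ kD ≤⟨ *-mono-≤ (*-monoʳ-≤ (B₁ ^ E) (^-monoʳ-≤ ℓ {{>-nonZero ℓ>0}} exponents)) (^-monoˡ-≤ kD τ≤) ⟩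
      B₁ ^ E * ℓ ^ (3 * E * k + 2 * kD) * (2 ^ E * n) ^ kD ≡⟨ cong₂ _*_ (cong (B₁ ^ E *_) (^-distribˡ-+-* ℓ (3 * E * k) (2 * kD))) (^-distribʳ-* kD (2 ^ E) n) ⟩
      B₁ ^ E * (ℓ ^ (3 * E * k) * ℓ ^ (2 * kD)) * ((2 ^ E) ^ kD * n ^ kD) ≡⟨ e₇ (B₁ ^ E) (ℓ ^ (3 * E * k)) (ℓ ^ (2 * kD)) ((2 ^ E) ^ kD) (n ^ kD) ⟩
      B₂ * (n ^ kD * ℓ ^ (3 * E * k)) * ℓ ^ (2 * kD) ≡⟨ cong (λ x → B₂ * x * ℓ ^ (2 * kD)) (sym (trans (^-distribʳ-* k (n ^ D) (ℓ ^ (3 * E))) (cong₂ _*_ (trans (^-*-assoc n D k) (cong (n ^_) (*-comm D k))) (^-*-assoc ℓ (3 * E) k)))) ⟩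
      B₂ * (n ^ D * ℓ ^ (3 * E)) ^ k * ℓ ^ (2 * kD) ∎)

-- With q the prime and k = s - 1, the fingerprints have size of order q² / q^(1/k); t stands for the k-th root of q.
module Parameters (r : ℕ) (2≤r : 2 ≤ r) (s : Fin r → ℕ) (k₀ : ℕ) (s≡ : sumFin r s ≡ 2 + k₀) (d π κ A M₀ : ℕ)
  (d≡ : d ≡ 512 * (r * 4 ^ suc k₀)) (π≡ : π ≡ 64 * (r * 4 ^ suc k₀))
  (κ≡ : κ ≡ (64 * (r * 4 ^ suc k₀)) ^ suc k₀ * d) (A≡ : A ≡ 45 * κ * suc k₀ * π)
  (M₀-hits : 128 * r * 64 ^ suc k₀ ≤ M₀) (M₀-r : 32 * r ≤ M₀) (M₀-A : 16 * A ≤ M₀)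
  (M₀-E : 9 * 2 ^ (3 + 4 * k₀) ≤ M₀) (M₀-4 : 4 ≤ M₀) where

  open Numerics k₀ d A

  r>0 : 1 ≤ r
  r>0 = ≤-trans (s≤s z≤n) 2≤r

  4^k>0 : 1 ≤ r * 4 ^ k
  4^k>0 = *-mono-≤ r>0 (m^n>0 4 k)

  π>1 : 2 ≤ π
  π>1 = ≤-trans (*-mono-≤ {2} {64} (s≤s (s≤s z≤n)) 4^k>0) (≤-reflexive (sym π≡))

  d>0 : 1 ≤ d
  d>0 = ≤-trans (*-mono-≤ {1} {512} (s≤s z≤n) 4^k>0) (≤-reflexive (sym d≡))

  κ>0 : 1 ≤ κ
  κ>0 = ≤-trans (*-mono-≤ (m^n>0 (64 * (r * 4 ^ k)) {{>-nonZero (*-mono-≤ {1} {64} (s≤s z≤n) 4^k>0)}} k) d>0) (≤-reflexive (sym κ≡))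

  x≤x^k : ∀ x → x ≤ x ^ k
  x≤x^k zero = z≤n
  x≤x^k x@(suc _) = ≤-trans (≤-reflexive (sym (*-identityʳ x))) (^-monoʳ-≤ x {1} {k} (s≤s z≤n))

  fourth-power : ∀ x → x ^ E * x ≡ (x ^ k) ^ 4
  fourth-power x = trans (*-comm (x ^ E) x) (trans (cong (x ^_) (lem k₀)) (sym (^-*-assoc x k 4)))
    where
    lem : ∀ a → 1 + (3 + 4 * a) ≡ (1 + a) * 4
    lem = solve-∀

  product≤fourth-power : ∀ p u τ → u ^ k ≤ p → τ ^ k ≤ p → u * τ ^ E ≤ p ^ 4
  product≤fourth-power p u τ u≤ τ≤ with ≤-total u τ
  ... | inj₁ le = begin
    u * τ ^ E ≤⟨ *-monoˡ-≤ (τ ^ E) le ⟩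
    τ * τ ^ E ≡⟨ trans (*-comm τ (τ ^ E)) (fourth-power τ) ⟩
    (τ ^ k) ^ 4 ≤⟨ ^-monoˡ-≤ 4 τ≤ ⟩
    p ^ 4 ∎
    where open ≤-Reasoning
  ... | inj₂ ge = begin
    u * τ ^ E ≤⟨ *-monoʳ-≤ u (^-monoˡ-≤ E ge) ⟩
    u * u ^ E ≡⟨ trans (*-comm u (u ^ E)) (fourth-power u) ⟩
    (u ^ k) ^ 4 ≤⟨ ^-monoˡ-≤ 4 u≤ ⟩
    p ^ 4 ∎
    where open ≤-Reasoning

  root : ∀ H → 16 * 64 ^ k ≤ H → ∃ λ t → 1 ≤ t × 16 * (64 * t) ^ k ≤ H × H < 16 * (64 * suc t) ^ k
  root H large = go (least (λ m → H <? 16 * (64 * m) ^ k) (suc H)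
      (≤-trans (m≤n*m (suc H) 64) (≤-trans (x≤x^k (64 * suc H)) (m≤n*m ((64 * suc H) ^ k) 16))))
    where
    go : (∃ λ m → H < 16 * (64 * m) ^ k × (∀ j → j < m → ¬ (H < 16 * (64 * j) ^ k))) →
      ∃ λ t → 1 ≤ t × 16 * (64 * t) ^ k ≤ H × H < 16 * (64 * suc t) ^ k
    go (zero , () , _)
    go (suc zero , lt , _) = ⊥-elim (<⇒≱ lt large)
    go (suc (suc t) , lt , below) = suc t , s≤s z≤n , ≮⇒≥ (below (suc t) ≤-refl) , lt

  pp : ∀ p → p ^ 4 ≡ p * p * (p * p)
  pp p = lem p
    where
    lem : ∀ p → p * (p * (p * (p * 1))) ≡ p * p * (p * p)
    lem = solve-∀

  module At (n ℓ τ : ℕ) (ℓ>0 : 1 ≤ ℓ) (n< : n < 2 ^ suc ℓ) (n≤ : n ≤ τ ^ E * (ℓ * ℓ)) (τ≤ : τ ^ E * (ℓ * ℓ) ≤ 2 ^ E * n)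
    (large : M₀ * (ℓ * ℓ) ≤ τ) (n>0 : 1 ≤ n) where
    open ≤-Reasoning

    Bounded : Set
    Bounded = Σ (Graph (Fin n)) λ Γ → Free (complete (r + 2)) Γ ×
      (∀ S → FIndependent (completeMultipartite r s) Γ S → ∣ S ∣ ^ E ≤ B₂ * n ^ D * ℓ ^ (3 * E))

    ℓℓ>0 : 1 ≤ ℓ * ℓ
    ℓℓ>0 = *-mono-≤ ℓ>0 ℓ>0

    M₀≤τ : M₀ ≤ τ
    M₀≤τ = ≤-trans (m≤m*n M₀ (ℓ * ℓ) {{>-nonZero ℓℓ>0}}) large

    τ>0 : 1 ≤ τ
    τ>0 = ≤-trans (s≤s z≤n) (≤-trans M₀-4 M₀≤τ)

    y h : ℕ
    y = τ ^ k
    h = 4 * (y * ℓ)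

    y>0 : 1 ≤ y
    y>0 = m^n>0 τ {{>-nonZero τ>0}} k

    yℓ>0 : 1 ≤ y * ℓ
    yℓ>0 = *-mono-≤ y>0 ℓ>0

    2h≤ : suc (h + h) ≤ 9 * (y * ℓ)
    2h≤ = ≤-trans (+-monoˡ-≤ (h + h) yℓ>0) (≤-reflexive (lem (y * ℓ)))
      where
      lem : ∀ x → x + (4 * x + 4 * x) ≡ 9 * x
      lem = solve-∀

    9yℓ≤n : 9 * (y * ℓ) ≤ n
    9yℓ≤n = *-cancelˡ-≤ (2 ^ E) {{m^n≢0 2 E}} (begin
      2 ^ E * (9 * (y * ℓ)) ≡⟨ lem (2 ^ E) y ℓ ⟩
      9 * 2 ^ E * y * ℓ ≤⟨ *-mono-≤ (*-monoˡ-≤ y (≤-trans M₀-E M₀≤τ)) (m≤n*m ℓ ℓ {{>-nonZero ℓ>0}}) ⟩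
      τ ^ suc k * (ℓ * ℓ) ≤⟨ *-monoˡ-≤ (ℓ * ℓ) (^-monoʳ-≤ τ {{>-nonZero τ>0}} (+-mono-≤ {2} {3} (s≤s (s≤s z≤n)) (m≤n*m k₀ 4))) ⟩
      τ ^ E * (ℓ * ℓ) ≤⟨ τ≤ ⟩
      2 ^ E * n ∎)
      where
      lem : ∀ a y l → a * (9 * (y * l)) ≡ 9 * a * y * l
      lem = solve-∀

    prime-window : suc (h + h) ^ y < 4 ^ h
    prime-window = begin-strict
      suc (h + h) ^ y ≤⟨ ^-monoˡ-≤ y (≤-trans 2h≤ 9yℓ≤n) ⟩
      n ^ y <⟨ ^-monoˡ-< y {{>-nonZero y>0}} n< ⟩
      (2 ^ suc ℓ) ^ y ≤⟨ ^-monoˡ-≤ y (^-monoʳ-≤ 2 (≤-trans (+-monoˡ-≤ ℓ ℓ>0) (≤-reflexive (cong (ℓ +_) (sym (+-identityʳ ℓ)))))) ⟩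
      (2 ^ (2 * ℓ)) ^ y ≡⟨ cong (_^ y) (sym (^-*-assoc 2 2 ℓ)) ⟩
      (4 ^ ℓ) ^ y ≡⟨ trans (^-*-assoc 4 ℓ y) (cong (4 ^_) (*-comm ℓ y)) ⟩
      4 ^ (y * ℓ) ≤⟨ ^-monoʳ-≤ 4 (m≤n*m (y * ℓ) 4) ⟩
      4 ^ h ∎

    module Prime-chosen (p : ℕ) (Geo : Geometry p) (y<p : y < p) (p≤9yℓ : p ≤ 9 * (y * ℓ)) where
     τ≤p : τ ≤ p
     τ≤p = ≤-trans (x≤x^k τ) (<⇒≤ y<p)

     p>0 : 1 ≤ p
     p>0 = ≤-trans τ>0 τ≤p

     open Geometry Geo

     instance
       8r≢0 : NonZero (8 * r)
       8r≢0 = >-nonZero (*-mono-≤ {1} {8} (s≤s z≤n) r>0)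
       n≢0 : NonZero n
       n≢0 = >-nonZero n>0

     H : ℕ
     H = p / (8 * r)

     8rH≤p : 8 * r * H ≤ p
     8rH≤p = ≤-trans (≤-reflexive (*-comm (8 * r) H)) (m/n*n≤m p (8 * r))

     H≤p : H ≤ p
     H≤p = ≤-trans (m≤n*m H (8 * r)) 8rH≤p

     16*64^k≤H : 16 * 64 ^ k ≤ H
     16*64^k≤H = ≤-trans (≤-reflexive (sym (m*n/n≡m (16 * 64 ^ k) (8 * r))))
       (/-monoˡ-≤ (8 * r) (≤-trans (≤-reflexive (lem (64 ^ k) r)) (≤-trans M₀-hits (≤-trans M₀≤τ τ≤p))))
       where
       lem : ∀ x r → 16 * x * (8 * r) ≡ 128 * r * x
       lem = solve-∀

     H>0 : 1 ≤ H
     H>0 = ≤-trans (*-mono-≤ {1} {16} (s≤s z≤n) (m^n>0 64 k)) 16*64^k≤H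

     p≤16rH : p ≤ 16 * r * H
     p≤16rH = begin
       p ≤⟨ <⇒≤ (<-div p (8 * r)) ⟩
       suc H * (8 * r) ≤⟨ *-monoˡ-≤ (8 * r) (+-monoˡ-≤ H H>0) ⟩
       (H + H) * (8 * r) ≡⟨ lem H r ⟩
       16 * r * H ∎
       where
       lem : ∀ H r → (H + H) * (8 * r) ≡ 16 * r * H
       lem = solve-∀

     module Root-chosen (t : ℕ) (t>0 : 1 ≤ t) (lower : 16 * (64 * t) ^ k ≤ H) (upper : H < 16 * (64 * suc t) ^ k) where
      z : ℕ
      z = 32 * t

      z>0 : 1 ≤ z
      z>0 = ≤-trans t>0 (m≤n*m t 32)

      16[2z]^k≤H : 16 * (2 * z) ^ k ≤ H
      16[2z]^k≤H = ≤-trans (≤-reflexive (cong (λ x → 16 * x ^ k) (lem t))) lower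
        where
        lem : ∀ t → 2 * (32 * t) ≡ 64 * t
        lem = solve-∀

      [2z]^k≤p : (2 * z) ^ k ≤ p
      [2z]^k≤p = ≤-trans (m≤n*m _ 16) (≤-trans 16[2z]^k≤H H≤p)

      16z^k≤H : 16 * z ^ k ≤ H
      16z^k≤H = ≤-trans (*-monoʳ-≤ 16 (^-monoˡ-≤ k (m≤n*m z 2))) 16[2z]^k≤H

      H≤ : H ≤ 16 * (4 ^ k * z ^ k)
      H≤ = begin
        H ≤⟨ <⇒≤ upper ⟩
        16 * (64 * suc t) ^ k ≤⟨ *-monoʳ-≤ 16 (^-monoˡ-≤ k (*-monoʳ-≤ 64 (+-monoˡ-≤ t t>0))) ⟩
        16 * (64 * (t + t)) ^ k ≡⟨ cong (λ x → 16 * x ^ k) (lem t) ⟩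
        16 * (4 * z) ^ k ≡⟨ cong (16 *_) (^-distribʳ-* k 4 z) ⟩
        16 * (4 ^ k * z ^ k) ∎
        where
        lem : ∀ t → 64 * (t + t) ≡ 4 * (32 * t)
        lem = solve-∀

      Π G m g : ℕ
      Π = π * (p * p)
      G = suc ℓ + suc ℓ
      m = suc (_/_ (8 * Π) z {{>-nonZero z>0}})
      g = lines / n

      pp>0 : 1 ≤ p * p
      pp>0 = *-mono-≤ p>0 p>0

      Π>0 : 1 ≤ Π
      Π>0 = *-mono-≤ (≤-trans (s≤s z≤n) π>1) pp>0

      degree : 2 * p ≤ d * z ^ k
      degree = begin
        2 * p ≤⟨ *-monoʳ-≤ 2 p≤16rH ⟩
        2 * (16 * r * H) ≤⟨ *-monoʳ-≤ 2 (*-monoʳ-≤ (16 * r) H≤) ⟩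
        2 * (16 * r * (16 * (4 ^ k * z ^ k))) ≡⟨ lem r (4 ^ k) (z ^ k) ⟩
        512 * (r * 4 ^ k) * z ^ k ≡⟨ cong (_* z ^ k) (sym d≡) ⟩
        d * z ^ k ∎
        where
        lem : ∀ r x y → 2 * (16 * r * (16 * (x * y))) ≡ 512 * (r * x) * y
        lem = solve-∀

      hits-large : 2 * (p * (p * p)) * 4 ^ k + 8 * z ^ k * Π ≤ H * Π
      hits-large = *-cancelˡ-≤ 2 (begin
        2 * (2 * (p * (p * p)) * 4 ^ k + 8 * z ^ k * Π) ≡⟨ lem₁ p (4 ^ k) (z ^ k) Π ⟩
        4 * p * 4 ^ k * (p * p) + 16 * z ^ k * Π ≤⟨ +-mono-≤ (*-monoˡ-≤ (p * p) part) (*-monoˡ-≤ Π 16z^k≤H) ⟩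
        H * π * (p * p) + H * Π ≡⟨ lem₂ H π (p * p) ⟩
        2 * (H * Π) ∎)
        where
        lem₁ : ∀ p x y Π → 2 * (2 * (p * (p * p)) * x + 8 * y * Π) ≡ 4 * p * x * (p * p) + 16 * y * Π
        lem₁ = solve-∀
        lem₂ : ∀ H π q → H * π * q + H * (π * q) ≡ 2 * (H * (π * q))
        lem₂ = solve-∀
        lem₃ : ∀ r H x → 4 * (16 * r * H) * x ≡ H * (64 * (r * x))
        lem₃ = solve-∀
        part : 4 * p * 4 ^ k ≤ H * π
        part = begin
          4 * p * 4 ^ k ≤⟨ *-monoˡ-≤ (4 ^ k) (*-monoʳ-≤ 4 p≤16rH) ⟩
          4 * (16 * r * H) * 4 ^ k ≡⟨ lem₃ r H (4 ^ k) ⟩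
          H * (64 * (r * 4 ^ k)) ≡⟨ cong (H *_) (sym π≡) ⟩
          H * π ∎

      G≤4ℓ : G ≤ 4 * ℓ
      G≤4ℓ = ≤-trans (+-mono-≤ (+-monoˡ-≤ ℓ ℓ>0) (+-monoˡ-≤ ℓ ℓ>0)) (≤-reflexive (lem ℓ))
        where
        lem : ∀ l → l + l + (l + l) ≡ 4 * l
        lem = solve-∀

      GG≤ : G * G ≤ 16 * (ℓ * ℓ)
      GG≤ = ≤-trans (*-mono-≤ G≤4ℓ G≤4ℓ) (≤-reflexive (lem ℓ))
        where
        lem : ∀ l → 4 * l * (4 * l) ≡ 16 * (l * l)
        lem = solve-∀

      ℓℓ≤GG : ℓ * ℓ ≤ G * G
      ℓℓ≤GG = *-mono-≤ (≤-trans (n≤1+n ℓ) (m≤m+n (suc ℓ) (suc ℓ))) (≤-trans (n≤1+n ℓ) (m≤m+n (suc ℓ) (suc ℓ)))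

      8rG≤p : 8 * r * G ≤ p
      8rG≤p = begin
        8 * r * G ≤⟨ *-monoʳ-≤ (8 * r) G≤4ℓ ⟩
        8 * r * (4 * ℓ) ≡⟨ lem r ℓ ⟩
        32 * r * ℓ ≤⟨ *-mono-≤ M₀-r (m≤n*m ℓ ℓ {{>-nonZero ℓ>0}}) ⟩
        M₀ * (ℓ * ℓ) ≤⟨ large ⟩
        τ ≤⟨ τ≤p ⟩
        p ∎
        where
        lem : ∀ r l → 8 * r * (4 * l) ≡ 32 * r * l
        lem = solve-∀

      lines-long : ∀ ℓ → 2 * r * (H + G) ≤ # (allFin (p * (p * p))) (inc ℓ)
      lines-long ℓ = *-cancelˡ-≤ 4 (begin
        4 * (2 * r * (H + G)) ≡⟨ lem r H G ⟩
        8 * r * H + 8 * r * G ≤⟨ +-mono-≤ 8rH≤p 8rG≤p ⟩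
        p + p ≤⟨ +-mono-≤ (long ℓ) (long ℓ) ⟩
        2 * c + 2 * c ≡⟨ lem₂ c ⟩
        4 * c ∎)
        where
        c = # (allFin (p * (p * p))) (inc ℓ)
        lem : ∀ r H G → 4 * (2 * r * (H + G)) ≡ 8 * r * H + 8 * r * G
        lem = solve-∀
        lem₂ : ∀ c → 2 * c + 2 * c ≡ 4 * c
        lem₂ = solve-∀

      pp≤2^G : p * p ≤ 2 ^ G
      pp≤2^G = ≤-trans (*-mono-≤ p≤ p≤) (≤-reflexive (sym (^-distribˡ-+-* 2 (suc ℓ) (suc ℓ))))
        where
        p≤ : p ≤ 2 ^ suc ℓ
        p≤ = ≤-trans p≤9yℓ (≤-trans 9yℓ≤n (<⇒≤ n<))

      ng≤ : n * g ≤ lines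
      ng≤ = ≤-trans (≤-reflexive (*-comm n g)) (m/n*n≤m lines n)

      ng≤p⁴ : n * g ≤ p * p * (p * p)
      ng≤p⁴ = ≤-trans ng≤ (≤-trans few (≤-reflexive (pp p)))

      few-lines : 2 * (n * g) ≤ Π * 2 ^ G
      few-lines = begin
        2 * (n * g) ≤⟨ *-mono-≤ π>1 ng≤p⁴ ⟩
        π * (p * p * (p * p)) ≡⟨ sym (*-assoc π (p * p) (p * p)) ⟩
        Π * (p * p) ≤⟨ *-monoʳ-≤ Π pp≤2^G ⟩
        Π * 2 ^ G ∎

      group-size : n * g ≤ 2 ^ G * Π
      group-size = ≤-trans (m≤n*m (n * g) 2) (≤-trans few-lines (≤-reflexive (*-comm Π (2 ^ G))))

      m-large : 8 * Π ≤ m * z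
      m-large = <⇒≤ (<-div (8 * Π) z {{>-nonZero z>0}})

      mz≤ : m * z ≤ 9 * Π
      mz≤ = begin
        z + (_/_ (8 * Π) z {{>-nonZero z>0}}) * z ≤⟨ +-mono-≤ z≤Π (m/n*n≤m (8 * Π) z {{>-nonZero z>0}}) ⟩
        Π + 8 * Π ∎
        where
        z≤Π : z ≤ Π
        z≤Π = begin
          z ≤⟨ x≤x^k z ⟩
          z ^ k ≤⟨ m≤n*m (z ^ k) 16 ⟩
          16 * z ^ k ≤⟨ 16z^k≤H ⟩
          H ≤⟨ H≤p ⟩
          p ≤⟨ m≤m*n p p {{>-nonZero p>0}} ⟩
          p * p ≤⟨ m≤n*m (p * p) π {{>-nonZero (≤-trans (s≤s z≤n) π>1)}} ⟩
          Π ∎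

      St T : ℕ
      St = G * (κ * (k * m))
      T = suc (4 * G * St)

      Tz≤ : T * z ≤ A * (G * G) * (p * p)
      Tz≤ = begin
        z + 4 * G * (G * (κ * (k * m))) * z ≡⟨ cong (z +_) (lem₁ G κ k m z) ⟩
        z + 4 * (G * G * κ * k) * (m * z) ≤⟨ +-mono-≤ (≤-trans (m≤n*m z m) mz≤) (*-monoʳ-≤ (4 * (G * G * κ * k)) mz≤) ⟩
        9 * Π + 4 * (G * G * κ * k) * (9 * Π) ≤⟨ +-monoˡ-≤ _ (m≤n*m (9 * Π) (G * G * κ * k) {{>-nonZero (*-mono-≤ (*-mono-≤ {1} {G * G} (s≤s z≤n) κ>0) (s≤s z≤n))}}) ⟩
        G * G * κ * k * (9 * Π) + 4 * (G * G * κ * k) * (9 * Π) ≡⟨ lem₂ (G * G) κ k π (p * p) ⟩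
        45 * κ * k * π * (G * G) * (p * p) ≡⟨ cong (λ a → a * (G * G) * (p * p)) (sym A≡) ⟩
        A * (G * G) * (p * p) ∎
        where
        lem₁ : ∀ G κ k m z → 4 * G * (G * (κ * (k * m))) * z ≡ 4 * (G * G * κ * k) * (m * z)
        lem₁ = solve-∀
        lem₂ : ∀ g κ k π q → g * κ * k * (9 * (π * q)) + 4 * (g * κ * k) * (9 * (π * q)) ≡ 45 * κ * k * π * g * q
        lem₂ = solve-∀

      T≤p⁴ : T ≤ p * p * (p * p)
      T≤p⁴ = begin
        T ≤⟨ m≤m*n T z {{>-nonZero z>0}} ⟩
        T * z ≤⟨ Tz≤ ⟩
        A * (G * G) * (p * p) ≤⟨ *-monoˡ-≤ (p * p) (*-monoʳ-≤ A GG≤) ⟩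
        A * (16 * (ℓ * ℓ)) * (p * p) ≡⟨ cong (_* (p * p)) (lem A (ℓ * ℓ)) ⟩
        16 * A * (ℓ * ℓ) * (p * p) ≤⟨ *-monoˡ-≤ (p * p) (≤-trans (*-monoˡ-≤ (ℓ * ℓ) M₀-A) (≤-trans large (≤-trans τ≤p (m≤m*n p p {{>-nonZero p>0}})))) ⟩
        p * p * (p * p) ∎
        where
        lem : ∀ a l → a * (16 * l) ≡ 16 * a * l
        lem = solve-∀

      budget : (1 + 2 ^ G * T) ^ St < 2 ^ T
      budget = begin-strict
        (1 + 2 ^ G * T) ^ St ≤⟨ ^-monoˡ-≤ St base ⟩
        (2 ^ (4 * G)) ^ St ≡⟨ ^-*-assoc 2 (4 * G) St ⟩
        2 ^ (4 * G * St) <⟨ ^-monoʳ-< 2 (s≤s (s≤s z≤n)) (n<1+n (4 * G * St)) ⟩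
        2 ^ T ∎
        where
        X = 2 ^ G
        X≥2 : 2 ≤ X
        X≥2 = ^-monoʳ-≤ 2 {1} {G} (s≤s z≤n)
        lem : ∀ x → x * (x * x) + x * (x * x) ≡ 2 * (x * (x * x))
        lem = solve-∀
        lem₂ : ∀ x → x * (x * (x * x)) ≡ x * (x * (x * (x * 1)))
        lem₂ = solve-∀
        base : 1 + X * T ≤ 2 ^ (4 * G)
        base = begin
          1 + X * T ≤⟨ +-mono-≤ (*-mono-≤ X>0 (*-mono-≤ X>0 X>0)) (*-monoʳ-≤ X (≤-trans T≤p⁴ (*-mono-≤ pp≤2^G pp≤2^G))) ⟩
          X * (X * X) + X * (X * X) ≡⟨ lem X ⟩
          2 * (X * (X * X)) ≤⟨ *-monoˡ-≤ (X * (X * X)) X≥2 ⟩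
          X * (X * (X * X)) ≡⟨ lem₂ X ⟩
          X ^ 4 ≡⟨ trans (^-*-assoc 2 G 4) (cong (2 ^_) (*-comm G 4)) ⟩
          2 ^ (4 * G) ∎
          where
          X>0 : 1 ≤ X
          X>0 = ≤-trans (s≤s z≤n) X≥2

      2zτ≤ : 2 * z * τ ^ E ≤ p ^ 4
      2zτ≤ = product≤fourth-power p (2 * z) τ [2z]^k≤p (<⇒≤ y<p)

      4n≤p⁴ : 4 * n ≤ p ^ 4
      4n≤p⁴ = begin
        4 * n ≤⟨ *-monoʳ-≤ 4 n≤ ⟩
        4 * (τ ^ E * (ℓ * ℓ)) ≡⟨ lem (τ ^ E) (ℓ * ℓ) ⟩
        τ ^ E * (4 * (ℓ * ℓ)) ≤⟨ *-monoʳ-≤ (τ ^ E) (≤-trans (*-monoˡ-≤ (ℓ * ℓ) M₀-4) large) ⟩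
        τ ^ E * τ ≡⟨ fourth-power τ ⟩
        (τ ^ k) ^ 4 ≤⟨ ^-monoˡ-≤ 4 (<⇒≤ y<p) ⟩
        p ^ 4 ∎
        where
        lem : ∀ a b → 4 * (a * b) ≡ a * (4 * b)
        lem = solve-∀

      p⁴≤8ng : p ^ 4 ≤ 8 * (n * g)
      p⁴≤8ng = begin
        p ^ 4 ≤⟨ many ⟩
        4 * lines ≤⟨ *-monoʳ-≤ 4 (<⇒≤ (<-div lines n)) ⟩
        4 * (suc g * n) ≤⟨ *-monoʳ-≤ 4 (*-monoˡ-≤ n (+-monoˡ-≤ g g>0)) ⟩
        4 * ((g + g) * n) ≡⟨ lem g n ⟩
        8 * (n * g) ∎
        where
        g>0 : 1 ≤ g
        g>0 = m≥n⇒m/n>0 (*-cancelˡ-≤ 4 (≤-trans 4n≤p⁴ many))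
        lem : ∀ g n → 4 * ((g + g) * n) ≡ 8 * (n * g)
        lem = solve-∀

      64nπ≤ : 64 * n * π ≤ p * p * T
      64nπ≤ = *-cancelʳ-≤ (64 * n * π) (p * p * T) z {{>-nonZero z>0}} (begin
        64 * n * π * z ≤⟨ *-monoˡ-≤ z (*-monoˡ-≤ π (*-monoʳ-≤ 64 (≤-trans n≤ (*-monoʳ-≤ (τ ^ E) ℓℓ≤GG)))) ⟩
        64 * (τ ^ E * (G * G)) * π * z ≡⟨ lem₁ (τ ^ E) (G * G) π z ⟩
        32 * (G * G) * π * (2 * z * τ ^ E) ≤⟨ *-monoʳ-≤ (32 * (G * G) * π) 2zτ≤ ⟩
        32 * (G * G) * π * p ^ 4 ≡⟨ cong (32 * (G * G) * π *_) (pp p) ⟩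
        32 * (G * G) * π * (p * p * (p * p)) ≡⟨ lem₂ (G * G) π (p * p) ⟩
        p * p * (4 * (G * G) * (8 * Π)) ≤⟨ *-monoʳ-≤ (p * p) (*-monoʳ-≤ (4 * (G * G)) (≤-trans m-large (m≤n*m (m * z) (κ * k) {{>-nonZero (*-mono-≤ κ>0 (s≤s z≤n))}}))) ⟩
        p * p * (4 * (G * G) * (κ * k * (m * z))) ≡⟨ lem₃ (p * p) G κ k m z ⟩
        p * p * (4 * G * St) * z ≤⟨ *-monoˡ-≤ z (*-monoʳ-≤ (p * p) (n≤1+n (4 * G * St))) ⟩
        p * p * T * z ∎)
        where
        lem₁ : ∀ x g π z → 64 * (x * g) * π * z ≡ 32 * g * π * (2 * z * x)
        lem₁ = solve-∀
        lem₂ : ∀ g π q → 32 * g * π * (q * q) ≡ q * (4 * g * (8 * (π * q)))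
        lem₂ = solve-∀
        lem₃ : ∀ q G κ k m z → q * (4 * (G * G) * (κ * k * (m * z))) ≡ q * (4 * G * (G * (κ * (k * m)))) * z
        lem₃ = solve-∀

      sample-large : 8 * Π ≤ g * T
      sample-large = *-cancelˡ-≤ (8 * n) {{m*n≢0 8 n}} (begin
        8 * n * (8 * Π) ≡⟨ lem₁ n π (p * p) ⟩
        64 * n * π * (p * p) ≤⟨ *-monoˡ-≤ (p * p) 64nπ≤ ⟩
        p * p * T * (p * p) ≡⟨ trans (lem₂ (p * p) T) (cong (_* T) (sym (pp p))) ⟩
        p ^ 4 * T ≤⟨ *-monoˡ-≤ T p⁴≤8ng ⟩
        8 * (n * g) * T ≡⟨ lem₃ n g T ⟩
        8 * n * (g * T) ∎)
        where
        lem₁ : ∀ n π q → 8 * n * (8 * (π * q)) ≡ 64 * n * π * q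
        lem₁ = solve-∀
        lem₂ : ∀ q T → q * T * q ≡ q * q * T
        lem₂ = solve-∀
        lem₃ : ∀ n g T → 8 * (n * g) * T ≡ 8 * n * (g * T)
        lem₃ = solve-∀

      open Assembly p Geo r 2≤r s n g ng≤ k s≡ Π t m d H G Π>0 t>0 d>0 few-lines hits-large degree lines-long m-large
        using (small-independent)

      conclusion : 1 ≤ B₂ → Bounded
      conclusion B₂>0 =
        let Γ , clique-free , small = small-independent G T group-size sample-large
              (subst (λ κ → (1 + 2 ^ G * T) ^ (G * (κ * (k * m))) < 2 ^ T) κ≡ budget)
        in Γ , clique-free , λ S indep → ≤-trans (^-monoˡ-≤ E (<⇒≤ (small S indep)))
             (final-bound T z p G τ ℓ n ℓ>0 p>0 B₂>0 Tz≤ degree GG≤ p≤9yℓ τ≤)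

     conclusion : 1 ≤ B₂ → Bounded
     conclusion B₂>0 = let t , t>0 , lower , upper = root H 16*64^k≤H in Root-chosen.conclusion t t>0 lower upper B₂>0

    conclusion : 1 ≤ B₂ → Bounded
    conclusion B₂>0 = let p , pr , y<p , p≤ = prime-between y h prime-window in
      Prime-chosen.conclusion p
        (geometry p pr (≤-trans (≤-trans (s≤s (s≤s (s≤s z≤n))) M₀-4) (≤-trans M₀≤τ (≤-trans (x≤x^k τ) (<⇒≤ y<p)))))
        y<p (≤-trans p≤ 2h≤) B₂>0

  B₂>0 : 1 ≤ B₂
  B₂>0 = *-mono-≤ (m^n>0 B₁ {{>-nonZero B₁>0}} E) (m^n>0 (2 ^ E) {{m^n≢0 2 E}} (k * D))
    where
    A>0 : 1 ≤ A
    A>0 = ≤-trans (*-mono-≤ (*-mono-≤ (*-mono-≤ {1} {45} (s≤s z≤n) κ>0) (s≤s z≤n)) (≤-trans (s≤s z≤n) π>1)) (≤-reflexive (sym A≡))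
    B₁>0 : 1 ≤ B₁
    B₁>0 = *-mono-≤ (*-mono-≤ (*-mono-≤ d>0 (m^n>0 A {{>-nonZero A>0}} k)) (m^n>0 16 k)) (m^n>0 9 D)

  threshold : ∃ λ L → ∀ ℓ → L ≤ ℓ → M₀ ^ E * ℓ ^ (2 * E + 2) < 2 ^ ℓ
  threshold = polynomial<exponential (M₀ ^ E) (2 * E + 2)

  bounded : ∀ n → 2 ^ suc (proj₁ threshold) ≤ n → Σ (Graph (Fin n)) λ Γ → Free (complete (r + 2)) Γ ×
    (∀ S → FIndependent (completeMultipartite r s) Γ S → ∣ S ∣ ^ E ≤ B₂ * n ^ D * ⌊log₂ n ⌋ ^ (3 * E))
  bounded n N≤n = go (least (λ τ → n ≤? τ ^ E * (ℓ * ℓ)) n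
      (≤-trans (m≤m*n n (ℓ * ℓ) {{>-nonZero ℓℓ>0}}) (*-monoˡ-≤ (ℓ * ℓ) (≤-trans (≤-reflexive (sym (*-identityʳ n))) (^-monoʳ-≤ n {{>-nonZero n>0}} {1} {E} (s≤s z≤n))))))
    where
    open ≤-Reasoning
    ℓ = ⌊log₂ n ⌋
    n>0 : 1 ≤ n
    n>0 = ≤-trans (m^n>0 2 (suc (proj₁ threshold))) N≤n
    L<ℓ : suc (proj₁ threshold) ≤ ℓ
    L<ℓ = ≤-trans (≤-reflexive (sym (⌊log₂[2^n]⌋≡n (suc (proj₁ threshold))))) (⌊log₂⌋-mono-≤ N≤n)
    ℓ>0 : 1 ≤ ℓ
    ℓ>0 = ≤-trans (s≤s z≤n) L<ℓ
    ℓℓ>0 : 1 ≤ ℓ * ℓ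
    ℓℓ>0 = *-mono-≤ ℓ>0 ℓ>0
    power : ∀ M → (M * (ℓ * ℓ)) ^ E * (ℓ * ℓ) ≡ M ^ E * ℓ ^ (2 * E + 2)
    power M = trans (cong (_* (ℓ * ℓ)) (^-distribʳ-* E M (ℓ * ℓ))) (trans (*-assoc (M ^ E) _ _) (cong (M ^ E *_) (begin-equality
      (ℓ * ℓ) ^ E * (ℓ * ℓ) ≡⟨ cong (λ x → x ^ E * x) (cong (ℓ *_) (sym (*-identityʳ ℓ))) ⟩
      (ℓ ^ 2) ^ E * ℓ ^ 2 ≡⟨ cong (_* ℓ ^ 2) (^-*-assoc ℓ 2 E) ⟩
      ℓ ^ (2 * E) * ℓ ^ 2 ≡⟨ sym (^-distribˡ-+-* ℓ (2 * E) 2) ⟩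
      ℓ ^ (2 * E + 2) ∎)))
    large : ∀ τ → n ≤ τ ^ E * (ℓ * ℓ) → M₀ * (ℓ * ℓ) ≤ τ
    large τ n≤ = ≮⇒≥ λ τ< → <⇒≱ (proj₂ threshold ℓ (≤-trans (n≤1+n _) L<ℓ)) (begin
      2 ^ ℓ ≤⟨ 2^log≤n n n>0 ⟩
      n ≤⟨ n≤ ⟩
      τ ^ E * (ℓ * ℓ) ≤⟨ *-monoˡ-≤ (ℓ * ℓ) (^-monoˡ-≤ E (<⇒≤ τ<)) ⟩
      (M₀ * (ℓ * ℓ)) ^ E * (ℓ * ℓ) ≡⟨ power M₀ ⟩
      M₀ ^ E * ℓ ^ (2 * E + 2) ∎)
    go : (∃ λ τ → n ≤ τ ^ E * (ℓ * ℓ) × (∀ j → j < τ → ¬ (n ≤ j ^ E * (ℓ * ℓ)))) → _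
    go (zero , n≤ , _) = ⊥-elim (<⇒≱ n>0 n≤)
    go (suc zero , n≤ , _) = ⊥-elim (<⇒≱ (≤-trans (s≤s (s≤s z≤n)) (≤-trans M₀-4 (m≤m*n M₀ (ℓ * ℓ) {{>-nonZero ℓℓ>0}}))) (large 1 n≤))
    go (τ@(suc τ'@(suc _)) , n≤ , minimal) = At.conclusion n ℓ τ ℓ>0 (n<2^[1+log] n) n≤ τ≤ (large τ n≤) n>0 B₂>0
      where
      τ≤ : τ ^ E * (ℓ * ℓ) ≤ 2 ^ E * n
      τ≤ = begin
        τ ^ E * (ℓ * ℓ) ≤⟨ *-monoˡ-≤ (ℓ * ℓ) (^-monoˡ-≤ E (≤-trans (+-monoˡ-≤ τ' {1} {τ'} (s≤s z≤n)) (≤-reflexive (cong (τ' +_) (sym (+-identityʳ τ')))))) ⟩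
        (2 * τ') ^ E * (ℓ * ℓ) ≡⟨ trans (cong (_* (ℓ * ℓ)) (^-distribʳ-* E 2 τ')) (*-assoc (2 ^ E) (τ' ^ E) (ℓ * ℓ)) ⟩
        2 ^ E * (τ' ^ E * (ℓ * ℓ)) ≤⟨ *-monoʳ-≤ (2 ^ E) (<⇒≤ (≰⇒> (minimal τ' ≤-refl))) ⟩
        2 ^ E * n ∎

sumFin≥ : ∀ r s → (∀ i → 1 ≤ s i) → r ≤ sumFin r s
sumFin≥ zero s s>0 = z≤n
sumFin≥ (suc r) s s>0 = +-mono-≤ (s>0 zero) (sumFin≥ r (s ∘ suc) (s>0 ∘ suc))

theorem1p5 : (r : ℕ) → 2 ≤ r → (s : Fin r → ℕ) → (∀ i → 1 ≤ s i) →
    Σ ℕ λ C → Σ ℕ λ N → ∀ n → N ≤ n →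
    Σ (Graph (Fin n)) λ G →
    Free (complete (r + 2)) G ×
    (∀ S → FIndependent (completeMultipartite r s) G S →
    ∣ S ∣ ^ (4 * sumFin r s ∸ 5)
    ≤ C * (n ^ (2 * sumFin r s ∸ 3)) * (⌊log₂ n ⌋ ^ (3 * (4 * sumFin r s ∸ 5))))
theorem1p5 r 2≤r s s>0 = B₂ , 2 ^ suc (proj₁ threshold) , λ n N≤n →
  let Γ , clique-free , small = bounded n N≤n
  in Γ , clique-free , λ S indep → subst₂ (λ E D → ∣ S ∣ ^ E ≤ B₂ * n ^ D * ⌊log₂ n ⌋ ^ (3 * E)) (sym E≡) (sym D≡) (small S indep)
  where
  k₀ d π κ A M₀ : ℕ
  k₀ = sumFin r s ∸ 2
  d = 512 * (r * 4 ^ suc k₀)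
  π = 64 * (r * 4 ^ suc k₀)
  κ = (64 * (r * 4 ^ suc k₀)) ^ suc k₀ * d
  A = 45 * κ * suc k₀ * π
  M₀ = 128 * r * 64 ^ suc k₀ + (32 * r + (16 * A + (9 * 2 ^ (3 + 4 * k₀) + 4)))
  s≡ : sumFin r s ≡ 2 + k₀
  s≡ = sym (m+[n∸m]≡n (≤-trans 2≤r (sumFin≥ r s s>0)))
  open Numerics k₀ d A using (B₂; E; D)
  open Parameters r 2≤r s k₀ s≡ d π κ A M₀ refl refl refl refl
    (m≤m+n _ _)
    (≤-trans (m≤m+n (32 * r) _) (m≤n+m _ (128 * r * 64 ^ suc k₀)))
    (≤-trans (m≤m+n (16 * A) _) (≤-trans (m≤n+m _ (32 * r)) (m≤n+m _ (128 * r * 64 ^ suc k₀))))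
    (≤-trans (m≤m+n (9 * 2 ^ (3 + 4 * k₀)) 4) (≤-trans (m≤n+m _ (16 * A)) (≤-trans (m≤n+m _ (32 * r)) (m≤n+m _ (128 * r * 64 ^ suc k₀)))))
    (≤-trans (m≤n+m 4 (9 * 2 ^ (3 + 4 * k₀))) (≤-trans (m≤n+m _ (16 * A)) (≤-trans (m≤n+m _ (32 * r)) (m≤n+m _ (128 * r * 64 ^ suc k₀)))))
    using (threshold; bounded)
  E≡ : 4 * sumFin r s ∸ 5 ≡ E
  E≡ = trans (cong (λ a → 4 * a ∸ 5) s≡) (trans (cong (_∸ 5) (lem k₀)) (m+n∸m≡n 5 E))
    where
    lem : ∀ a → 4 * (2 + a) ≡ 5 + (3 + 4 * a)
    lem = solve-∀
  D≡ : 2 * sumFin r s ∸ 3 ≡ D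
  D≡ = trans (cong (λ a → 2 * a ∸ 3) s≡) (trans (cong (_∸ 3) (lem k₀)) (m+n∸m≡n 3 D))
    where
    lem : ∀ a → 2 * (2 + a) ≡ 3 + (1 + 2 * a)
    lem = solve-∀
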